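{- Let $m$ be a positive integer. An alcove $\widetilde{w}A_\circ$ is an $m$-Shi alcove (i.e. the minimal alcove of the $m$-Shi region containing it) if and only if $\widetilde{w}\in\widetilde{W}^{mh+1}$.
   Context: $\Phi$ is an irreducible crystallographic root system in a real Euclidean space $V$ with simple roots $\Delta$, positive roots $\Phi^+$, Weyl group $W$, highest root $\theta$; height of $\sum a_i\alpha_i$ is $\sum a_i$; $h=1+\mathrm{ht}(\theta)$. $H_\alpha^k=\{x:\langle x,\alpha\rangle=k\}$. The affine Weyl group $\widetilde{W}=W\ltimes Q^\vee$ is generated by reflections in all $H_\alpha^k$; alcoves $\widetilde{w}A_\circ$ with $A_\circ=\{x:\langle x,\alpha\rangle>0\ \forall\alpha\in\Delta,\ \langle x,\theta\rangle<1\}$. $k(\widetilde{w},\alpha)$ is the integer $k$ with $k<\langle x,\alpha\rangle<k+1$ on $\widetilde{w}A_\circ$. The $m$-Shi hyperplanes are $H_\alpha^k$, $\alpha\in\Phi^+$, $-m<k\le m$; each region $R$ of their complement contains a unique minimal alcove $\widetilde{w}_RA_\circ$ with $|k(\widetilde{w}_R,\alpha)|\le|k(\widetilde{w},\alpha)|$ for all $\alpha\in\Phi^+$ and all alcoves $\widetilde{w}A_\circ\subseteq R$. Affine roots $\alpha+k\delta$ with $wt_\mu(\alpha+k\delta)=w(\alpha)+(k-\langle\mu,\alpha\rangle)\delta$; $\widetilde{\Phi}^+=\{\alpha+k\delta:\alpha\in\Phi^+,k\ge0\}\cup\{\alpha+k\delta:\alpha\in-\Phi^+,k>0\}$; $\mathrm{ht}(\alpha+k\delta)=\mathrm{ht}(\alpha)+kh$;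 $\widetilde{\Phi}_p$ = affine roots of height $p$; $\widetilde{W}^p=\{\widetilde{w}:\widetilde{w}(\widetilde{\Phi}_p)\subseteq\widetilde{\Phi}^+\}$.
   Formalization: The Euclidean space V is taken over the rationals: the inner products of the simple roots are rational, and the points of the fundamental alcove (hence of all alcoves) range over vectors with rational coordinates in the simple roots. -}

module Defs where

open import Data.Nat as ℕ using (ℕ; zero; suc)
open import Data.Integer as ℤ using (ℤ; +_; -[1+_])
open import Data.Rational using (ℚ; 0ℚ; 1ℚ; _+_; _*_; _-_; -_; _/_; _≤_; _<_; 1/_; ≢-nonZero)
open import Data.Rational.Properties using (_≟_)
open import Data.Fin as Fin using (Fin)
open import Data.Vec using (Vec; []; _∷_; lookup; tabulate; map; zipWith; replicate; foldr′)
open import Data.Vec.Relation.Unary.All using (All)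
open import Data.List using (List)
open import Data.List.Membership.Propositional using (_∈_)
open import Data.Bool using (Bool; true; false; if_then_else_)
open import Data.Product using (Σ; _×_; _,_; ∃-syntax)
open import Data.Sum using (_⊎_)
open import Relation.Nullary using (¬_; yes; no; does)
open import Relation.Binary.PropositionalEquality using (_≡_; _≢_)

-- Linear algebra over ℚ.  Vectors of V are written in coordinates with
-- respect to the simple roots Δ = {e₀,…,e_{n-1}} (so V = ℚⁿ and the
-- Euclidean inner product is given by a Gram matrix `form`).

V : ℕ → Set
V n = Vec ℚ n

ℤ→ℚ : ℤ → ℚ
ℤ→ℚ z = z / 1

ℕ→ℚ : ℕ → ℚ
ℕ→ℚ m = + m / 1

2ℚ : ℚ
2ℚ = + 2 / 1

sumF : ∀ {n} → (Fin n → ℚ) → ℚ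
sumF {zero}  f = 0ℚ
sumF {suc n} f = f Fin.zero + sumF (λ i → f (Fin.suc i))

sumV : ∀ {n} → V n → ℚ
sumV = foldr′ _+_ 0ℚ

_⊕_ : ∀ {n} → V n → V n → V n
_⊕_ = zipWith _+_

_⊖_ : ∀ {n} → V n → V n → V n
_⊖_ = zipWith _-_

_·_ : ∀ {n} → ℚ → V n → V n
c · v = map (c *_) v

zeroV : ∀ {n} → V n
zeroV = replicate _ 0ℚ

-- i-th standard basis vector (= i-th simple root in these coordinates)
e : ∀ {n} → Fin n → V n
e i = tabulate (λ j → if does (i Fin.≟ j) then 1ℚ else 0ℚ)

ipG : ∀ {n} → (Fin n → Fin n → ℚ) → V n → V n → ℚ
ipG G x y = sumF (λ i → sumF (λ j → lookup x i * G i j * lookup y j))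

-- totalised reciprocal (only ever applied to nonzero numbers below)
inv : ℚ → ℚ
inv q with q ≟ 0ℚ
... | yes _  = 0ℚ
... | no q≢0 = 1/_ q {{≢-nonZero q≢0}}

IsInt : ℚ → Set
IsInt q = ∃[ z ] q ≡ ℤ→ℚ z

-- An irreducible (reduced, crystallographic) root system Φ in V = ℚⁿ
-- together with a base Δ, which is the standard basis of ℚⁿ.

record RootSystem (n : ℕ) : Set where
  field
    form        : Fin n → Fin n → ℚ
    form-sym    : ∀ i j → form i j ≡ form j i
    form-posdef : ∀ v → v ≢ zeroV → 0ℚ < ipG form v v
    roots       : List (V n)
    roots-nonzero : ∀ {α} → α ∈ roots → α ≢ zeroV
    roots-reflect : ∀ {α β} → α ∈ roots → β ∈ roots →
      ∃[ c ] ((2ℚ * ipG form β α ≡ ℤ→ℚ c * ipG form α α) × ((β ⊖ (ℤ→ℚ c · α)) ∈ roots))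
    roots-reduced : ∀ {α} (c : ℚ) → α ∈ roots → (c · α) ∈ roots → (c ≡ 1ℚ) ⊎ (c ≡ - 1ℚ)
    simple-roots   : ∀ i → e i ∈ roots
    roots-integral : ∀ {α} → α ∈ roots → All IsInt α
    roots-sign     : ∀ {α} → α ∈ roots → All (0ℚ ≤_) α ⊎ All (_≤ 0ℚ) α
    irreducible : ∀ (S : V n → Bool) →
      (∀ {α β} → α ∈ roots → β ∈ roots → S α ≡ true → S β ≡ false → ipG form α β ≡ 0ℚ) →
      (∀ {α} → α ∈ roots → S α ≡ true) ⊎ (∀ {α} → α ∈ roots → S α ≡ false)

module _ {n : ℕ} (Φ : RootSystem n) where
  open RootSystem Φ

  ⟪_,_⟫ : V n → V n → ℚ
  ⟪ x , y ⟫ = ipG form x y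

  ht : V n → ℚ
  ht = sumV

  PosRoot : V n → Set
  PosRoot α = α ∈ roots × All (0ℚ ≤_) α

  NegRoot : V n → Set
  NegRoot α = α ∈ roots × All (_≤ 0ℚ) α

  IsHighest : V n → Set
  IsHighest θ = PosRoot θ × (∀ {α} → α ∈ roots → ht α ≤ ht θ)

  cox : V n → ℚ
  cox θ = 1ℚ + ht θ

  sref : Fin n → V n → V n
  sref i x = x ⊖ ((2ℚ * ⟪ x , e i ⟫ * inv (form i i)) · e i)

  -- an element of W given as a word i₁ i₂ … i_k, meaning s_{i₁} s_{i₂} ⋯ s_{i_k}
  wact : List (Fin n) → V n → V n
  wact List.[] x = x
  wact (i List.∷ w) x = sref i (wact w x)

  -- elements w t_μ of W̃ = W ⋉ Q^∨, μ = Σ c_i α_i^∨ given by c ∈ ℤⁿ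
  AffW : Set
  AffW = List (Fin n) × Vec ℤ n

  -- μ = Σ c_i α_i^∨,  α_i^∨ = 2 α_i / ⟨α_i,α_i⟩
  coweight : Vec ℤ n → V n
  coweight c = tabulate (λ i → ℤ→ℚ (lookup c i) * 2ℚ * inv (form i i))

  act : AffW → V n → V n
  act (w , c) x = wact w (x ⊕ coweight c)

  -- action on affine roots: w t_μ (α + kδ) = w(α) + (k - ⟨μ,α⟩) δ
  affAct : AffW → V n → ℚ → V n × ℚ
  affAct (w , c) α k = wact w α , (k - ⟪ coweight c , α ⟫)

  PosAff : V n × ℚ → Set
  PosAff (β , j) = (PosRoot β × 0ℚ ≤ j) ⊎ (NegRoot β × 0ℚ < j)

  -- W̃^p : w̃ maps every affine root of height p to a positive affine root
  -- (height of α + kδ is ht α + k h)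
  InWp : V n → ℚ → AffW → Set
  InWp θ p w̃ = ∀ (α : V n) (k : ℤ) → α ∈ roots →
    ht α + ℤ→ℚ k * cox θ ≡ p → PosAff (affAct w̃ α (ℤ→ℚ k))

  -- fundamental alcove A∘ (rational points)
  InA : V n → V n → Set
  InA θ x = (∀ i → 0ℚ < ⟪ x , e i ⟫) × (⟪ x , θ ⟫ < 1ℚ)

  KVal : V n → AffW → V n → ℤ → Set
  KVal θ w̃ α k = ∀ x → InA θ x →
    (ℤ→ℚ k < ⟪ act w̃ x , α ⟫) × (⟪ act w̃ x , α ⟫ < ℤ→ℚ (k ℤ.+ + 1))

  -- the alcoves w̃A∘ and w̃′A∘ lie in the same region of the m-Shi
  -- arrangement {H_α^j : α ∈ Φ⁺, -m < j ≤ m}, i.e. on the same side of each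
  -- of its hyperplanes
  SameRegion : V n → ℕ → AffW → AffW → Set
  SameRegion θ m w̃ w̃′ = ∀ α → PosRoot α → ∀ (j : ℤ) → ℤ.- (+ m) ℤ.< j → j ℤ.≤ + m →
    ∀ x y → InA θ x → InA θ y →
    ((⟪ act w̃ x , α ⟫ < ℤ→ℚ j) → (⟪ act w̃′ y , α ⟫ < ℤ→ℚ j)) ×
    ((⟪ act w̃′ y , α ⟫ < ℤ→ℚ j) → (⟪ act w̃ x , α ⟫ < ℤ→ℚ j))

  -- w̃A∘ is an m-Shi alcove: the minimal alcove of its m-Shi region, i.e.
  -- |k(w̃,α)| ≤ |k(w̃′,α)| for all α ∈ Φ⁺ and all alcoves w̃′A∘ in that region
  IsShiAlcove : V n → ℕ → AffW → Set
  IsShiAlcove θ m w̃ = ∀ w̃′ → SameRegion θ m w̃ w̃′ → ∀ α → PosRoot α →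
    ∀ k k′ → KVal θ w̃ α k → KVal θ w̃′ α k′ → ℤ.∣ k ∣ ℕ.≤ ℤ.∣ k′ ∣

module Submission where

open import Defs
open import Data.Bool using (Bool; true; false; if_then_else_)
open import Data.Empty using (⊥; ⊥-elim)
open import Data.Fin as Fin using (Fin)
open import Data.Fin.Properties using (any?)
open import Data.Integer as ℤ using (ℤ; -[1+_])
import Data.Integer.Properties as ℤ
open import Data.List as List using (List)
open import Data.List.Membership.Propositional using (_∈_)
open import Data.Maybe using (Maybe; just; nothing)
open import Data.Nat as ℕ using (ℕ; zero; suc)
import Data.Nat.Properties as ℕ
open import Data.Product using (_×_; _,_; ∃; ∃-syntax; proj₁; proj₂)
open import Data.Rational
open import Data.Rational.Properties
open import Data.Rational.Solver using (module +-*-Solver)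
import Data.Rational.Unnormalised as ℚᵘ
import Data.Rational.Unnormalised.Properties as ℚᵘ
open import Data.Sum using (_⊎_; inj₁; inj₂; [_,_]′)
open import Data.Vec as Vec using (Vec; []; _∷_; head; lookup; tabulate; tail)
open import Data.Vec.Properties using (∷-injective; lookup∘tabulate; lookup-map; lookup-replicate; lookup-zipWith; ≡-dec)
open import Data.Vec.Relation.Unary.All as All using (All; []; _∷_)
open import Function using (_∘_)
open import Function.Bundles using (_⇔_; mk⇔)
open import Relation.Binary.Definitions using (tri<; tri≈; tri>)
open import Relation.Binary.PropositionalEquality
open import Relation.Nullary using (¬_; Dec; yes; no; does)
open import Relation.Nullary.Decidable using (_×-dec_; ¬?; decidable-stable)
open +-*-Solver

-- Write α + kδ as k ∷ α.  It is a positive affine root iff its height ht α + k h is positive, and it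
-- has height > m h iff its hyperplane is not an m-Shi hyperplane.  Applied to the affine simple roots
-- (the roots of height 1, shifted by mδ), w̃ ∈ W̃^{mh+1} therefore says that every floor of w̃A∘, i.e.
-- every wall separating it from A∘, is an m-Shi hyperplane.
--
-- If some floor is not, reflecting w̃A∘ in it stays in the region and lowers one |k(w̃,α)|.
--
-- Conversely let all floors of w̃A∘ be Shi and let w̃′A∘ lie in the same region.  Suppose some
-- inversion a of w̃ is not one of w̃′, and take it with -ht(w̃⁻¹a) minimal: then a has height > m h
-- and is not a sum of two inversions.  No such root exists, by induction on -ht(w̃⁻¹a): pick an
-- affine simple root b with (w̃⁻¹a, b) < 0.  If w̃b < 0, then -w̃b is a floor and either a splits as
-- (a + w̃b) + (-w̃b) or the floor is at least as high as a, hence not Shi.  If w̃b > 0, then a + w̃b is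
-- again an inversion, and the lowest inversion a + e with e a positive non-inversion is again
-- indecomposable.  So the inversions of w̃ are inversions of w̃′, which is minimality.

-- The alcoves enter the main induction only through the point ρ^∨/h of A∘. There the affine
-- function of an affine root is its height divided by h, so the side of a hyperplane on which w̃A∘
-- lies is the sign of ht(w̃⁻¹a). A∘, w̃A∘ and w̃′A∘ become three linear functionals on one set of
-- vectors, each of absolute value at least 1 on it; reduced words and the geometry of regions do
-- not appear.
--
-- Two obstacles shape the induction. The argument that a + e is indecomposable excludes lower
-- candidates first, so a + w̃b itself will not do and only starts the search. Passing to the lowest
-- a + e raises ht(w̃⁻¹a) towards 0, which drives the induction, and raises ht a, which preserves
-- the bound m h. Secondly, affine roots at an acute angle may differ by a multiple of δ, which is
-- isotropic; w̃ fixes these multiples, so they are never inversions and (c, c) > 0 holds for every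
-- inversion c.
--
-- Irreducibility supplies b: it makes all coefficients of θ positive, so only 0 has no acute angle
-- with any affine simple root.
--
-- For the reflected alcove, s_θ and θ^∨ must be written as a word in W and an integral vector of
-- Q^∨.

-- Inequalities in the ordered field of rationals

<⇒≱ : ∀ {p q} → p < q → ¬ q ≤ p
<⇒≱ p<q q≤p = <-irrefl refl (<-≤-trans p<q q≤p)

-- An inequality passes between pairs with the same difference, which turns the linear arithmetic
-- below into ring identities for the solver.
≤-by : ∀ {p q r s} → p ≤ q → q - p ≡ s - r → r ≤ s
≤-by {p} {q} {r} {s} p≤q eq = subst₂ _≤_
  (solve 2 (λ p r → p :+ (r :- p) := r) refl p r)
  (trans (solve 3 (λ p q r → q :+ (r :- p) := r :+ (q :- p)) refl p q r)
    (trans (cong (r +_) eq) (solve 2 (λ r s → r :+ (s :- r) := s) refl r s)))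
  (+-monoˡ-≤ (r - p) p≤q)

<-by : ∀ {p q r s} → p < q → q - p ≡ s - r → r < s
<-by {p} {q} {r} {s} p<q eq = ≰⇒> λ s≤r → <⇒≱ p<q (≤-by s≤r
  (trans (solve 2 (λ r s → r :- s := :- (s :- r)) refl r s)
    (trans (cong -_ (sym eq)) (solve 2 (λ p q → :- (q :- p) := p :- q) refl p q))))

0≤⇒≤ : ∀ {p q} → 0ℚ ≤ q - p → p ≤ q
0≤⇒≤ {p} {q} h = ≤-by h (solve 2 (λ p q → (q :- p) :- con 0ℚ := q :- p) refl p q)

0<⇒< : ∀ {p q} → 0ℚ < q - p → p < q
0<⇒< {p} {q} h = <-by h (solve 2 (λ p q → (q :- p) :- con 0ℚ := q :- p) refl p q)

≤⇒0≤ : ∀ {p q} → p ≤ q → 0ℚ ≤ q - p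
≤⇒0≤ {p} {q} h = ≤-by h (solve 2 (λ p q → q :- p := (q :- p) :- con 0ℚ) refl p q)

<⇒0< : ∀ {p q} → p < q → 0ℚ < q - p
<⇒0< {p} {q} h = <-by h (solve 2 (λ p q → q :- p := (q :- p) :- con 0ℚ) refl p q)

neg-0< : ∀ {p} → p < 0ℚ → 0ℚ < - p
neg-0< {p} h = <-by h (solve 1 (λ p → con 0ℚ :- p := :- p :- con 0ℚ) refl p)

neg-<0 : ∀ {p} → 0ℚ < p → - p < 0ℚ
neg-<0 {p} h = <-by h (solve 1 (λ p → p :- con 0ℚ := con 0ℚ :- (:- p)) refl p)

neg-0≤ : ∀ {p} → p ≤ 0ℚ → 0ℚ ≤ - p
neg-0≤ {p} h = ≤-by h (solve 1 (λ p → con 0ℚ :- p := :- p :- con 0ℚ) refl p)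

neg-≤0 : ∀ {p} → 0ℚ ≤ p → - p ≤ 0ℚ
neg-≤0 {p} h = ≤-by h (solve 1 (λ p → p :- con 0ℚ := con 0ℚ :- (:- p)) refl p)

*-0≤ : ∀ {p q} → 0ℚ ≤ p → 0ℚ ≤ q → 0ℚ ≤ p * q
*-0≤ {p} {q} hp hq = nonNegative⁻¹ (p * q)
  {{nonNeg*nonNeg⇒nonNeg p {{nonNegative hp}} q {{nonNegative hq}}}}

*-0< : ∀ {p q} → 0ℚ < p → 0ℚ < q → 0ℚ < p * q
*-0< {p} {q} hp hq = positive⁻¹ (p * q) {{pos*pos⇒pos p {{positive hp}} q {{positive hq}}}}

*-≤0 : ∀ {p q} → 0ℚ ≤ p → q ≤ 0ℚ → p * q ≤ 0ℚ
*-≤0 {p} {q} hp hq = ≤-by (*-0≤ hp (neg-0≤ hq))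
  (solve 2 (λ p q → p :* :- q :- con 0ℚ := con 0ℚ :- p :* q) refl p q)

*-<0 : ∀ {p q} → 0ℚ < p → q < 0ℚ → p * q < 0ℚ
*-<0 {p} {q} hp hq = <-by (*-0< hp (neg-0< hq))
  (solve 2 (λ p q → p :* :- q :- con 0ℚ := con 0ℚ :- p :* q) refl p q)

*-cancel-0< : ∀ {p} q → 0ℚ < p → 0ℚ < q * p → 0ℚ < q
*-cancel-0< {p} q hp h = ≰⇒> λ q≤0 → <⇒≱ h (subst (_≤ 0ℚ) (*-comm p q) (*-≤0 (<⇒≤ hp) q≤0))

*-cancel-0≤ : ∀ {p} q → 0ℚ < p → 0ℚ ≤ q * p → 0ℚ ≤ q
*-cancel-0≤ {p} q hp h = ≮⇒≥ λ q<0 → <⇒≱ (subst (_< 0ℚ) (*-comm p q) (*-<0 hp q<0)) h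

*-cancelʳ-≡ : ∀ {p q r} → r ≢ 0ℚ → p * r ≡ q * r → p ≡ q
*-cancelʳ-≡ {p} {q} {r} r≢0 eq = begin
  p               ≡⟨ sym (*-identityʳ p) ⟩
  p * 1ℚ          ≡⟨ cong (p *_) (sym (*-inverseʳ r)) ⟩
  p * (r * 1/ r)  ≡⟨ sym (*-assoc p r (1/ r)) ⟩
  p * r * 1/ r    ≡⟨ cong (_* 1/ r) eq ⟩
  q * r * 1/ r    ≡⟨ *-assoc q r (1/ r) ⟩
  q * (r * 1/ r)  ≡⟨ cong (q *_) (*-inverseʳ r) ⟩
  q * 1ℚ          ≡⟨ *-identityʳ q ⟩
  q               ∎
  where
  open ≡-Reasoning
  instance
    r-nonZero : NonZero r
    r-nonZero = ≢-nonZero r≢0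

inv-inverseʳ : ∀ {p} → p ≢ 0ℚ → p * inv p ≡ 1ℚ
inv-inverseʳ {p} p≢0 with p ≟ 0ℚ
... | yes p≡0 = ⊥-elim (p≢0 p≡0)
... | no  p≢0 = *-inverseʳ p {{≢-nonZero p≢0}}

0<inv : ∀ {p} → 0ℚ < p → 0ℚ < inv p
0<inv {p} 0<p = *-cancel-0< (inv p) 0<p (subst (0ℚ <_)
  (trans (sym (inv-inverseʳ (λ p≡0 → <-irrefl (sym p≡0) 0<p))) (*-comm p (inv p)))
  (positive⁻¹ 1ℚ))

-- Integral rationals

ℤ→ℚ-toℚᵘ : ∀ i → toℚᵘ (ℤ→ℚ i) ℚᵘ.≃ ℚᵘ.mkℚᵘ i 0
ℤ→ℚ-toℚᵘ i = toℚᵘ-fromℚᵘ (ℚᵘ.mkℚᵘ i 0)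

ℤ→ℚ-+ : ∀ i j → ℤ→ℚ (i ℤ.+ j) ≡ ℤ→ℚ i + ℤ→ℚ j
ℤ→ℚ-+ i j = toℚᵘ-injective (begin
  toℚᵘ (ℤ→ℚ (i ℤ.+ j))                  ≈⟨ ℤ→ℚ-toℚᵘ (i ℤ.+ j) ⟩
  ℚᵘ.mkℚᵘ (i ℤ.+ j) 0                    ≡⟨ cong (λ k → ℚᵘ.mkℚᵘ k 0)
    (sym (cong₂ ℤ._+_ (ℤ.*-identityʳ i) (ℤ.*-identityʳ j))) ⟩
  ℚᵘ.mkℚᵘ i 0 ℚᵘ.+ ℚᵘ.mkℚᵘ j 0          ≈⟨ ℚᵘ.+-cong (ℚᵘ.≃-sym (ℤ→ℚ-toℚᵘ i)) (ℚᵘ.≃-sym (ℤ→ℚ-toℚᵘ j)) ⟩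
  toℚᵘ (ℤ→ℚ i) ℚᵘ.+ toℚᵘ (ℤ→ℚ j)        ≈⟨ ℚᵘ.≃-sym (toℚᵘ-homo-+ (ℤ→ℚ i) (ℤ→ℚ j)) ⟩
  toℚᵘ (ℤ→ℚ i + ℤ→ℚ j)                  ∎)
  where open ℚᵘ.≃-Reasoning

ℤ→ℚ-* : ∀ i j → ℤ→ℚ (i ℤ.* j) ≡ ℤ→ℚ i * ℤ→ℚ j
ℤ→ℚ-* i j = toℚᵘ-injective (begin
  toℚᵘ (ℤ→ℚ (i ℤ.* j))                  ≈⟨ ℤ→ℚ-toℚᵘ (i ℤ.* j) ⟩
  ℚᵘ.mkℚᵘ i 0 ℚᵘ.* ℚᵘ.mkℚᵘ j 0          ≈⟨ ℚᵘ.*-cong (ℚᵘ.≃-sym (ℤ→ℚ-toℚᵘ i)) (ℚᵘ.≃-sym (ℤ→ℚ-toℚᵘ j)) ⟩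
  toℚᵘ (ℤ→ℚ i) ℚᵘ.* toℚᵘ (ℤ→ℚ j)        ≈⟨ ℚᵘ.≃-sym (toℚᵘ-homo-* (ℤ→ℚ i) (ℤ→ℚ j)) ⟩
  toℚᵘ (ℤ→ℚ i * ℤ→ℚ j)                  ∎)
  where open ℚᵘ.≃-Reasoning

ℤ→ℚ-neg : ∀ i → ℤ→ℚ (ℤ.- i) ≡ - ℤ→ℚ i
ℤ→ℚ-neg i = begin
  ℤ→ℚ (ℤ.- i)                        ≡⟨ solve 2 (λ a b → a := (a :+ b) :- b) refl (ℤ→ℚ (ℤ.- i)) (ℤ→ℚ i) ⟩
  (ℤ→ℚ (ℤ.- i) + ℤ→ℚ i) - ℤ→ℚ i      ≡⟨ cong (_- ℤ→ℚ i) (sym (ℤ→ℚ-+ (ℤ.- i) i)) ⟩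
  ℤ→ℚ (ℤ.- i ℤ.+ i) - ℤ→ℚ i          ≡⟨ cong (λ k → ℤ→ℚ k - ℤ→ℚ i) (ℤ.+-inverseˡ i) ⟩
  0ℚ - ℤ→ℚ i                         ≡⟨ +-identityˡ (- ℤ→ℚ i) ⟩
  - ℤ→ℚ i                            ∎
  where open ≡-Reasoning

ℤ→ℚ-mono-≤ : ∀ {i j} → i ℤ.≤ j → ℤ→ℚ i ≤ ℤ→ℚ j
ℤ→ℚ-mono-≤ {i} {j} i≤j = toℚᵘ-cancel-≤
  (ℚᵘ.≤-respˡ-≃ (ℚᵘ.≃-sym (ℤ→ℚ-toℚᵘ i)) (ℚᵘ.≤-respʳ-≃ (ℚᵘ.≃-sym (ℤ→ℚ-toℚᵘ j))
    (ℚᵘ.*≤* (subst₂ ℤ._≤_ (sym (ℤ.*-identityʳ i)) (sym (ℤ.*-identityʳ j)) i≤j))))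

ℤ→ℚ-mono-< : ∀ {i j} → i ℤ.< j → ℤ→ℚ i < ℤ→ℚ j
ℤ→ℚ-mono-< {i} {j} i<j = toℚᵘ-cancel-<
  (ℚᵘ.<-respˡ-≃ (ℚᵘ.≃-sym (ℤ→ℚ-toℚᵘ i)) (ℚᵘ.<-respʳ-≃ (ℚᵘ.≃-sym (ℤ→ℚ-toℚᵘ j))
    (ℚᵘ.*<* (subst₂ ℤ._<_ (sym (ℤ.*-identityʳ i)) (sym (ℤ.*-identityʳ j)) i<j))))

ℤ→ℚ-cancel-< : ∀ {i j} → ℤ→ℚ i < ℤ→ℚ j → i ℤ.< j
ℤ→ℚ-cancel-< h = ℤ.≰⇒> λ j≤i → <⇒≱ h (ℤ→ℚ-mono-≤ j≤i)

ℤ→ℚ-cancel-≤ : ∀ {i j} → ℤ→ℚ i ≤ ℤ→ℚ j → i ℤ.≤ j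
ℤ→ℚ-cancel-≤ h = ℤ.≮⇒≥ λ j<i → <⇒≱ (ℤ→ℚ-mono-< j<i) h

ℤ→ℚ-injective : ∀ {i j} → ℤ→ℚ i ≡ ℤ→ℚ j → i ≡ j
ℤ→ℚ-injective eq = ℤ.≤-antisym (ℤ→ℚ-cancel-≤ (≤-reflexive eq)) (ℤ→ℚ-cancel-≤ (≤-reflexive (sym eq)))

IsInt-0 : IsInt 0ℚ
IsInt-0 = ℤ.+ 0 , refl

IsInt-1 : IsInt 1ℚ
IsInt-1 = ℤ.+ 1 , refl

IsInt-+ : ∀ {p q} → IsInt p → IsInt q → IsInt (p + q)
IsInt-+ (i , refl) (j , refl) = i ℤ.+ j , sym (ℤ→ℚ-+ i j)

IsInt-* : ∀ {p q} → IsInt p → IsInt q → IsInt (p * q)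
IsInt-* (i , refl) (j , refl) = i ℤ.* j , sym (ℤ→ℚ-* i j)

IsInt-neg : ∀ {p} → IsInt p → IsInt (- p)
IsInt-neg (i , refl) = ℤ.- i , sym (ℤ→ℚ-neg i)

IsInt-- : ∀ {p q} → IsInt p → IsInt q → IsInt (p - q)
IsInt-- p q = IsInt-+ p (IsInt-neg q)

IsInt-1≤ : ∀ {p} → IsInt p → 0ℚ < p → 1ℚ ≤ p
IsInt-1≤ (i , refl) h = ℤ→ℚ-mono-≤ (ℤ.i<j⇒suc[i]≤j (ℤ→ℚ-cancel-< {ℤ.+ 0} {i} h))

IsInt-≤-1 : ∀ {p} → IsInt p → p < 0ℚ → p ≤ - 1ℚ
IsInt-≤-1 {p} hp h = ≤-by (IsInt-1≤ (IsInt-neg hp) (neg-0< h))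
  (solve 1 (λ p → :- p :- con 1ℚ := :- con 1ℚ :- p) refl p)

-- A fraction is at most the absolute value of its numerator. The bound lets inductions on a
-- rational height run on a natural number.
≤-ℕ : ∀ p → ∃[ n ] p ≤ ℕ→ℚ n
≤-ℕ p@(mkℚ i d _) = ℤ.∣ i ∣ , toℚᵘ-cancel-≤ (ℚᵘ.≤-respʳ-≃ (ℚᵘ.≃-sym (ℤ→ℚ-toℚᵘ (ℤ.+ ℤ.∣ i ∣)))
  (ℚᵘ.*≤* (bound i d)))
  where
  bound : ∀ i d → i ℤ.* ℤ.+ 1 ℤ.≤ ℤ.+ ℤ.∣ i ∣ ℤ.* ℤ.+ suc d
  bound (ℤ.+ n) d = subst₂ ℤ._≤_ (sym (ℤ.*-identityʳ (ℤ.+ n))) (ℤ.pos-* n (suc d))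
    (ℤ.+≤+ (ℕ.m≤m*n n (suc d)))
  bound -[1+ n ] d = subst (ℤ._≤ ℤ.+ suc n ℤ.* ℤ.+ suc d) (sym (ℤ.*-identityʳ -[1+ n ])) ℤ.-≤+

ℕ→ℚ-suc : ∀ n → ℕ→ℚ (suc n) ≡ 1ℚ + ℕ→ℚ n
ℕ→ℚ-suc n = ℤ→ℚ-+ (ℤ.+ 1) (ℤ.+ n)

IsInt-≡1⊎2≤ : ∀ {p} → IsInt p → 0ℚ < p → p ≡ 1ℚ ⊎ 2ℚ ≤ p
IsInt-≡1⊎2≤ (i , refl) h with ℤ.<-cmp (ℤ.+ 1) i
... | tri< 1<i _ _  = inj₂ (ℤ→ℚ-mono-≤ {ℤ.+ 2} {i} (ℤ.i<j⇒suc[i]≤j 1<i))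
... | tri≈ _ refl _ = inj₁ refl
... | tri> _ _ i<1  = ⊥-elim (ℤ.<⇒≱ i<1 (ℤ.i<j⇒suc[i]≤j (ℤ→ℚ-cancel-< {ℤ.+ 0} {i} h)))

-- Vectors and bilinear forms

+-interchange : ∀ a b c d → (a + b) + (c + d) ≡ (a + c) + (b + d)
+-interchange = solve 4 (λ a b c d → (a :+ b) :+ (c :+ d) := (a :+ c) :+ (b :+ d)) refl

sumF-cong : ∀ {n} {f g : Fin n → ℚ} → (∀ i → f i ≡ g i) → sumF f ≡ sumF g
sumF-cong {zero}  eq = refl
sumF-cong {suc n} eq = cong₂ _+_ (eq Fin.zero) (sumF-cong (λ i → eq (Fin.suc i)))

sumF-0 : ∀ n → sumF {n} (λ _ → 0ℚ) ≡ 0ℚ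
sumF-0 zero    = refl
sumF-0 (suc n) = trans (+-identityˡ _) (sumF-0 n)

sumF-+ : ∀ {n} (f g : Fin n → ℚ) → sumF (λ i → f i + g i) ≡ sumF f + sumF g
sumF-+ {zero}  f g = refl
sumF-+ {suc n} f g = trans (cong (f Fin.zero + g Fin.zero +_) (sumF-+ (λ i → f (Fin.suc i))
  (λ i → g (Fin.suc i))))
  (+-interchange (f Fin.zero) (g Fin.zero) (sumF (λ i → f (Fin.suc i))) (sumF (λ i → g (Fin.suc i))))

sumF-* : ∀ {n} c (f : Fin n → ℚ) → sumF (λ i → c * f i) ≡ c * sumF f
sumF-* {zero}  c f = sym (*-zeroʳ c)
sumF-* {suc n} c f = trans (cong (c * f Fin.zero +_) (sumF-* c (λ i → f (Fin.suc i))))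
  (sym (*-distribˡ-+ c (f Fin.zero) (sumF (λ i → f (Fin.suc i)))))

sumF-swap : ∀ {m n} (f : Fin m → Fin n → ℚ) → sumF (λ i → sumF (f i)) ≡ sumF (λ j → sumF (λ i → f i j))
sumF-swap {zero}  {n} f = sym (sumF-0 n)
sumF-swap {suc m} f = trans (cong (sumF (f Fin.zero) +_) (sumF-swap (λ i → f (Fin.suc i))))
  (sym (sumF-+ (f Fin.zero) (λ j → sumF (λ i → f (Fin.suc i) j))))

sumF-0≤ : ∀ {n} {f : Fin n → ℚ} → (∀ i → 0ℚ ≤ f i) → 0ℚ ≤ sumF f
sumF-0≤ {zero}  h = ≤-refl
sumF-0≤ {suc n} h = +-mono-≤ (h Fin.zero) (sumF-0≤ (λ i → h (Fin.suc i)))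

sumF-0< : ∀ {n} {f : Fin n → ℚ} → (∀ i → 0ℚ ≤ f i) → ∀ i → 0ℚ < f i → 0ℚ < sumF f
sumF-0< h Fin.zero    p = +-mono-<-≤ p (sumF-0≤ (λ i → h (Fin.suc i)))
sumF-0< h (Fin.suc i) p = +-mono-≤-< (h Fin.zero) (sumF-0< (λ i → h (Fin.suc i)) i p)

sumF-∃0< : ∀ {n} {f : Fin n → ℚ} → 0ℚ < sumF f → ∃[ i ] 0ℚ < f i
sumF-∃0< {zero}  h = ⊥-elim (<-irrefl refl h)
sumF-∃0< {suc n} {f} h with 0ℚ <? f Fin.zero
... | yes p = Fin.zero , p
... | no ¬p with sumF-∃0< {n} {λ i → f (Fin.suc i)} (≰⇒> λ q → <⇒≱ h (+-mono-≤ (≮⇒≥ ¬p) q))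
...   | i , p = Fin.suc i , p

sumF-∃≢0 : ∀ {n} {f : Fin n → ℚ} → sumF f ≢ 0ℚ → ∃[ i ] f i ≢ 0ℚ
sumF-∃≢0 {zero}  h = ⊥-elim (h refl)
sumF-∃≢0 {suc n} {f} h with f Fin.zero ≟ 0ℚ
... | no ¬p = Fin.zero , ¬p
... | yes p with sumF-∃≢0 {n} {λ i → f (Fin.suc i)} (λ q → h (cong₂ _+_ p q))
...   | i , q = Fin.suc i , q

δ : ∀ {n} → Fin n → Fin n → ℚ
δ i j = if does (i Fin.≟ j) then 1ℚ else 0ℚ

δ-suc : ∀ {n} (i j : Fin n) → δ (Fin.suc i) (Fin.suc j) ≡ δ i j
δ-suc i j with i Fin.≟ j
... | yes _ = refl
... | no  _ = refl

δ-refl : ∀ {n} (i : Fin n) → δ i i ≡ 1ℚ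
δ-refl i with i Fin.≟ i
... | yes _ = refl
... | no ¬p = ⊥-elim (¬p refl)

δ-≢ : ∀ {n} {i j : Fin n} → i ≢ j → δ i j ≡ 0ℚ
δ-≢ {i = i} {j} i≢j with i Fin.≟ j
... | yes p = ⊥-elim (i≢j p)
... | no  _ = refl

sumF-δ : ∀ {n} (i : Fin n) (f : Fin n → ℚ) → sumF (λ j → f j * δ i j) ≡ f i
sumF-δ {suc n} Fin.zero f = trans
  (cong₂ _+_ (*-identityʳ (f Fin.zero)) (trans (sumF-cong (λ j → *-zeroʳ (f (Fin.suc j)))) (sumF-0 n)))
  (+-identityʳ (f Fin.zero))
sumF-δ {suc n} (Fin.suc i) f = trans
  (cong₂ _+_ (*-zeroʳ (f Fin.zero)) (trans (sumF-cong (λ j → cong (f (Fin.suc j) *_) (δ-suc i j)))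
    (sumF-δ i (λ j → f (Fin.suc j)))))
  (+-identityˡ (f (Fin.suc i)))

vec-ext : ∀ {n} {u v : V n} → (∀ i → lookup u i ≡ lookup v i) → u ≡ v
vec-ext {u = []}    {[]}    eq = refl
vec-ext {u = _ ∷ _} {_ ∷ _} eq = cong₂ _∷_ (eq Fin.zero) (vec-ext (λ i → eq (Fin.suc i)))

⊝_ : ∀ {n} → V n → V n
⊝ v = (- 1ℚ) · v

lookup-⊕ : ∀ {n} (u v : V n) i → lookup (u ⊕ v) i ≡ lookup u i + lookup v i
lookup-⊕ u v i = lookup-zipWith _+_ i u v

lookup-⊖ : ∀ {n} (u v : V n) i → lookup (u ⊖ v) i ≡ lookup u i - lookup v i
lookup-⊖ u v i = lookup-zipWith _-_ i u v

lookup-· : ∀ {n} c (v : V n) i → lookup (c · v) i ≡ c * lookup v i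
lookup-· c v i = lookup-map i (c *_) v

lookup-e : ∀ {n} (i j : Fin n) → lookup (e i) j ≡ δ i j
lookup-e i j = lookup∘tabulate (δ i) j

lookup-zeroV : ∀ {n} (i : Fin n) → lookup (zeroV {n}) i ≡ 0ℚ
lookup-zeroV i = lookup-replicate i 0ℚ

⊕-comm : ∀ {n} (u v : V n) → u ⊕ v ≡ v ⊕ u
⊕-comm []      []      = refl
⊕-comm (x ∷ u) (y ∷ v) = cong₂ _∷_ (+-comm x y) (⊕-comm u v)

⊖-def : ∀ {n} (u v : V n) → u ⊖ v ≡ u ⊕ (⊝ v)
⊖-def []      []      = refl
⊖-def (x ∷ u) (y ∷ v) = cong₂ _∷_ (solve 2 (λ x y → x :- y := x :+ (:- con 1ℚ) :* y) refl x y) (⊖-def u v)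

⊖-self : ∀ {n} (u : V n) → u ⊖ u ≡ zeroV
⊖-self []      = refl
⊖-self (x ∷ u) = cong₂ _∷_ (+-inverseʳ x) (⊖-self u)

⊖≡0⇒≡ : ∀ {n} {u v : V n} → u ⊖ v ≡ zeroV → u ≡ v
⊖≡0⇒≡ {u = []}    {[]}    eq = refl
⊖≡0⇒≡ {u = x ∷ u} {y ∷ v} eq with ∷-injective eq
... | p , q = cong₂ _∷_ (trans (solve 2 (λ x y → x := (x :- y) :+ y) refl x y)
  (trans (cong (_+ y) p) (+-identityˡ y))) (⊖≡0⇒≡ q)

1· : ∀ {n} (u : V n) → 1ℚ · u ≡ u
1· []      = refl
1· (x ∷ u) = cong₂ _∷_ (*-identityˡ x) (1· u)

0· : ∀ {n} (u : V n) → 0ℚ · u ≡ zeroV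
0· []      = refl
0· (x ∷ u) = cong₂ _∷_ (*-zeroˡ x) (0· u)

⊝-involutive : ∀ {n} (u : V n) → ⊝ (⊝ u) ≡ u
⊝-involutive []      = refl
⊝-involutive (x ∷ u) = cong₂ _∷_ (solve 1 (λ x → (:- con 1ℚ) :* ((:- con 1ℚ) :* x) := x) refl x)
  (⊝-involutive u)

⊝-⊖ : ∀ {n} (u v : V n) → ⊝ (u ⊖ v) ≡ v ⊖ u
⊝-⊖ []      []      = refl
⊝-⊖ (x ∷ u) (y ∷ v) = cong₂ _∷_ (solve 2 (λ x y → (:- con 1ℚ) :* (x :- y) := y :- x) refl x y) (⊝-⊖ u v)

⊖-cancel : ∀ {n} (u v : V n) → (u ⊖ v) ⊖ u ≡ ⊝ v
⊖-cancel []      []      = refl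
⊖-cancel (x ∷ u) (y ∷ v) = cong₂ _∷_ (solve 2 (λ x y → (x :- y) :- x := (:- con 1ℚ) :* y) refl x y)
  (⊖-cancel u v)

⊖-⊕-cancel : ∀ {n} (u v : V n) → u ≡ (u ⊖ v) ⊕ v
⊖-⊕-cancel []      []      = refl
⊖-⊕-cancel (x ∷ u) (y ∷ v) = cong₂ _∷_ (solve 2 (λ x y → x := (x :- y) :+ y) refl x y) (⊖-⊕-cancel u v)

⊕-⊖-cancel : ∀ {n} (u v : V n) → u ≡ v ⊕ (u ⊖ v)
⊕-⊖-cancel []      []      = refl
⊕-⊖-cancel (x ∷ u) (y ∷ v) = cong₂ _∷_ (solve 2 (λ x y → x := y :+ (x :- y)) refl x y) (⊕-⊖-cancel u v)

record Linear {n} (f : V n → ℚ) : Set where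
  field
    map-⊕ : ∀ u v → f (u ⊕ v) ≡ f u + f v
    map-· : ∀ c v → f (c · v) ≡ c * f v

  map-⊝ : ∀ v → f (⊝ v) ≡ - f v
  map-⊝ v = trans (map-· (- 1ℚ) v) (solve 1 (λ x → (:- con 1ℚ) :* x := :- x) refl (f v))

  map-⊖ : ∀ u v → f (u ⊖ v) ≡ f u - f v
  map-⊖ u v = trans (cong f (⊖-def u v)) (trans (map-⊕ u (⊝ v)) (cong (f u +_) (map-⊝ v)))

  map-0 : f zeroV ≡ 0ℚ
  map-0 = trans (cong f (sym (0· zeroV))) (trans (map-· 0ℚ zeroV) (*-zeroˡ (f zeroV)))

sumV-linear : ∀ {n} → Linear (sumV {n})
sumV-linear = record { map-⊕ = plus ; map-· = scale }
  where
  plus : ∀ {n} (u v : V n) → sumV (u ⊕ v) ≡ sumV u + sumV v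
  plus []      []      = refl
  plus (x ∷ u) (y ∷ v) = trans (cong (x + y +_) (plus u v))
    (+-interchange x y (sumV u) (sumV v))
  scale : ∀ {n} c (v : V n) → sumV (c · v) ≡ c * sumV v
  scale c []      = sym (*-zeroʳ c)
  scale c (x ∷ v) = trans (cong (c * x +_) (scale c v)) (sym (*-distribˡ-+ c x (sumV v)))

sumV≡sumF : ∀ {n} (v : V n) → sumV v ≡ sumF (lookup v)
sumV≡sumF []      = refl
sumV≡sumF (x ∷ v) = cong (x +_) (sumV≡sumF v)

sumV-e : ∀ {n} (i : Fin n) → sumV (e i) ≡ 1ℚ
sumV-e i = trans (sumV≡sumF (e i)) (trans
  (sumF-cong (λ j → trans (lookup-e i j) (sym (*-identityˡ (δ i j))))) (sumF-δ i (λ _ → 1ℚ)))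

module Form {n} (G : Fin n → Fin n → ℚ) (G-sym : ∀ i j → G i j ≡ G j i) where

  opaque
    ip : V n → V n → ℚ
    ip = ipG G

    ip-def : ∀ x y → ip x y ≡ ipG G x y
    ip-def x y = refl

    ip-comm : ∀ x y → ip x y ≡ ip y x
    ip-comm x y = trans (sumF-swap (λ i j → lookup x i * G i j * lookup y j))
      (sumF-cong λ j → sumF-cong λ i → trans (cong (λ g → lookup x i * g * lookup y j) (G-sym i j))
        (solve 3 (λ a b c → a :* b :* c := c :* b :* a) refl (lookup x i) (G j i) (lookup y j)))

    ip-linearʳ : ∀ x → Linear (ip x)
    ip-linearʳ x = record
      { map-⊕ = λ u v → trans (sumF-cong λ i → trans (sumF-cong λ j →
            trans (cong (lookup x i * G i j *_) (lookup-⊕ u v j)) (*-distribˡ-+ (lookup x i * G i j)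
              (lookup u j) (lookup v j)))
            (sumF-+ (λ j → lookup x i * G i j * lookup u j) (λ j → lookup x i * G i j * lookup v j)))
          (sumF-+ (λ i → sumF (λ j → lookup x i * G i j * lookup u j))
            (λ i → sumF (λ j → lookup x i * G i j * lookup v j)))
      ; map-· = λ c v → trans (sumF-cong λ i → trans (sumF-cong λ j →
            trans (cong (lookup x i * G i j *_) (lookup-· c v j))
              (solve 3 (λ a c v → a :* (c :* v) := c :* (a :* v)) refl (lookup x i * G i j) c (lookup v j)))
            (sumF-* c (λ j → lookup x i * G i j * lookup v j)))
          (sumF-* c (λ i → sumF (λ j → lookup x i * G i j * lookup v j)))
      }

    ip-linearˡ : ∀ y → Linear (λ x → ip x y)
    ip-linearˡ y = record
      { map-⊕ = λ u v → trans (ip-comm (u ⊕ v) y) (trans (Linear.map-⊕ (ip-linearʳ y) u v)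
        (cong₂ _+_ (ip-comm y u) (ip-comm y v)))
      ; map-· = λ c v → trans (ip-comm (c · v) y) (trans (Linear.map-· (ip-linearʳ y) c v)
        (cong (c *_) (ip-comm y v)))
      }

    ip-e : ∀ x j → ip x (e j) ≡ sumF (λ i → lookup x i * G i j)
    ip-e x j = sumF-cong λ i → trans
      (sumF-cong λ k → cong (lookup x i * G i k *_) (lookup-e j k)) (sumF-δ j (λ k → lookup x i * G i k))

    ip-e-e : ∀ i j → ip (e i) (e j) ≡ G i j
    ip-e-e i j = trans (ip-e (e i) j) (trans
      (sumF-cong λ k → trans (cong (_* G k j) (lookup-e i k)) (*-comm (δ i k) (G k j)))
        (sumF-δ i (λ k → G k j)))

    ip-expand : ∀ x y → ip x y ≡ sumF (λ j → lookup y j * ip x (e j))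
    ip-expand x y = trans (sumF-swap (λ i j → lookup x i * G i j * lookup y j))
      (sumF-cong λ j → trans (sumF-cong λ i → *-comm (lookup x i * G i j) (lookup y j))
        (trans (sumF-* (lookup y j) (λ i → lookup x i * G i j)) (cong (lookup y j *_) (sym (ip-e x j)))))

-- Inversion sets

-- This encodes an integer-valued functional that vanishes at no root. A strict sign is then worth a
-- full unit, which makes inductions on heights terminate and rules out the value 0.
Gap : ∀ {n} → (V n → Set) → (V n → ℚ) → Set
Gap Root f = ∀ {a} → Root a → 1ℚ ≤ f a ⊎ f a ≤ - 1ℚ

0<1 : 0ℚ < 1ℚ
0<1 = positive⁻¹ 1ℚ

-1<0 : - 1ℚ < 0ℚ
-1<0 = negative⁻¹ (- 1ℚ)

gap-pos : ∀ {x} → 1ℚ ≤ x ⊎ x ≤ - 1ℚ → ¬ x < 0ℚ → 1ℚ ≤ x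
gap-pos (inj₁ h) _ = h
gap-pos (inj₂ h) k = ⊥-elim (k (≤-<-trans h -1<0))

gap-neg : ∀ {x} → 1ℚ ≤ x ⊎ x ≤ - 1ℚ → ¬ 0ℚ < x → x ≤ - 1ℚ
gap-neg (inj₂ h) _ = h
gap-neg (inj₁ h) k = ⊥-elim (k (<-≤-trans 0<1 h))

-- P, Q, R stand for the heights of a, w̃⁻¹a and w̃′⁻¹a, and M for m h.  In floor, d is minus the image
-- under w̃ of an affine simple root, so that the bound on P d is vacuous unless d is a floor.
module Inversions {n}
  (Root : V n → Set)
  (B : V n → V n → ℚ) (B-linearˡ : ∀ v → Linear (λ u → B u v)) (B-linearʳ : ∀ u → Linear (B u))
  (B-0< : ∀ {a b} → Root a → Root b → 0ℚ < B a b → a ≡ b ⊎ (Root (a ⊖ b) × Root (b ⊖ a)))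
  (Root-⊝ : ∀ {a} → Root a → Root (⊝ a))
  (P Q R : V n → ℚ) (P-linear : Linear P) (Q-linear : Linear Q) (R-linear : Linear R)
  (P-gap : Gap Root P) (Q-gap : Gap Root Q) (R-gap : Gap Root R)
  (inversion-anisotropic : ∀ {a} → Root a → 0ℚ < P a → Q a < 0ℚ → 0ℚ < B a a)
  (M : ℚ)
  (floor : ∀ {a} → Root a → 0ℚ < B a a → ∃[ d ] Root d × (Q d ≡ - 1ℚ) × (0ℚ < B a d) × (P d < M))
  (separating : ∀ {a} → Root a → 0ℚ < P a → Q a < 0ℚ → 0ℚ < R a → M < P a)
  where

  private
    module P = Linear P-linear
    module Q = Linear Q-linear
    module R = Linear R-linear

  Inversion : V n → Set
  Inversion a = Root a × 0ℚ < P a × Q a < 0ℚ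

  Indecomposable : V n → Set
  Indecomposable a = ∀ {u v} → Inversion u → Inversion v → a ≡ u ⊕ v → ⊥

  ⊕-inversion : ∀ {u v} → Inversion u → Inversion v → (P u < P (u ⊕ v)) × (Q (u ⊕ v) < Q u)
  ⊕-inversion {u} {v} (_ , pu , qu) (_ , pv , qv) =
      <-by pv (trans (solve 2 (λ u v → v :- con 0ℚ := (u :+ v) :- u) refl (P u) (P v))
        (cong (_- P u) (sym (P.map-⊕ u v))))
    , <-by qv (trans (solve 2 (λ u v → con 0ℚ :- v := u :- (u :+ v)) refl (Q u) (Q v))
      (cong (λ t → Q u - t) (sym (Q.map-⊕ u v))))

  ⊖-flip : ∀ {f : V n → ℚ} → Linear f → (u v : V n) → f (u ⊖ v) ≡ - f (v ⊖ u)
  ⊖-flip {f} L u v = trans (cong f (sym (⊝-⊖ v u))) (Linear.map-⊝ L (v ⊖ u))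

  0<-⊖ : ∀ {f : V n → ℚ} → Linear f → ∀ {u v} → f v < f u → 0ℚ < f (u ⊖ v)
  0<-⊖ L {u} {v} h = subst (0ℚ <_) (sym (Linear.map-⊖ L u v)) (<⇒0< h)

  -- Passing from a to c = a ⊕ e for a positive non-inversion e: the smallest such c is again
  -- indecomposable, because B c c > 0 makes some u ⊖ a or v ⊖ a a root whenever c = u ⊕ v.
  no-larger-inversion : ∀ {a} → Inversion a → Indecomposable a →
    (∀ {c} → Inversion c → Indecomposable c → Root (c ⊖ a) → P a < P c → Q a < Q c → ⊥) →
    ∀ k {c} → P c ≤ ℕ→ℚ k → Inversion c → Root (c ⊖ a) → P a < P c → Q a < Q c → ⊥
  no-larger-inversion _ _ _ zero {c} Pc≤0 (_ , pc , _) _ _ _ = <⇒≱ pc Pc≤0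
  no-larger-inversion {a} inv-a@(root-a , pa , qa) indec-a IH (suc k) {c} Pc≤k inv-c@(root-c , pc , qc)
    root-e Pa<Pc Qa<Qc =
    IH inv-c indec-c root-e Pa<Pc Qa<Qc
    where
    absurd-summand : ∀ {u v} → Inversion u → Inversion v → c ≡ u ⊕ v →
      (u ≡ a ⊎ (Root (u ⊖ a) × Root (a ⊖ u))) → ⊥
    absurd-summand {u} {v} inv-u inv-v c≡ (inj₁ refl) = <-asym Qa<Qc (subst (λ c → Q c < Q a) (sym c≡)
      (proj₂ (⊕-inversion inv-u inv-v)))
    absurd-summand {u} {v} inv-u@(_ , pu , qu) inv-v@(_ , pv , qv) c≡ (inj₂ (r , r′)) with Q-gap r
    ... | inj₂ Qe≤-1 = <-asym Qu<Qa
      (<-trans Qa<Qc (subst (λ c → Q c < Q u) (sym c≡) (proj₂ (⊕-inversion inv-u inv-v))))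
      where
      Qu<Qa : Q u < Q a
      Qu<Qa = <-by (subst (_< 0ℚ) (Q.map-⊖ u a) (≤-<-trans Qe≤-1 -1<0))
        (solve 2 (λ u v → con 0ℚ :- (u :- v) := v :- u) refl (Q u) (Q a))
    ... | inj₁ 1≤Qe with P-gap r
    -- Here `u` is itself of the form a + e, and it lies below `c` by P v, which is at least 1.
    ...   | inj₁ 1≤Pe = no-larger-inversion inv-a indec-a IH k Pu≤k inv-u r
              (0<⇒< (subst (0ℚ <_) (P.map-⊖ u a) (<-≤-trans 0<1 1≤Pe)))
              (0<⇒< (subst (0ℚ <_) (Q.map-⊖ u a) (<-≤-trans 0<1 1≤Qe)))
      where
      Pu≤k : P u ≤ ℕ→ℚ k
      Pu≤k = ≤-by (+-mono-≤ Pc≤k (gap-pos (P-gap (proj₁ inv-v)) (<-asym pv)))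
        (trans (cong₂ (λ s t → s + P v - (t + 1ℚ)) (ℕ→ℚ-suc k) (trans (cong P c≡) (P.map-⊕ u v)))
          (solve 3 (λ k u v → (con 1ℚ :+ k) :+ v :- ((u :+ v) :+ con 1ℚ) := k :- u) refl (ℕ→ℚ k) (P u)
            (P v)))
    -- Now a ⊖ u is an inversion, so a splits as u ⊕ (a ⊖ u).
    ...   | inj₂ Pe≤-1 = indec-a inv-u (r′ ,
              subst (0ℚ <_) (sym (⊖-flip P-linear a u)) (neg-0< (≤-<-trans Pe≤-1 -1<0)) ,
              subst (_< 0ℚ) (sym (⊖-flip Q-linear a u)) (neg-<0 (<-≤-trans 0<1 1≤Qe)))
              (⊕-⊖-cancel a u)

    Qe-pos : 0ℚ < Q (c ⊖ a)
    Qe-pos = 0<-⊖ Q-linear Qa<Qc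

    via-e : ∀ {u v} → Inversion u → Inversion v → c ≡ u ⊕ v → 0ℚ < B (c ⊖ a) v → ⊥
    via-e {u} {v} inv-u inv-v c≡ h with B-0< root-e (proj₁ inv-v) h
    ... | inj₁ e≡v = <-asym Qe-pos (subst (λ t → Q t < 0ℚ) (sym e≡v) (proj₂ (proj₂ inv-v)))
    -- With e = c ⊖ a and c = u ⊕ v one has e ⊖ v = u ⊖ a: an acute angle between e and one summand
    -- compares the other summand with a.
    ... | inj₂ (r , r′) = absurd-summand inv-u inv-v c≡ (inj₂ (subst Root eq₁ r , subst Root eq₂ r′))
      where
      lem : ∀ {n} (a u v : V n) → ((u ⊕ v) ⊖ a) ⊖ v ≡ u ⊖ a
      lem [] [] [] = refl
      lem (a ∷ as) (u ∷ us) (v ∷ vs) = cong₂ _∷_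
        (solve 3 (λ a u v → (u :+ v :- a) :- v := u :- a) refl a u v) (lem as us vs)
      eq₁ : (c ⊖ a) ⊖ v ≡ u ⊖ a
      eq₁ = trans (cong (λ c → (c ⊖ a) ⊖ v) c≡) (lem a u v)
      eq₂ : v ⊖ (c ⊖ a) ≡ a ⊖ u
      eq₂ = trans (sym (⊝-⊖ (c ⊖ a) v)) (trans (cong ⊝_ eq₁) (⊝-⊖ u a))

    via-a : ∀ {u v} → Inversion u → Inversion v → c ≡ u ⊕ v → 0ℚ < B a u → ⊥
    via-a inv-u inv-v c≡ h with B-0< root-a (proj₁ inv-u) h
    ... | inj₁ a≡u = absurd-summand inv-u inv-v c≡ (inj₁ (sym a≡u))
    ... | inj₂ (r , r′) = absurd-summand inv-u inv-v c≡ (inj₂ (r′ , r))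

    indec-c : Indecomposable c
    indec-c {u} {v} inv-u inv-v c≡ = <⇒≱ (inversion-anisotropic root-c pc qc)
      (subst (_≤ 0ℚ) (sym Bcc) (+-mono-≤ (+-mono-≤ (≮⇒≥ (via-a inv-u inv-v c≡))
        (≮⇒≥ (via-a inv-v inv-u c≡′)))
        (+-mono-≤ (≮⇒≥ (via-e inv-v inv-u c≡′)) (≮⇒≥ (via-e inv-u inv-v c≡)))))
      where
      c≡′ : c ≡ v ⊕ u
      c≡′ = trans c≡ (⊕-comm u v)
      Bcc : B c c ≡ (B a u + B a v) + (B (c ⊖ a) u + B (c ⊖ a) v)
      Bcc = trans (cong (λ t → B t c) (⊕-⊖-cancel c a)) (trans (Linear.map-⊕ (B-linearˡ c) a (c ⊖ a))
        (cong₂ _+_ (trans (cong (B a) c≡) (Linear.map-⊕ (B-linearʳ a) u v))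
                   (trans (cong (B (c ⊖ a)) c≡) (Linear.map-⊕ (B-linearʳ (c ⊖ a)) u v))))

  no-big-indecomposable : ∀ k {a} → - Q a ≤ ℕ→ℚ k → Inversion a → Indecomposable a → M < P a → ⊥
  no-big-indecomposable zero {a} h (_ , _ , qa) _ _ = <⇒≱ (neg-0< qa) h
  no-big-indecomposable (suc k) {a} h inv-a@(root-a , pa , qa) indec-a big
    with floor root-a (inversion-anisotropic root-a pa qa)
  ... | d , root-d , Qd , Bad , Pd<M with B-0< root-a root-d Bad
  ...   | inj₁ refl = <-asym big Pd<M
  ...   | inj₂ (r , _) = by-cases (P-gap root-d) (P-gap r)
    where
    Qa′ : Q (a ⊖ d) ≡ Q a + 1ℚ
    Qa′ = trans (Q.map-⊖ a d) (cong (λ t → Q a - t) Qd)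
    -- From Q a ≤ -1 one only gets Q a + 1 ≤ 0; the gap at the root a ⊖ d excludes equality.
    Qa′<0 : Q (a ⊖ d) < 0ℚ
    Qa′<0 = ≤-<-trans (gap-neg (Q-gap r) λ 0<Qa′ → <⇒≱ (subst (0ℚ <_) Qa′ 0<Qa′)
      (≤-by (gap-neg (Q-gap root-a) (<-asym qa)) (solve 1 (λ q → :- con 1ℚ :- q := con 0ℚ :- (q :+ con 1ℚ))
        refl (Q a)))) -1<0
    Qa<Qa′ : Q a < Q (a ⊖ d)
    Qa<Qa′ = <-by 0<1 (trans (solve 1 (λ q → con 1ℚ :- con 0ℚ := (q :+ con 1ℚ) :- q) refl (Q a))
      (cong (_- Q a) (sym Qa′)))
    Pa≡ : P a ≡ P (a ⊖ d) + P d
    Pa≡ = trans (cong P (⊖-⊕-cancel a d)) (P.map-⊕ (a ⊖ d) d)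
    by-cases : (1ℚ ≤ P d ⊎ P d ≤ - 1ℚ) → (1ℚ ≤ P (a ⊖ d) ⊎ P (a ⊖ d) ≤ - 1ℚ) → ⊥
    by-cases (inj₁ 1≤Pd) (inj₁ 1≤Pa′) = indec-a (r , <-≤-trans 0<1 1≤Pa′ , Qa′<0)
      (root-d , <-≤-trans 0<1 1≤Pd , subst (_< 0ℚ) (sym Qd) -1<0) (⊖-⊕-cancel a d)
    by-cases (inj₁ 1≤Pd) (inj₂ Pa′≤-1) = <-asym big (<-trans (<-by (≤-<-trans Pa′≤-1 -1<0)
      (trans (solve 2 (λ a′ d → con 0ℚ :- a′ := d :- (a′ :+ d)) refl (P (a ⊖ d)) (P d))
        (cong (λ t → P d - t) (sym Pa≡)))) Pd<M)
    -- In this case `d` is not a floor and ⊝ d is a positive non-inversion. So a ⊖ d is a first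
    -- candidate a + e, and its height bounds the search for the lowest one.
    by-cases (inj₂ Pd≤-1) _ = no-larger-inversion inv-a indec-a IH (proj₁ (≤-ℕ (P (a ⊖ d))))
      (proj₂ (≤-ℕ (P (a ⊖ d))))
      (r , <-trans pa Pa<Pa′ , Qa′<0) (subst Root (sym (⊖-cancel a d)) (Root-⊝ root-d)) Pa<Pa′ Qa<Qa′
      where
      Pa<Pa′ : P a < P (a ⊖ d)
      Pa<Pa′ = <-by (≤-<-trans Pd≤-1 -1<0)
        (trans (solve 2 (λ a′ d → con 0ℚ :- d := a′ :- (a′ :+ d)) refl (P (a ⊖ d)) (P d))
          (cong (λ t → P (a ⊖ d) - t) (sym Pa≡)))
      IH : ∀ {c} → Inversion c → Indecomposable c → Root (c ⊖ a) → P a < P c → Q a < Q c → ⊥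
      IH {c} inv-c indec-c root-e Pa<Pc Qa<Qc = no-big-indecomposable k
        (≤-by (+-mono-≤ h (gap-pos (Q-gap root-e) (<-asym (0<-⊖ Q-linear Qa<Qc))))
          (trans (cong₂ (λ s t → s + t - (- Q a + 1ℚ)) (ℕ→ℚ-suc k) (Q.map-⊖ c a))
            (solve 3 (λ k c a → (con 1ℚ :+ k) :+ (c :- a) :- (:- a :+ con 1ℚ) := k :- (:- c)) refl (ℕ→ℚ k)
              (Q c) (Q a))))
        inv-c indec-c (<-trans big Pa<Pc)

  private
    -- If a = u ⊕ v with u and v inversions, then R a > 0 forces R to be positive on one of them,
    -- and that one has a smaller value of -Q. A minimal counterexample is therefore indecomposable,
    -- and `separating` makes it too high to exist.
    no-separated-inversion : ∀ k {a} → - Q a ≤ ℕ→ℚ k → Inversion a → 0ℚ < R a → ⊥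
    no-separated-inversion zero h (_ , _ , qa) _ = <⇒≱ (neg-0< qa) h
    no-separated-inversion (suc k) {a} h inv-a@(root-a , pa , qa) ra =
      no-big-indecomposable (suc k) h inv-a indec-a (separating root-a pa qa ra)
      where
      smaller : ∀ {u v} → Inversion u → Inversion v → a ≡ u ⊕ v → - Q u ≤ ℕ→ℚ k
      smaller {u} {v} _ (root-v , pv , qv) a≡ = ≤-by (+-mono-≤ h (gap-neg (Q-gap root-v) (<-asym qv)))
        (trans (cong₂ (λ s t → s + - 1ℚ - (- t + Q v)) (ℕ→ℚ-suc k) (trans (cong Q a≡) (Q.map-⊕ u v)))
          (solve 3 (λ k u v → (con 1ℚ :+ k) :+ (:- con 1ℚ) :- (:- (u :+ v) :+ v) := k :- (:- u))
            refl (ℕ→ℚ k) (Q u) (Q v)))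
      indec-a : Indecomposable a
      indec-a {u} {v} inv-u inv-v a≡ with R-gap (proj₁ inv-u) | R-gap (proj₁ inv-v)
      ... | inj₁ 1≤Ru | _ = no-separated-inversion k (smaller inv-u inv-v a≡) inv-u (<-≤-trans 0<1 1≤Ru)
      ... | inj₂ _ | inj₁ 1≤Rv = no-separated-inversion k (smaller inv-v inv-u (trans a≡ (⊕-comm u v)))
        inv-v (<-≤-trans 0<1 1≤Rv)
      ... | inj₂ Ru≤ | inj₂ Rv≤ = <-asym ra (subst (_< 0ℚ) (sym (trans (cong R a≡) (R.map-⊕ u v)))
              (≤-<-trans (+-mono-≤ Ru≤ Rv≤) (negative⁻¹ (- 1ℚ + - 1ℚ))))

  inversion-shared : ∀ {a} → Root a → 0ℚ < P a → Q a < 0ℚ → R a < 0ℚ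
  inversion-shared {a} root-a pa qa = ≤-<-trans (gap-neg (R-gap root-a) λ ra →
    no-separated-inversion (proj₁ (≤-ℕ (- Q a))) (proj₂ (≤-ℕ (- Q a))) (root-a , pa , qa) ra) -1<0

-- Root systems

sumV-int : ∀ {n} {v : V n} → All IsInt v → IsInt (sumV v)
sumV-int []       = IsInt-0
sumV-int (p ∷ ps) = IsInt-+ p (sumV-int ps)

sumV-0≤ : ∀ {n} {v : V n} → All (0ℚ ≤_) v → 0ℚ ≤ sumV v
sumV-0≤ []       = ≤-refl
sumV-0≤ (p ∷ ps) = +-mono-≤ p (sumV-0≤ ps)

sumV-0< : ∀ {n} {v : V n} → All (0ℚ ≤_) v → v ≢ zeroV → 0ℚ < sumV v
sumV-0< [] v≢0 = ⊥-elim (v≢0 refl)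
sumV-0< {v = x ∷ v} (p ∷ ps) v≢0 with 0ℚ <? x
... | yes 0<x = +-mono-<-≤ 0<x (sumV-0≤ ps)
... | no  0≮x = +-mono-≤-< p (sumV-0< ps λ v≡0 → v≢0 (cong₂ _∷_ (≤-antisym (≮⇒≥ 0≮x) p) v≡0))

⊝-nonneg : ∀ {n} {v : V n} → All (_≤ 0ℚ) v → All (0ℚ ≤_) (⊝ v)
⊝-nonneg []                   = []
⊝-nonneg {v = x ∷ _} (p ∷ ps) =
  subst (0ℚ ≤_) (solve 1 (λ x → :- x := (:- con 1ℚ) :* x) refl x) (neg-0≤ p) ∷ ⊝-nonneg ps

⊝-nonpos : ∀ {n} {v : V n} → All (0ℚ ≤_) v → All (_≤ 0ℚ) (⊝ v)
⊝-nonpos []                   = []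
⊝-nonpos {v = x ∷ _} (p ∷ ps) =
  subst (_≤ 0ℚ) (solve 1 (λ x → :- x := (:- con 1ℚ) :* x) refl x) (neg-≤0 p) ∷ ⊝-nonpos ps

record LinearV {m n} (f : V m → V n) : Set where
  field
    map-⊕ : ∀ u v → f (u ⊕ v) ≡ f u ⊕ f v
    map-· : ∀ c v → f (c · v) ≡ c · f v

  map-⊝ : ∀ v → f (⊝ v) ≡ ⊝ f v
  map-⊝ = map-· (- 1ℚ)

  map-⊖ : ∀ u v → f (u ⊖ v) ≡ f u ⊖ f v
  map-⊖ u v = trans (cong f (⊖-def u v)) (trans (map-⊕ u (⊝ v))
    (trans (cong (f u ⊕_) (map-⊝ v)) (sym (⊖-def (f u) (f v)))))

module Roots {n} (Φ : RootSystem n) where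
  open RootSystem Φ public
  open Form form form-sym public

  module ipˡ y = Linear (ip-linearˡ y)
  module ipʳ x = Linear (ip-linearʳ x)

  ip-0< : ∀ {v} → v ≢ zeroV → 0ℚ < ip v v
  ip-0< {v} v≢0 = subst (0ℚ <_) (sym (ip-def v v)) (form-posdef v v≢0)

  ip-definite : ∀ {v} → ip v v ≤ 0ℚ → v ≡ zeroV
  ip-definite {v} h = decidable-stable (≡-dec _≟_ v zeroV) λ v≢0 → <⇒≱ (ip-0< v≢0) h

  root-0< : ∀ {α} → α ∈ roots → 0ℚ < ip α α
  root-0< α∈ = ip-0< (roots-nonzero α∈)

  root-≢0 : ∀ {α} → α ∈ roots → ip α α ≢ 0ℚ
  root-≢0 α∈ eq = <-irrefl (sym eq) (root-0< α∈)

  pairing : V n → V n → ℚ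
  pairing x α = 2ℚ * ip x α * inv (ip α α)

  reflect : V n → V n → V n
  reflect α x = x ⊖ (pairing x α · α)

  pairing-linear : ∀ α → Linear (λ x → pairing x α)
  pairing-linear α = record
    { map-⊕ = λ u v → trans (cong (λ t → 2ℚ * t * inv (ip α α)) (ipˡ.map-⊕ α u v))
        (solve 3 (λ u v i → con 2ℚ :* (u :+ v) :* i := con 2ℚ :* u :* i :+ con 2ℚ :* v :* i) refl (ip u α)
          (ip v α) (inv (ip α α)))
    ; map-· = λ c v → trans (cong (λ t → 2ℚ * t * inv (ip α α)) (ipˡ.map-· α c v))
        (solve 3 (λ c v i → con 2ℚ :* (c :* v) :* i := c :* (con 2ℚ :* v :* i)) refl c (ip v α)
          (inv (ip α α)))
    }

  pairing-* : ∀ {α} → α ∈ roots → ∀ x → pairing x α * ip α α ≡ 2ℚ * ip x α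
  pairing-* {α} α∈ x = trans
    (solve 3 (λ x i g → con 2ℚ :* x :* i :* g := con 2ℚ :* x :* (g :* i)) refl (ip x α) (inv (ip α α))
      (ip α α))
    (trans (cong (2ℚ * ip x α *_) (inv-inverseʳ (root-≢0 α∈))) (*-identityʳ (2ℚ * ip x α)))

  pairing-self : ∀ {α} → α ∈ roots → pairing α α ≡ 2ℚ
  pairing-self {α} α∈ = *-cancelʳ-≡ (root-≢0 α∈) (pairing-* α∈ α)

  reflect-root′ : ∀ {α β} → α ∈ roots → β ∈ roots → IsInt (pairing β α) × reflect α β ∈ roots
  reflect-root′ {α} {β} α∈ β∈ with roots-reflect α∈ β∈
  ... | c , eq′ , β′∈ = (c , pairing≡c) , subst (λ t → (β ⊖ (t · α)) ∈ roots) (sym pairing≡c) β′∈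
    where
    eq : 2ℚ * ip β α ≡ ℤ→ℚ c * ip α α
    eq = trans (cong (2ℚ *_) (ip-def β α)) (trans eq′ (cong (ℤ→ℚ c *_) (sym (ip-def α α))))
    pairing≡c : pairing β α ≡ ℤ→ℚ c
    pairing≡c = *-cancelʳ-≡ (root-≢0 α∈) (trans (pairing-* α∈ β) eq)

  pairing-int : ∀ {α β} → α ∈ roots → β ∈ roots → IsInt (pairing β α)
  pairing-int α∈ β∈ = proj₁ (reflect-root′ α∈ β∈)

  reflect-root : ∀ {α β} → α ∈ roots → β ∈ roots → reflect α β ∈ roots
  reflect-root α∈ β∈ = proj₂ (reflect-root′ α∈ β∈)

  pairing-0< : ∀ {α x} → α ∈ roots → 0ℚ < ip x α → 0ℚ < pairing x α
  pairing-0< α∈ h = *-0< (*-0< (positive⁻¹ 2ℚ) h) (0<inv (root-0< α∈))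

  reflect-self : ∀ {α} → α ∈ roots → reflect α α ≡ ⊝ α
  reflect-self {α} α∈ = trans (cong (λ t → α ⊖ (t · α)) (pairing-self α∈)) (lem α)
    where
    lem : ∀ {n} (v : V n) → v ⊖ (2ℚ · v) ≡ ⊝ v
    lem []      = refl
    lem (x ∷ v) = cong₂ _∷_ (solve 1 (λ x → x :- con 2ℚ :* x := (:- con 1ℚ) :* x) refl x) (lem v)

  ⊝-root : ∀ {α} → α ∈ roots → (⊝ α) ∈ roots
  ⊝-root α∈ = subst (_∈ roots) (reflect-self α∈) (reflect-root α∈ α∈)

  pairing≡1 : ∀ {α β} → α ∈ roots → β ∈ roots → pairing β α ≡ 1ℚ → (β ⊖ α) ∈ roots
  pairing≡1 {α} {β} α∈ β∈ eq = subst (_∈ roots) (trans (cong (λ t → β ⊖ (t · α)) eq) (cong (β ⊖_) (1· α)))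
    (reflect-root α∈ β∈)

  pairing-≡1⊎2≤ : ∀ {α β} → α ∈ roots → β ∈ roots → 0ℚ < ip β α → pairing β α ≡ 1ℚ ⊎ 2ℚ ≤ pairing β α
  pairing-≡1⊎2≤ α∈ β∈ h = IsInt-≡1⊎2≤ (pairing-int α∈ β∈) (pairing-0< α∈ h)

  2≤pairing⇒ : ∀ {α β} → α ∈ roots → 2ℚ ≤ pairing β α → ip α α ≤ ip β α
  2≤pairing⇒ {α} {β} α∈ h = 0≤⇒≤ (*-cancel-0≤ (ip β α - ip α α) (positive⁻¹ 2ℚ) (subst (0ℚ ≤_) eq
      (*-0≤ (≤⇒0≤ h) (<⇒≤ (root-0< α∈)))))
    where
    eq : (pairing β α - 2ℚ) * ip α α ≡ (ip β α - ip α α) * 2ℚ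
    eq = trans (solve 2 (λ c g → (c :- con 2ℚ) :* g := c :* g :- con 2ℚ :* g) refl (pairing β α) (ip α α))
      (trans (cong (_- 2ℚ * ip α α) (pairing-* α∈ β))
        (solve 2 (λ b g → con 2ℚ :* b :- con 2ℚ :* g := (b :- g) :* con 2ℚ) refl (ip β α) (ip α α)))

  -- If one of the two Cartan integers is 1, a reflection yields the difference up to sign. If both
  -- are at least 2, then ⟨α,β⟩ is at least ⟨α,α⟩ and ⟨β,β⟩, so α ⊖ β has norm at most 0. This takes
  -- the place of the Cauchy-Schwarz inequality.
  acute-⊖ : ∀ {α β} → α ∈ roots → β ∈ roots → 0ℚ < ip α β → α ≡ β ⊎ (α ⊖ β) ∈ roots
  acute-⊖ {α} {β} α∈ β∈ h = by-cases (pairing-≡1⊎2≤ β∈ α∈ h)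
    (pairing-≡1⊎2≤ α∈ β∈ (subst (0ℚ <_) (ip-comm α β) h))
    where
    eq : ip (α ⊖ β) (α ⊖ β) ≡ (ip α α - ip α β) - (ip α β - ip β β)
    eq = trans (ipˡ.map-⊖ (α ⊖ β) α β) (cong₂ _-_ (ipʳ.map-⊖ α α β)
      (trans (ipʳ.map-⊖ β α β) (cong (_- ip β β) (ip-comm β α))))
    by-cases : pairing α β ≡ 1ℚ ⊎ 2ℚ ≤ pairing α β → pairing β α ≡ 1ℚ ⊎ 2ℚ ≤ pairing β α →
      α ≡ β ⊎ (α ⊖ β) ∈ roots
    by-cases (inj₁ eq) _         = inj₂ (pairing≡1 β∈ α∈ eq)
    by-cases (inj₂ _)  (inj₁ eq) = inj₂ (subst (_∈ roots) (⊝-⊖ β α) (⊝-root (pairing≡1 α∈ β∈ eq)))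
    by-cases (inj₂ p)  (inj₂ q)  =
      inj₁ (⊖≡0⇒≡ (ip-definite (subst (_≤ 0ℚ) (sym eq) (≤-by (+-mono-≤ (2≤pairing⇒ β∈ p) (2≤pairing⇒ α∈ q))
      (trans (cong (λ t → ip α β + t - (ip β β + ip α α)) (ip-comm β α))
        (solve 3 (λ a b c → a :+ a :- (c :+ b) := con 0ℚ :- ((b :- a) :- (a :- c))) refl (ip α β) (ip α α)
          (ip β β)))))))

  height : V n → ℚ
  height = sumV

  height-0< : ∀ {α} → PosRoot Φ α → 1ℚ ≤ height α
  height-0< (α∈ , pos) = IsInt-1≤ (sumV-int (roots-integral α∈)) (sumV-0< pos (roots-nonzero α∈))

  height-<0 : ∀ {α} → NegRoot Φ α → height α ≤ - 1ℚ
  height-<0 {α} (α∈ , neg) = ≤-by (height-0< (⊝-root α∈ , ⊝-nonneg neg))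
    (trans (cong (_- 1ℚ) (Linear.map-⊝ sumV-linear α)) (solve 1 (λ x → :- x :- con 1ℚ := :- con 1ℚ :- x)
      refl (height α)))

  pos⊎neg : ∀ {α} → α ∈ roots → PosRoot Φ α ⊎ NegRoot Φ α
  pos⊎neg α∈ with roots-sign α∈
  ... | inj₁ pos = inj₁ (α∈ , pos)
  ... | inj₂ neg = inj₂ (α∈ , neg)

  height-gap : Gap (_∈ roots) height
  height-gap α∈ with pos⊎neg α∈
  ... | inj₁ pos = inj₁ (height-0< pos)
  ... | inj₂ neg = inj₂ (height-<0 neg)

  height≮0⇒pos : ∀ {α} → α ∈ roots → ¬ height α < 0ℚ → PosRoot Φ α
  height≮0⇒pos α∈ h with pos⊎neg α∈
  ... | inj₁ pos = pos
  ... | inj₂ neg = ⊥-elim (h (≤-<-trans (height-<0 neg) -1<0))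

  reflect-linear : ∀ α → LinearV (reflect α)
  reflect-linear α = record
    { map-⊕ = λ u v → trans (cong (λ t → (u ⊕ v) ⊖ (t · α)) (Linear.map-⊕ (pairing-linear α) u v))
      (plus u v (pairing u α) (pairing v α) α)
    ; map-· = λ c v → trans (cong (λ t → (c · v) ⊖ (t · α)) (Linear.map-· (pairing-linear α) c v))
      (scale c v (pairing v α) α)
    }
    where
    plus : ∀ {n} (u v : V n) p q α → (u ⊕ v) ⊖ ((p + q) · α) ≡ (u ⊖ (p · α)) ⊕ (v ⊖ (q · α))
    plus []      []      p q []      = refl
    plus (x ∷ u) (y ∷ v) p q (a ∷ α) = cong₂ _∷_
      (solve 5 (λ x y p q a → (x :+ y) :- (p :+ q) :* a := (x :- p :* a) :+ (y :- q :* a)) refl x y p q a)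
        (plus u v p q α)
    scale : ∀ {n} c (v : V n) p α → (c · v) ⊖ ((c * p) · α) ≡ c · (v ⊖ (p · α))
    scale c []      p []      = refl
    scale c (x ∷ v) p (a ∷ α) = cong₂ _∷_
      (solve 4 (λ c x p a → c :* x :- (c :* p) :* a := c :* (x :- p :* a)) refl c x p a) (scale c v p α)

  reflect-involutive : ∀ {α} → α ∈ roots → ∀ x → reflect α (reflect α x) ≡ x
  reflect-involutive {α} α∈ x = trans (cong (λ t → reflect α x ⊖ (t · α)) p′) (lem x (pairing x α) α)
    where
    p′ : pairing (reflect α x) α ≡ - pairing x α
    p′ = trans (Linear.map-⊖ (pairing-linear α) x (pairing x α · α)) (trans
      (cong (λ t → pairing x α - t) (trans (Linear.map-· (pairing-linear α) (pairing x α) α)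
        (cong (pairing x α *_) (pairing-self α∈))))
      (solve 1 (λ p → p :- p :* con 2ℚ := :- p) refl (pairing x α)))
    lem : ∀ {n} (x : V n) p α → (x ⊖ (p · α)) ⊖ ((- p) · α) ≡ x
    lem []      p []      = refl
    lem (x ∷ v) p (a ∷ α) = cong₂ _∷_ (solve 3 (λ x p a → (x :- p :* a) :- (:- p) :* a := x) refl x p a)
      (lem v p α)

  reflect-adjoint : ∀ α x y → ip (reflect α x) y ≡ ip x (reflect α y)
  reflect-adjoint α x y = trans (trans (ipˡ.map-⊖ y x _)
    (cong (λ t → ip x y - t) (ipˡ.map-· y (pairing x α) α)))
    (trans (cong (λ t → ip x y - pairing x α * t) (ip-comm α y))
      (trans (solve 4 (λ s x y i → s :- con 2ℚ :* x :* i :* y := s :- con 2ℚ :* y :* i :* x) refl (ip x y)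
        (ip x α) (ip y α) (inv (ip α α)))
        (sym (trans (ipʳ.map-⊖ x y _) (cong (λ t → ip x y - t) (ipʳ.map-· x (pairing y α) α))))))

  sref≡ : ∀ i x → sref Φ i x ≡ reflect (e i) x
  sref≡ i x = cong₂ (λ t g → x ⊖ ((2ℚ * t * inv g) · e i)) (sym (ip-def x (e i))) (sym (ip-e-e i i))

  wact-linear : ∀ w → LinearV (wact Φ w)
  wact-linear List.[] = record { map-⊕ = λ _ _ → refl ; map-· = λ _ _ → refl }
  wact-linear (i List.∷ w) = record
    { map-⊕ = λ u v → trans (sref≡ i _) (trans (cong (reflect (e i)) (W.map-⊕ u v))
        (trans (S.map-⊕ _ _) (sym (cong₂ _⊕_ (sref≡ i _) (sref≡ i _)))))
    ; map-· = λ c v → trans (sref≡ i _) (trans (cong (reflect (e i)) (W.map-· c v))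
        (trans (S.map-· c _) (sym (cong (c ·_) (sref≡ i _)))))
    }
    where
    module W = LinearV (wact-linear w)
    module S = LinearV (reflect-linear (e i))

  winv : List (Fin n) → V n → V n
  winv List.[]      x = x
  winv (i List.∷ w) x = winv w (reflect (e i) x)

  winv-linear : ∀ w → LinearV (winv w)
  winv-linear List.[] = record { map-⊕ = λ _ _ → refl ; map-· = λ _ _ → refl }
  winv-linear (i List.∷ w) = record
    { map-⊕ = λ u v → trans (cong (winv w) (S.map-⊕ u v)) (W.map-⊕ _ _)
    ; map-· = λ c v → trans (cong (winv w) (S.map-· c v)) (W.map-· c _)
    }
    where
    module W = LinearV (winv-linear w)
    module S = LinearV (reflect-linear (e i))

  wact-root : ∀ w {α} → α ∈ roots → wact Φ w α ∈ roots
  wact-root List.[]      α∈ = α∈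
  wact-root (i List.∷ w) α∈ = subst (_∈ roots) (sym (sref≡ i _)) (reflect-root (simple-roots i)
    (wact-root w α∈))

  winv-root : ∀ w {α} → α ∈ roots → winv w α ∈ roots
  winv-root List.[]      α∈ = α∈
  winv-root (i List.∷ w) α∈ = winv-root w (reflect-root (simple-roots i) α∈)

  wact-winv : ∀ w x → wact Φ w (winv w x) ≡ x
  wact-winv List.[]      x = refl
  wact-winv (i List.∷ w) x = trans (sref≡ i _) (trans (cong (reflect (e i)) (wact-winv w (reflect (e i) x)))
    (reflect-involutive (simple-roots i) x))

  winv-wact : ∀ w x → winv w (wact Φ w x) ≡ x
  winv-wact List.[]      x = refl
  winv-wact (i List.∷ w) x = trans (cong (λ t → winv w (reflect (e i) t)) (sref≡ i _))
    (trans (cong (winv w) (reflect-involutive (simple-roots i) (wact Φ w x))) (winv-wact w x))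

  wact-adjoint : ∀ w x y → ip (wact Φ w x) y ≡ ip x (winv w y)
  wact-adjoint List.[]      x y = refl
  wact-adjoint (i List.∷ w) x y = trans (cong (λ t → ip t y) (sref≡ i _))
    (trans (reflect-adjoint (e i) (wact Φ w x) y) (wact-adjoint w x (reflect (e i) y)))

  wact-++ : ∀ w w′ x → wact Φ (w List.++ w′) x ≡ wact Φ w (wact Φ w′ x)
  wact-++ List.[]      w′ x = refl
  wact-++ (i List.∷ w) w′ x = cong (sref Φ i) (wact-++ w w′ x)

-- Affine roots

IsInt-tri : ∀ {k} → IsInt k → k ≤ - 1ℚ ⊎ k ≡ 0ℚ ⊎ 1ℚ ≤ k
IsInt-tri {k} hk with <-cmp k 0ℚ
... | tri< k<0 _ _ = inj₁ (IsInt-≤-1 hk k<0)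
... | tri≈ _ k≡0 _ = inj₂ (inj₁ k≡0)
... | tri> _ _ 0<k = inj₂ (inj₂ (IsInt-1≤ hk 0<k))

module Affine {n} (Φ : RootSystem n) (θ : V n) (θ-highest : IsHighest Φ θ) where
  open Roots Φ public

  θ∈ : θ ∈ roots
  θ∈ = proj₁ (proj₁ θ-highest)

  θ-pos : PosRoot Φ θ
  θ-pos = proj₁ θ-highest

  height-≤ : ∀ {α} → α ∈ roots → height α ≤ height θ
  height-≤ = proj₂ θ-highest

  h : ℚ
  h = cox Φ θ

  2≤h : 2ℚ ≤ h
  2≤h = +-monoʳ-≤ 1ℚ (height-0< θ-pos)

  0<h : 0ℚ < h
  0<h = <-≤-trans (positive⁻¹ 2ℚ) 2≤h

  height-≥ : ∀ {α} → α ∈ roots → - height θ ≤ height α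
  height-≥ {α} α∈ = ≤-by (height-≤ (⊝-root α∈))
    (trans (cong (λ t → height θ - t) (Linear.map-⊝ sumV-linear α))
      (solve 2 (λ t a → t :- (:- a) := a :- (:- t)) refl (height θ) (height α)))

  -- k ∷ α encodes α + kδ; nonzero multiples of δ are included, so that differences of roots at an
  -- acute angle stay in AffRoot.
  data AffRoot : V (suc n) → Set where
    real : ∀ {α k} → α ∈ roots → IsInt k → AffRoot (k ∷ α)
    imag : ∀ {k} → IsInt k → k ≢ 0ℚ → AffRoot (k ∷ zeroV)

  aip : V (suc n) → V (suc n) → ℚ
  aip a b = ip (tail a) (tail b)

  aip-linearˡ : ∀ b → Linear (λ a → aip a b)
  aip-linearˡ (_ ∷ β) = record
    { map-⊕ = λ where (_ ∷ u) (_ ∷ v) → ipˡ.map-⊕ β u v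
    ; map-· = λ where c (_ ∷ u) → ipˡ.map-· β c u }

  aip-linearʳ : ∀ a → Linear (aip a)
  aip-linearʳ (_ ∷ α) = record
    { map-⊕ = λ where (_ ∷ u) (_ ∷ v) → ipʳ.map-⊕ α u v
    ; map-· = λ where c (_ ∷ u) → ipʳ.map-· α c u }

  affHeight : V (suc n) → ℚ
  affHeight (k ∷ α) = height α + k * h

  affHeight-linear : Linear affHeight
  affHeight-linear = record
    { map-⊕ = λ where
        (k ∷ u) (l ∷ v) → trans (cong (_+ (k + l) * h) (Linear.map-⊕ sumV-linear u v))
          (solve 5 (λ k l u v h → (u :+ v) :+ (k :+ l) :* h := (u :+ k :* h) :+ (v :+ l :* h)) refl k l
            (height u) (height v) h)
    ; map-· = λ where
        c (k ∷ u) → trans (cong (_+ c * k * h) (Linear.map-· sumV-linear c u))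
          (solve 4 (λ c k u h → c :* u :+ c :* k :* h := c :* (u :+ k :* h)) refl c k (height u) h)
    }

  module affHeight = Linear affHeight-linear

  -- One level is worth h = 1 + ht θ, one more than the finite part can take away. The hypothesis
  -- bounds only the height, so that it also covers the finite part 0 of a multiple of δ.
  1≤k⇒1≤affHeight : ∀ {k α} → - height θ ≤ height α → 1ℚ ≤ k → 1ℚ ≤ affHeight (k ∷ α)
  1≤k⇒1≤affHeight {k} {α} hα 1≤k = ≤-by (+-mono-≤ hα (*-0≤ (≤⇒0≤ 1≤k) (<⇒≤ 0<h)))
    (solve 3 (λ t a k → (a :+ (k :- con 1ℚ) :* (con 1ℚ :+ t)) :- (:- t :+ con 0ℚ) :=
      (a :+ k :* (con 1ℚ :+ t)) :- con 1ℚ) refl (height θ) (height α) k)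

  k≤-1⇒affHeight≤-1 : ∀ {k α} → height α ≤ height θ → k ≤ - 1ℚ → affHeight (k ∷ α) ≤ - 1ℚ
  k≤-1⇒affHeight≤-1 {k} {α} hα k≤-1 = ≤-by (+-mono-≤ hα (*-≤0 (<⇒≤ 0<h) (neg-≤0 (≤⇒0≤ k≤-1))))
    (solve 3 (λ t a k → (t :+ con 0ℚ) :- (a :+ (con 1ℚ :+ t) :* (:- (:- con 1ℚ :- k))) := (:- con 1ℚ) :-
      (a :+ k :* (con 1ℚ :+ t))) refl (height θ) (height α) k)

  affHeight-gap : Gap AffRoot affHeight
  affHeight-gap (real {α} {k} α∈ hk) = by-cases (IsInt-tri hk)
    where
    by-cases : k ≤ - 1ℚ ⊎ k ≡ 0ℚ ⊎ 1ℚ ≤ k → 1ℚ ≤ affHeight (k ∷ α) ⊎ affHeight (k ∷ α) ≤ - 1ℚ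
    by-cases (inj₁ k≤-1)        = inj₂ (k≤-1⇒affHeight≤-1 {k} {α} (height-≤ α∈) k≤-1)
    by-cases (inj₂ (inj₁ refl)) = subst (λ t → 1ℚ ≤ t ⊎ t ≤ - 1ℚ)
      (solve 2 (λ a h → a := a :+ con 0ℚ :* h) refl (height α) h) (height-gap α∈)
    by-cases (inj₂ (inj₂ 1≤k))  = inj₁ (1≤k⇒1≤affHeight {k} {α} (height-≥ α∈) 1≤k)
  affHeight-gap (imag {k} hk k≢0) = by-cases (IsInt-tri hk)
    where
    0≤θ : 0ℚ ≤ height θ
    0≤θ = ≤-trans (<⇒≤ 0<1) (height-0< θ-pos)
    height-0 : height (zeroV {n}) ≡ 0ℚ
    height-0 = Linear.map-0 (sumV-linear {n})
    by-cases : k ≤ - 1ℚ ⊎ k ≡ 0ℚ ⊎ 1ℚ ≤ k → 1ℚ ≤ affHeight (k ∷ zeroV) ⊎ affHeight (k ∷ zeroV) ≤ - 1ℚ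
    by-cases (inj₁ k≤-1)       = inj₂ (k≤-1⇒affHeight≤-1 {k} {zeroV}
      (subst (_≤ height θ) (sym height-0) 0≤θ) k≤-1)
    by-cases (inj₂ (inj₁ k≡0)) = ⊥-elim (k≢0 k≡0)
    by-cases (inj₂ (inj₂ 1≤k)) = inj₁ (1≤k⇒1≤affHeight {k} {zeroV} (subst (- height θ ≤_) (sym height-0)
      (neg-≤0 0≤θ)) 1≤k)

  AffRoot-⊝ : ∀ {a} → AffRoot a → AffRoot (⊝ a)
  AffRoot-⊝ (real α∈ hk) = real (⊝-root α∈) (IsInt-* (IsInt-neg IsInt-1) hk)
  AffRoot-⊝ (imag {k} hk k≢0) = subst (λ v → AffRoot ((- 1ℚ * k) ∷ v)) (sym (lem _))
    (imag (IsInt-* (IsInt-neg IsInt-1) hk) λ eq →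
      k≢0 (*-cancelʳ-≡ {r = - 1ℚ} (λ ()) (trans (*-comm k (- 1ℚ)) eq)))
    where
    lem : ∀ n → ⊝ zeroV {n} ≡ zeroV
    lem zero    = refl
    lem (suc n) = cong (0ℚ ∷_) (lem n)

  -- The new case compared with finite roots is that of equal finite parts at different levels,
  -- where the difference is a nonzero multiple of δ. Such multiples pair to 0 with everything, so
  -- they never satisfy the hypothesis themselves.
  acute-AffRoot : ∀ {a b} → AffRoot a → AffRoot b → 0ℚ < aip a b →
    a ≡ b ⊎ (AffRoot (a ⊖ b) × AffRoot (b ⊖ a))
  acute-AffRoot (imag _ _) b h = ⊥-elim (<-irrefl (sym (ipˡ.map-0 _)) h)
  acute-AffRoot (real _ _) (imag _ _) h = ⊥-elim (<-irrefl (sym (ipʳ.map-0 _)) h)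
  acute-AffRoot (real {α} {k} α∈ hk) (real {β} {l} β∈ hl) h = by-cases (acute-⊖ α∈ β∈ h)
    where
    by-cases : α ≡ β ⊎ (α ⊖ β) ∈ roots → (k ∷ α) ≡ (l ∷ β) ⊎ (AffRoot ((k - l) ∷ (α ⊖ β)) × AffRoot
      ((l - k) ∷ (β ⊖ α)))
    by-cases (inj₂ γ∈)   = inj₂ (real γ∈ (IsInt-- hk hl) , real (subst (_∈ roots) (⊝-⊖ α β) (⊝-root γ∈))
      (IsInt-- hl hk))
    by-cases (inj₁ refl) with k ≟ l
    ... | yes k≡l = inj₁ (cong (_∷ α) k≡l)
    ... | no  k≢l = inj₂ (subst (λ v → AffRoot ((k - l) ∷ v)) (sym (⊖-self α))
      (imag (IsInt-- hk hl) (k≢l ∘ lem k l))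
                        , subst (λ v → AffRoot ((l - k) ∷ v)) (sym (⊖-self α))
                          (imag (IsInt-- hl hk) (k≢l ∘ sym ∘ lem l k)))
      where
      lem : ∀ x y → x - y ≡ 0ℚ → x ≡ y
      lem x y eq = trans (solve 2 (λ x y → x := (x :- y) :+ y) refl x y)
        (trans (cong (_+ y) eq) (+-identityˡ y))

  affRefl : V (suc n) → V (suc n) → V (suc n)
  affRefl a c = c ⊖ (pairing (tail c) (tail a) · a)

  affRefl-root : ∀ {β j γ k} → β ∈ roots → IsInt j → γ ∈ roots → IsInt k → AffRoot (affRefl (j ∷ β) (k ∷ γ))
  affRefl-root β∈ hj γ∈ hk = real (reflect-root β∈ γ∈) (IsInt-- hk (IsInt-* (pairing-int β∈ γ∈) hj))

  affHeight-affRefl : ∀ {a} → affHeight a ≡ 1ℚ → ∀ c → affHeight (affRefl a c) ≡ affHeight c - pairing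
    (tail c) (tail a)
  affHeight-affRefl {a} ha c = trans (affHeight.map-⊖ c (pairing (tail c) (tail a) · a))
    (cong (λ t → affHeight c - t) (trans (affHeight.map-· (pairing (tail c) (tail a)) a)
      (trans (cong (pairing (tail c) (tail a) *_) ha) (*-identityʳ (pairing (tail c) (tail a))))))

  pairing-≤0 : ∀ {α x} → α ∈ roots → ip x α ≤ 0ℚ → pairing x α ≤ 0ℚ
  pairing-≤0 {α} {x} α∈ hx = subst (_≤ 0ℚ) (solve 2 (λ x i → (con 2ℚ :* i) :* x := con 2ℚ :* x :* i)
    refl (ip x α) (inv (ip α α)))
    (*-≤0 (<⇒≤ (*-0< (positive⁻¹ 2ℚ) (0<inv (root-0< α∈)))) hx)

  2·root : ∀ {β} → β ∈ roots → ¬ (2ℚ · β) ∈ roots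
  2·root β∈ 2β∈ = [ (λ ()) , (λ ()) ]′ (roots-reduced 2ℚ β∈ 2β∈)

  -- A reflection in an affine simple root permutes the other positive roots.  The induction is on the
  -- height of c, through c ⊖ a, whose reflection is affRefl a c ⊕ a.
  affRefl-positive : ∀ {β j} → β ∈ roots → IsInt j → affHeight (j ∷ β) ≡ 1ℚ →
    ∀ {γ k} → γ ∈ roots → IsInt k → 1ℚ ≤ affHeight (k ∷ γ) → (k ∷ γ) ≢ (j ∷ β) →
    1ℚ ≤ affHeight (affRefl (j ∷ β) (k ∷ γ))
  affRefl-positive {β} {j} β∈ hj ha {γ} {k} γ∈ hk =
    go (proj₁ (≤-ℕ (affHeight (k ∷ γ)))) γ∈ hk (proj₂ (≤-ℕ (affHeight (k ∷ γ))))
    where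
    a = j ∷ β
    go : ∀ N {γ k} → γ ∈ roots → IsInt k → affHeight (k ∷ γ) ≤ ℕ→ℚ N →
      1ℚ ≤ affHeight (k ∷ γ) → (k ∷ γ) ≢ a → 1ℚ ≤ affHeight (affRefl a (k ∷ γ))
    go zero γ∈ hk h≤0 1≤h _ = ⊥-elim (<⇒≱ (<-≤-trans 0<1 1≤h) h≤0)
    go (suc N) {γ} {k} γ∈ hk h≤N 1≤h c≢a with 0ℚ <? ip γ β
    -- Without an acute angle the reflection adds a nonnegative multiple of `a`, which has height 1.
    ... | no ip≤0 = ≤-by (+-mono-≤ 1≤h (pairing-≤0 β∈ (≮⇒≥ ip≤0)))
            (trans (solve 2 (λ H p → (H :+ con 0ℚ) :- (con 1ℚ :+ p) := (H :- p) :- con 1ℚ)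
              refl (affHeight (k ∷ γ)) (pairing γ β))
              (cong (_- 1ℚ) (sym (affHeight-affRefl {a} ha (k ∷ γ)))))
    ... | yes 0<ip = by-cases (acute-AffRoot (real γ∈ hk) (real β∈ hj) 0<ip)
      where
      c = k ∷ γ
      ζ-height : affHeight (c ⊖ a) ≡ affHeight c - 1ℚ
      ζ-height = trans (affHeight.map-⊖ c a) (cong (λ t → affHeight c - t) ha)
      ζ-positive : AffRoot (c ⊖ a) → 1ℚ ≤ affHeight (c ⊖ a)
      ζ-positive ζ-root = gap-pos (affHeight-gap ζ-root) λ ζ<0 → <⇒≱ (subst (_< 0ℚ) ζ-height ζ<0) (≤⇒0≤ 1≤h)
      -- Losing 1 from a height that is at least 1 leaves at least 0, and a root does not have
      -- height 0.
      finish : affHeight (affRefl a c) ≡ affHeight (affRefl a (c ⊖ a)) - 1ℚ → 1ℚ ≤ affHeight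
        (affRefl a (c ⊖ a)) → 1ℚ ≤ affHeight (affRefl a c)
      finish eq hζ = gap-pos (affHeight-gap (affRefl-root β∈ hj γ∈ hk)) λ rc<0 → <⇒≱ (subst (_< 0ℚ) eq rc<0)
        (≤⇒0≤ hζ)
      p-ζ : pairing (γ ⊖ β) β ≡ pairing γ β - 2ℚ
      p-ζ = trans (Linear.map-⊖ (pairing-linear β) γ β) (cong (λ t → pairing γ β - t) (pairing-self β∈))
      refl-ζ : affHeight (affRefl a c) ≡ affHeight (affRefl a (c ⊖ a)) - 1ℚ
      refl-ζ = trans (affHeight-affRefl {a} ha c)
        (sym (trans (cong (_- 1ℚ) (trans (affHeight-affRefl {a} ha (c ⊖ a)) (cong₂ _-_ ζ-height p-ζ)))
        (solve 2 (λ H p → (H :- con 1ℚ) :- (p :- con 2ℚ) :- con 1ℚ := H :- p) refl (affHeight c)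
          (pairing γ β))))
      lem : ∀ {n} (u v : V n) → u ⊖ v ≡ v → u ≡ 2ℚ · v
      lem []      []      _  = refl
      lem (x ∷ u) (y ∷ v) eq = cong₂ _∷_ (trans (solve 2 (λ x y → x := (x :- y) :+ y) refl x y)
        (trans (cong (_+ y) (cong head eq)) (solve 1 (λ y → y :+ y := con 2ℚ :* y) refl y)))
          (lem u v (cong tail eq))
      from-root : ∀ {b} → b ≡ c ⊖ a → AffRoot b → 1ℚ ≤ affHeight (affRefl a (c ⊖ a))
      from-root eq (real {ζ} {l} ζ∈ hl) = subst (λ t → 1ℚ ≤ affHeight (affRefl a t)) eq
        (go N ζ∈ hl (subst (λ t → affHeight t ≤ ℕ→ℚ N) (sym eq) (subst (_≤ ℕ→ℚ N) (sym ζ-height)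
              (≤-by h≤N (trans (cong (λ t → t - affHeight c) (ℕ→ℚ-suc N))
                (solve 2 (λ k a → (con 1ℚ :+ k) :- a := k :- (a :- con 1ℚ)) refl (ℕ→ℚ N) (affHeight c))))))
            (subst (λ t → 1ℚ ≤ affHeight t) (sym eq) (ζ-positive (subst AffRoot eq (real ζ∈ hl))))
            -- If c ⊖ a were `a` again, γ would be 2β, which a reduced root system forbids.
            λ ζ≡a → 2·root β∈ (subst (_∈ roots) (lem γ β (trans (sym (cong tail eq)) (cong tail ζ≡a))) γ∈))
      from-root eq b@(imag {l} hl l≢0) = subst (1ℚ ≤_) (sym (trans (affHeight-affRefl {a} ha (c ⊖ a))
          (trans (cong (λ t → affHeight (c ⊖ a) - t) (trans (cong (λ t → pairing t β) (sym (cong tail eq)))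
            (Linear.map-0 (pairing-linear β))))
            (solve 1 (λ x → x :- con 0ℚ := x) refl (affHeight (c ⊖ a))))))
        (ζ-positive (subst AffRoot eq b))
      by-cases : c ≡ a ⊎ (AffRoot (c ⊖ a) × AffRoot (a ⊖ c)) → 1ℚ ≤ affHeight (affRefl a c)
      by-cases (inj₁ c≡a)     = ⊥-elim (c≢a c≡a)
      by-cases (inj₂ (r , _)) = finish refl-ζ (from-root refl r)

-- Support of the highest root

lookup-0≤ : ∀ {n} {v : V n} → All (0ℚ ≤_) v → ∀ i → 0ℚ ≤ lookup v i
lookup-0≤ (p ∷ _)  Fin.zero    = p
lookup-0≤ (_ ∷ ps) (Fin.suc i) = lookup-0≤ ps i

module Support {n} (Φ : RootSystem n) (θ : V n) (θ-highest : IsHighest Φ θ) where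
  open Affine Φ θ θ-highest public

  affHeight-0∷ : ∀ α → affHeight (0ℚ ∷ α) ≡ height α
  affHeight-0∷ α = solve 2 (λ a h → a :+ con 0ℚ :* h := a) refl (height α) h

  e∈ : ∀ i → e i ∈ roots
  e∈ = simple-roots

  -- This is `affRefl-positive` restricted to level 0.
  reflect-pos : ∀ {β} i → PosRoot Φ β → β ≢ e i → PosRoot Φ (reflect (e i) β)
  reflect-pos {β} i (β∈ , pos) β≢e = height≮0⇒pos (reflect-root (e∈ i) β∈) λ h<0 →
    <⇒≱ h<0 (<⇒≤ (<-≤-trans 0<1 1≤h))
    where
    zero-level : ∀ p → affHeight ((0ℚ ∷ β) ⊖ (p · (0ℚ ∷ e i))) ≡ height (β ⊖ (p · e i))
    zero-level p = solve 3 (λ p b h → b :+ (con 0ℚ :- p :* con 0ℚ) :* h := b) refl p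
      (height (β ⊖ (p · e i))) h
    1≤h : 1ℚ ≤ height (reflect (e i) β)
    1≤h = subst (1ℚ ≤_) (zero-level (pairing β (e i)))
      (affRefl-positive (e∈ i) IsInt-0 (trans (affHeight-0∷ (e i)) (sumV-e i)) β∈ IsInt-0
        (subst (1ℚ ≤_) (sym (affHeight-0∷ β)) (height-0< (β∈ , pos))) (λ eq → β≢e (cong tail eq)))

  acute-simple-root : ∀ {β} → PosRoot Φ β → ∃[ i ] 0ℚ < ip β (e i)
  acute-simple-root {β} (β∈ , pos) = from (sumF-∃0< (subst (0ℚ <_) (ip-expand β β) (root-0< β∈)))
    where
    from : ∃[ i ] 0ℚ < lookup β i * ip β (e i) → ∃[ i ] 0ℚ < ip β (e i)
    from (i , p) = i , ≰⇒> λ q → <⇒≱ p (*-≤0 (lookup-0≤ pos i) q)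

  -- Since ⟨β,β⟩ > 0 and the coordinates of β are nonnegative, some simple root makes an acute angle
  -- with β. Reflecting in it subtracts a Cartan integer of at least 1 from the height and stays
  -- positive unless β is that simple root.
  positive-root-induction : (M : V n → Set) → (∀ i → M (e i)) →
    (∀ {β} i → PosRoot Φ β → 0ℚ < ip β (e i) → M (reflect (e i) β) → M β) →
    ∀ {β} → PosRoot Φ β → M β
  positive-root-induction M base step {β} pos = go (proj₁ (≤-ℕ (height β))) (proj₂ (≤-ℕ (height β))) pos
    where
    go : ∀ N {β} → height β ≤ ℕ→ℚ N → PosRoot Φ β → M β
    go zero    h≤0 pos = ⊥-elim (<⇒≱ (<-≤-trans 0<1 (height-0< pos)) h≤0)
    go (suc N) {β} h≤N pos = from (acute-simple-root pos)
      where
      from : ∃[ i ] 0ℚ < ip β (e i) → M β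
      from (i , acute) with ≡-dec _≟_ β (e i)
      ... | yes refl = base i
      ... | no β≢e   = step i pos acute (go N smaller (reflect-pos i pos β≢e))
        where
        smaller : height (reflect (e i) β) ≤ ℕ→ℚ N
        smaller = ≤-by (+-mono-≤ h≤N (IsInt-1≤ (pairing-int (e∈ i) (proj₁ pos)) (pairing-0< (e∈ i) acute)))
          (trans (cong (λ t → t + pairing β (e i) - (height β + 1ℚ)) (ℕ→ℚ-suc N))
            (trans (solve 3 (λ k p b → (con 1ℚ :+ k) :+ p :- (b :+ con 1ℚ) := k :- (b :- p :* con 1ℚ))
              refl (ℕ→ℚ N) (pairing β (e i)) (height β))
              (cong (λ t → ℕ→ℚ N - t) (sym (trans (Linear.map-⊖ sumV-linear β (pairing β (e i) · e i))
                (cong (λ t → height β - t) (trans (Linear.map-· sumV-linear (pairing β (e i)) (e i))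
                  (cong (pairing β (e i) *_) (sumV-e i)))))))))

  -- At an obtuse angle with `e i`, the vector α + e i would be a root one higher than α.
  highest-dominant : ∀ {α} → IsHighest Φ α → ∀ i → 0ℚ ≤ ip α (e i)
  highest-dominant {α} (α-pos@(α∈ , _) , height-≤α) i = ≮⇒≥ λ ip<0 →
      by-cases (acute-⊖ α∈ (⊝-root (e∈ i)) (subst (0ℚ <_) (sym (ipʳ.map-⊝ α (e i))) (neg-0< ip<0)))
    where
    height-⊝e : height (⊝ e i) ≡ - 1ℚ
    height-⊝e = trans (Linear.map-⊝ sumV-linear (e i)) (cong -_ (sumV-e i))
    by-cases : α ≡ ⊝ e i ⊎ (α ⊖ (⊝ e i)) ∈ roots → ⊥
    by-cases (inj₁ eq) = <⇒≱ (<-trans -1<0 0<1) (subst (1ℚ ≤_) (trans (cong height eq) height-⊝e)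
      (height-0< α-pos))
    by-cases (inj₂ r)  = <⇒≱ 0<1 (≤-by (height-≤α r)
      (trans (cong (λ t → height α - t) (trans (Linear.map-⊖ sumV-linear α (⊝ e i))
        (cong (λ t → height α - t) height-⊝e)))
        (solve 1 (λ t → t :- (t :- (:- con 1ℚ)) := con 0ℚ :- con 1ℚ) refl (height α))))

  height-≢0 : ∀ {α} → α ∈ roots → height α ≢ 0ℚ
  height-≢0 α∈ eq = contra (subst (λ t → 1ℚ ≤ t ⊎ t ≤ - 1ℚ) eq (height-gap α∈))
    where
    contra : ¬ (1ℚ ≤ 0ℚ ⊎ 0ℚ ≤ - 1ℚ)
    contra (inj₁ p) = <⇒≱ 0<1 p
    contra (inj₂ p) = <⇒≱ -1<0 p

  simple-obtuse : ∀ {i j} → i ≢ j → ip (e i) (e j) ≤ 0ℚ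
  simple-obtuse {i} {j} i≢j = ≮⇒≥ λ 0<ip → by-cases (acute-⊖ (e∈ i) (e∈ j) 0<ip)
    where
    height-0 : height (e i ⊖ e j) ≡ 0ℚ
    height-0 = trans (Linear.map-⊖ sumV-linear (e i) (e j)) (cong₂ _-_ (sumV-e i) (sumV-e j))
    by-cases : e i ≡ e j ⊎ (e i ⊖ e j) ∈ roots → ⊥
    by-cases (inj₁ eq) = 1≢0 (trans (sym (δ-refl i)) (trans (sym (lookup-e i i))
      (trans (cong (λ v → lookup v i) eq) (trans (lookup-e j i) (δ-≢ (i≢j ∘ sym))))))
    by-cases (inj₂ r) = height-≢0 r height-0

  Supp : Fin n → Set
  Supp i = 0ℚ < lookup θ i

  Supp? : ∀ i → Dec (Supp i)
  Supp? i = 0ℚ <? lookup θ i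

  θ-coefficient-0 : ∀ {j} → ¬ Supp j → lookup θ j ≡ 0ℚ
  θ-coefficient-0 {j} ¬s = ≤-antisym (≮⇒≥ ¬s) (lookup-0≤ (proj₂ θ-pos) j)

  -- Distinct simple roots are never acute, and θ has coefficient 0 at j. So every term of ⟨-e j, θ⟩
  -- expanded along θ is nonnegative, and a strictly positive term at i would contradict the
  -- dominance of θ.
  Supp-orthogonal : ∀ {i j} → Supp i → ¬ Supp j → ip (e i) (e j) ≡ 0ℚ
  Supp-orthogonal {i} {j} si ¬sj = ≤-antisym (simple-obtuse i≢j) (≮⇒≥ λ ip<0 →
      <⇒≱ (total ip<0) (subst (_≤ 0ℚ) (sym (trans (ipˡ.map-⊝ θ (e j)) (cong -_ (ip-comm (e j) θ))))
        (neg-≤0 (highest-dominant θ-highest j))))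
    where
    i≢j : i ≢ j
    i≢j refl = ¬sj si
    term : ∀ k → 0ℚ ≤ lookup θ k * ip (⊝ e j) (e k)
    term k with k Fin.≟ j
    ... | yes refl = ≤-reflexive (sym (trans (cong (_* ip (⊝ e j) (e j)) (θ-coefficient-0 ¬sj))
      (*-zeroˡ (ip (⊝ e j) (e j)))))
    ... | no k≢j   = *-0≤ (lookup-0≤ (proj₂ θ-pos) k) (subst (0ℚ ≤_) (sym (ipˡ.map-⊝ (e k) (e j)))
      (neg-0≤ (simple-obtuse (k≢j ∘ sym))))
    total : ip (e i) (e j) < 0ℚ → 0ℚ < ip (⊝ e j) θ
    total ip<0 = subst (0ℚ <_) (sym (ip-expand (⊝ e j) θ)) (sumF-0< term i
      (*-0< si (subst (0ℚ <_) (sym (trans (ipˡ.map-⊝ (e i) (e j)) (cong -_ (ip-comm (e j) (e i)))))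
        (neg-0< ip<0))))

  -- A root straddling the support of θ and its complement. Irreducibility speaks of splittings of
  -- the set of roots, so a splitting of the simple roots can be used only once straddling roots are
  -- excluded.
  Mixed : V n → Set
  Mixed β = ∃[ p ] ∃[ q ] Supp p × ¬ Supp q × lookup β p ≢ 0ℚ × lookup β q ≢ 0ℚ

  lookup-reflect-≢ : ∀ {i j} β → i ≢ j → lookup (reflect (e i) β) j ≡ lookup β j
  lookup-reflect-≢ {i} {j} β i≢j = trans (lookup-⊖ β (pairing β (e i) · e i) j)
    (trans (cong (λ t → lookup β j - t) (trans (lookup-· (pairing β (e i)) (e i) j)
      (cong (pairing β (e i) *_) (trans (lookup-e i j) (δ-≢ i≢j)))))
      (solve 2 (λ b p → b :- p :* con 0ℚ := b) refl (lookup β j) (pairing β (e i))))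

  -- A reflection in e i changes only the i-th coordinate, and as reflect (e i) β is not
  -- orthogonal to e i it keeps a nonzero coordinate on the same side of the support as i.
  reflect-mixed : ∀ {β} i → 0ℚ < ip β (e i) → Mixed β → Mixed (reflect (e i) β)
  reflect-mixed {β} i acute (p , q , sp , ¬sq , βp , βq) =
    from (sumF-∃≢0 λ eq → nonorthogonal (trans (ip-expand (e i) γ) eq))
    where
    γ = reflect (e i) β
    nonorthogonal : ip (e i) γ ≢ 0ℚ
    nonorthogonal eq = <-irrefl refl (subst (0ℚ <_) (trans (ip-comm β (e i)) (trans
      (solve 1 (λ x → x := :- (:- x)) refl (ip (e i) β)) (cong -_ (trans (sym (ipˡ.map-⊝ β (e i)))
        (trans (cong (λ t → ip t β) (sym (reflect-self (e∈ i))))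
          (trans (reflect-adjoint (e i) (e i) β) eq)))))) acute)
    from : ∃[ k ] lookup γ k * ip (e i) (e k) ≢ 0ℚ → Mixed γ
    from (k , nonzero) = by-cases (Supp? i) (Supp? k)
      where
      γk≢0 : lookup γ k ≢ 0ℚ
      γk≢0 eq = nonzero (trans (cong (_* ip (e i) (e k)) eq) (*-zeroˡ (ip (e i) (e k))))
      not-orthogonal : ip (e i) (e k) ≢ 0ℚ
      not-orthogonal eq = nonzero (trans (cong (lookup γ k *_) eq) (*-zeroʳ (lookup γ k)))
      unchanged : ∀ {j} → i ≢ j → lookup β j ≢ 0ℚ → lookup γ j ≢ 0ℚ
      unchanged i≢j βj eq = βj (trans (sym (lookup-reflect-≢ β i≢j)) eq)
      by-cases : Dec (Supp i) → Dec (Supp k) → Mixed γ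
      by-cases (yes si) (yes sk) = k , q , sk , ¬sq , γk≢0 , unchanged (λ { refl → ¬sq si }) βq
      by-cases (yes si) (no ¬sk) = ⊥-elim (not-orthogonal (Supp-orthogonal si ¬sk))
      by-cases (no ¬si) (yes sk) = ⊥-elim
        (not-orthogonal (trans (ip-comm (e i) (e k)) (Supp-orthogonal sk ¬si)))
      by-cases (no ¬si) (no ¬sk) = p , k , sp , ¬sk , unchanged (λ { refl → ¬si sp }) βp , γk≢0

  lookup-e-≢0 : ∀ {i j : Fin n} → lookup (e i) j ≢ 0ℚ → i ≡ j
  lookup-e-≢0 {i} {j} nz = decidable-stable (i Fin.≟ j) λ i≢j → nz (trans (lookup-e i j) (δ-≢ i≢j))

  positive-root-unmixed : ∀ {β} → PosRoot Φ β → ¬ Mixed β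
  positive-root-unmixed = positive-root-induction (λ β → ¬ Mixed β)
    (λ i (p , q , sp , ¬sq , p≢0 , q≢0) →
      ¬sq (subst Supp (trans (sym (lookup-e-≢0 {i} {p} p≢0)) (lookup-e-≢0 {i} {q} q≢0)) sp))
    (λ i pos acute unmixed mixed → unmixed (reflect-mixed i acute mixed))

  root-unmixed : ∀ {α} → α ∈ roots → ¬ Mixed α
  root-unmixed {α} α∈ with roots-sign α∈
  ... | inj₁ pos = positive-root-unmixed (α∈ , pos)
  ... | inj₂ neg = λ { (p , q , sp , ¬sq , p≢0 , q≢0) → positive-root-unmixed (⊝-root α∈ , ⊝-nonneg neg)
          (p , q , sp , ¬sq , ⊝-≢0 p p≢0 , ⊝-≢0 q q≢0) }
    where
    ⊝-≢0 : ∀ j → lookup α j ≢ 0ℚ → lookup (⊝ α) j ≢ 0ℚ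
    ⊝-≢0 j nz eq = nz (trans (solve 1 (λ x → x := :- ((:- con 1ℚ) :* x)) refl (lookup α j))
      (cong -_ (trans (sym (lookup-· (- 1ℚ) α j)) eq)))

  meets-Supp? : ∀ α → Dec (∃[ i ] Supp i × lookup α i ≢ 0ℚ)
  meets-Supp? α = any? λ i → Supp? i ×-dec ¬? (lookup α i ≟ 0ℚ)

  yes-does : ∀ {P : Set} (P? : Dec P) → does P? ≡ true → P
  yes-does (yes p) _ = p

  no-does : ∀ {P : Set} (P? : Dec P) → does P? ≡ false → ¬ P
  no-does (no ¬p) _ = ¬p

  -- Split the roots by whether they meet the support of θ. A root that meets it lies inside it, by
  -- `root-unmixed`, and is orthogonal to every root outside, so irreducibility leaves one class
  -- empty. As θ meets its support, no simple root can lie outside.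
  θ-full-support : ∀ j → Supp j
  θ-full-support j = decidable-stable (Supp? j) λ ¬sj → by-cases ¬sj
    (irreducible (λ α → does (meets-Supp? α)) split)
    where
    split : ∀ {α β} → α ∈ roots → β ∈ roots → does (meets-Supp? α) ≡ true → does (meets-Supp? β) ≡ false →
      ipG form α β ≡ 0ℚ
    split {α} {β} α∈ β∈ sα ¬sβ = trans (sym (ip-def α β))
      (trans (ip-expand α β) (trans (sumF-cong term) (sumF-0 n)))
      where
      inner : ∀ {k} → ¬ Supp k → ∀ l → lookup α l * ip (e k) (e l) ≡ 0ℚ
      inner {k} ¬sk l = by-dec (Supp? l) (lookup α l ≟ 0ℚ)
        where
        by-dec : Dec (Supp l) → Dec (lookup α l ≡ 0ℚ) → lookup α l * ip (e k) (e l) ≡ 0ℚ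
        by-dec _        (yes eq) = trans (cong (_* ip (e k) (e l)) eq) (*-zeroˡ (ip (e k) (e l)))
        by-dec (yes sl) _        = trans
          (cong (lookup α l *_) (trans (ip-comm (e k) (e l)) (Supp-orthogonal sl ¬sk)))
          (*-zeroʳ (lookup α l))
        by-dec (no ¬sl) (no nz)  = ⊥-elim (contra (yes-does (meets-Supp? α) sα))
          where
          contra : ∃[ i ] Supp i × lookup α i ≢ 0ℚ → ⊥
          contra (i , si , αi) = root-unmixed α∈ (i , l , si , ¬sl , αi , nz)
      term : ∀ k → lookup β k * ip α (e k) ≡ 0ℚ
      term k = by-dec (Supp? k) (lookup β k ≟ 0ℚ)
        where
        by-dec : Dec (Supp k) → Dec (lookup β k ≡ 0ℚ) → lookup β k * ip α (e k) ≡ 0ℚ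
        by-dec _        (yes eq) = trans (cong (_* ip α (e k)) eq) (*-zeroˡ (ip α (e k)))
        by-dec (yes sk) (no nz)  = ⊥-elim (no-does (meets-Supp? β) ¬sβ (k , sk , nz))
        by-dec (no ¬sk) _        = trans
          (cong (lookup β k *_) (trans (ip-comm α (e k)) (trans (ip-expand (e k) α)
          (trans (sumF-cong (inner ¬sk)) (sumF-0 n))))) (*-zeroʳ (lookup β k))
    by-cases : ¬ Supp j → (∀ {α} → α ∈ roots → does (meets-Supp? α) ≡ true) ⊎ (∀ {α} → α ∈ roots →
      does (meets-Supp? α) ≡ false) → ⊥
    by-cases ¬sj (inj₁ all) = contra (yes-does (meets-Supp? (e j)) (all (e∈ j)))
      where
      contra : ∃[ i ] Supp i × lookup (e j) i ≢ 0ℚ → ⊥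
      contra (i , si , nz) = ¬sj (subst Supp (sym (lookup-e-≢0 {j} {i} nz)) si)
    by-cases ¬sj (inj₂ none) = contra
      (sumF-∃0< (subst (0ℚ <_) (sumV≡sumF θ) (<-≤-trans 0<1 (height-0< θ-pos))))
      where
      contra : ∃[ i ] Supp i → ⊥
      contra (i , si) = no-does (meets-Supp? θ) (none θ∈) (i , si , λ eq → <-irrefl (sym eq) si)

  -- The affine simple roots: just i is α_i, and nothing is -θ + δ.
  simpleRoot : Maybe (Fin n) → V n
  simpleRoot (just i) = e i
  simpleRoot nothing  = ⊝ θ

  simpleLevel : Maybe (Fin n) → ℚ
  simpleLevel (just i) = 0ℚ
  simpleLevel nothing  = 1ℚ

  simpleRoot∈ : ∀ s → simpleRoot s ∈ roots
  simpleRoot∈ (just i) = e∈ i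
  simpleRoot∈ nothing  = ⊝-root θ∈

  simpleLevel-int : ∀ s → IsInt (simpleLevel s)
  simpleLevel-int (just _) = IsInt-0
  simpleLevel-int nothing  = IsInt-1

  affHeight-simple : ∀ s → affHeight (simpleLevel s ∷ simpleRoot s) ≡ 1ℚ
  affHeight-simple (just i) = trans (affHeight-0∷ (e i)) (sumV-e i)
  affHeight-simple nothing  = trans (cong (_+ 1ℚ * h) (Linear.map-⊝ sumV-linear θ))
    (solve 1 (λ t → :- t :+ con 1ℚ :* (con 1ℚ :+ t) := con 1ℚ) refl (height θ))

  -- The root -θ forces ⟨v,θ⟩ ≥ 0, whereas expanding θ with positive coefficients gives ⟨v,θ⟩ ≤ 0;
  -- hence each ⟨v, e k⟩ vanishes. Geometrically, A∘ is bounded.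
  obtuse-simple⇒0 : ∀ {v} → (∀ s → ip v (simpleRoot s) ≤ 0ℚ) → v ≡ zeroV
  obtuse-simple⇒0 {v} obtuse = ip-definite (≤-reflexive (trans (ip-expand v v) (trans
      (sumF-cong λ k → trans (cong (lookup v k *_) (orthogonal k)) (*-zeroʳ (lookup v k))) (sumF-0 n))))
    where
    0≤ipθ : 0ℚ ≤ ip v θ
    0≤ipθ = subst (0ℚ ≤_) (trans (cong -_ (ipʳ.map-⊝ v θ)) (solve 1 (λ x → :- (:- x) := x) refl (ip v θ)))
      (neg-0≤ (obtuse nothing))
    orthogonal : ∀ k → ip v (e k) ≡ 0ℚ
    orthogonal k = ≤-antisym (obtuse (just k)) (≮⇒≥ λ ip<0 → <⇒≱ (total ip<0)
        (subst (_≤ 0ℚ) (sym (ipˡ.map-⊝ θ v)) (neg-≤0 0≤ipθ)))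
      where
      term : ∀ j → 0ℚ ≤ lookup θ j * ip (⊝ v) (e j)
      term j = *-0≤ (<⇒≤ (θ-full-support j)) (subst (0ℚ ≤_) (sym (ipˡ.map-⊝ (e j) v))
        (neg-0≤ (obtuse (just j))))
      total : ip v (e k) < 0ℚ → 0ℚ < ip (⊝ v) θ
      total ip<0 = subst (0ℚ <_) (sym (ip-expand (⊝ v) θ))
        (sumF-0< term k (*-0< (θ-full-support k) (subst (0ℚ <_) (sym (ipˡ.map-⊝ (e k) v)) (neg-0< ip<0))))

  acute-simple : ∀ {v} → v ≢ zeroV → ∃[ s ] 0ℚ < ip v (simpleRoot s)
  acute-simple {v} v≢0 = by-cases (any? λ i → 0ℚ <? ip v (e i)) (0ℚ <? ip v (⊝ θ))
    where
    by-cases : Dec (∃[ i ] 0ℚ < ip v (e i)) → Dec (0ℚ < ip v (⊝ θ)) → ∃[ s ] 0ℚ < ip v (simpleRoot s)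
    by-cases (yes (i , p)) _ = just i , p
    by-cases (no _) (yes p)  = nothing , p
    by-cases (no ¬i) (no ¬θ) = ⊥-elim (v≢0 (obtuse-simple⇒0 λ
      { (just i) → ≮⇒≥ λ p → ¬i (i , p)
      ; nothing  → ≮⇒≥ ¬θ }))

  height-1⇒simple : ∀ {α} → α ∈ roots → height α ≡ 1ℚ → ∃[ i ] α ≡ e i
  height-1⇒simple {α} α∈ hα = from (acute-simple-root α-pos)
    where
    α-pos : PosRoot Φ α
    α-pos = height≮0⇒pos α∈ λ lt → <⇒≱ lt (subst (0ℚ ≤_) (sym hα) (<⇒≤ 0<1))
    from : ∃[ i ] 0ℚ < ip α (e i) → ∃[ i ] α ≡ e i
    from (i , acute) = i , by-cases (acute-⊖ α∈ (e∈ i) acute)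
      where
      by-cases : α ≡ e i ⊎ (α ⊖ e i) ∈ roots → α ≡ e i
      by-cases (inj₁ eq) = eq
      by-cases (inj₂ r)  = ⊥-elim (height-≢0 r (trans (Linear.map-⊖ sumV-linear α (e i))
        (cong₂ _-_ hα (sumV-e i))))

  -- If α and θ are acute, their difference would be a root of height 0 unless they agree. If not,
  -- dominance of α makes ⊝ α non-acute with all affine simple roots, including -θ, so it would be
  -- 0.
  highest-unique : ∀ {α} → α ∈ roots → height α ≡ height θ → α ≡ θ
  highest-unique {α} α∈ hα = by-dec (0ℚ <? ip α θ)
    where
    α-highest : IsHighest Φ α
    α-highest = height≮0⇒pos α∈ (λ lt →
      <⇒≱ lt (subst (0ℚ ≤_) (sym hα) (≤-trans (<⇒≤ 0<1) (height-0< θ-pos))))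
              , λ β∈ → subst (_ ≤_) (sym hα) (height-≤ β∈)
    by-dec : Dec (0ℚ < ip α θ) → α ≡ θ
    by-dec (yes acute) = by-cases (acute-⊖ α∈ θ∈ acute)
      where
      by-cases : α ≡ θ ⊎ (α ⊖ θ) ∈ roots → α ≡ θ
      by-cases (inj₁ eq) = eq
      by-cases (inj₂ r)  = ⊥-elim (height-≢0 r (trans (Linear.map-⊖ sumV-linear α θ)
        (trans (cong (_- height θ) hα) (+-inverseʳ (height θ)))))
    by-dec (no ¬acute) = ⊥-elim (roots-nonzero (⊝-root α∈) (obtuse-simple⇒0 λ
      { (just i) → subst (_≤ 0ℚ) (sym (ipˡ.map-⊝ (e i) α)) (neg-≤0 (highest-dominant α-highest i))
      ; nothing  → subst (_≤ 0ℚ) (sym (trans (ipˡ.map-⊝ (⊝ θ) α) (trans (cong -_ (ipʳ.map-⊝ α θ))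
          (solve 1 (λ x → :- (:- x) := x) refl (ip α θ))))) (≮⇒≥ ¬acute) }))

-- Points of the alcove, coweights and affine Weyl group elements

Definite : ∀ {n} → (Fin n → Fin n → ℚ) → Set
Definite {n} G = ∀ (x : Fin n → ℚ) i → x i ≢ 0ℚ → 0ℚ < sumF (λ i → x i * sumF (λ j → G i j * x j))

cons : ∀ {n} → ℚ → (Fin n → ℚ) → Fin (suc n) → ℚ
cons t x Fin.zero    = t
cons t x (Fin.suc i) = x i

-- Gaussian elimination of the first unknown: the pivot is the value of the form at a unit vector,
-- hence positive, and definiteness passes to the Schur complement.
definite-solvable : ∀ {n} (G : Fin n → Fin n → ℚ) → Definite G → (b : Fin n → ℚ) →
  ∃ λ (x : Fin n → ℚ) → ∀ i → sumF (λ j → G i j * x j) ≡ b i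
definite-solvable {zero}  G def b = (λ ()) , λ ()
definite-solvable {suc n} G def b = extend (definite-solvable S S-definite λ i → b (Fin.suc i) - G
  (Fin.suc i) Fin.zero * inv g * b Fin.zero)
  where
  g = G Fin.zero Fin.zero
  0<g : 0ℚ < g
  0<g = subst (0ℚ <_) (trans (sumF-cong λ i →
    trans (*-comm (δ Fin.zero i) (sumF (λ j → G i j * δ Fin.zero j)))
    (cong (_* δ Fin.zero i) (sumF-δ Fin.zero (G i))))
    (sumF-δ Fin.zero (λ i → G i Fin.zero))) (def (δ Fin.zero) Fin.zero λ ())
  g*inv : g * inv g ≡ 1ℚ
  g*inv = inv-inverseʳ λ eq → <-irrefl (sym eq) 0<g
  -- Schur complement of the entry g
  S : Fin n → Fin n → ℚ
  S i j = G (Fin.suc i) (Fin.suc j) - G (Fin.suc i) Fin.zero * inv g * G Fin.zero (Fin.suc j)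
  top : (Fin n → ℚ) → ℚ
  top x = sumF (λ j → G Fin.zero (Fin.suc j) * x j)
  rest : Fin n → (Fin n → ℚ) → ℚ
  rest i x = sumF (λ j → G (Fin.suc i) (Fin.suc j) * x j)
  S-row : ∀ x i → sumF (λ j → S i j * x j) ≡ rest i x - G (Fin.suc i) Fin.zero * inv g * top x
  S-row x i = trans (sumF-cong λ j → solve 4 (λ a c b x → (a :- c :* b) :* x := a :* x :+ (:- c) :*
    (b :* x)) refl
      (G (Fin.suc i) (Fin.suc j)) (G (Fin.suc i) Fin.zero * inv g) (G Fin.zero (Fin.suc j)) (x j))
    (trans (sumF-+ (λ j → G (Fin.suc i) (Fin.suc j) * x j) (λ j → (- (G (Fin.suc i) Fin.zero * inv g)) *
      (G Fin.zero (Fin.suc j) * x j)))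
      (trans (cong (rest i x +_) (sumF-* (- (G (Fin.suc i) Fin.zero * inv g))
        (λ j → G Fin.zero (Fin.suc j) * x j)))
        (solve 3 (λ r c t → r :+ (:- c) :* t := r :- c :* t) refl (rest i x)
          (G (Fin.suc i) Fin.zero * inv g) (top x))))
  row-0 : ∀ x b → g * (inv g * (b - top x)) + top x ≡ b
  row-0 x b = trans (solve 4 (λ g i b t → g :* (i :* (b :- t)) :+ t := (g :* i) :* (b :- t) :+ t) refl g
    (inv g) b (top x))
    (trans (cong (λ u → u * (b - top x) + top x) g*inv) (solve 2 (λ b t → con 1ℚ :* (b :- t) :+ t := b)
      refl b (top x)))
  row-suc : ∀ x b i → G (Fin.suc i) Fin.zero * (inv g * (b - top x)) + rest i x ≡ sumF (λ j → S i j * x j) +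
    G (Fin.suc i) Fin.zero * inv g * b
  row-suc x b i = trans (solve 5 (λ c i b t r → c :* (i :* (b :- t)) :+ r := (r :- c :* i :* t) :+ c :* i :*
    b) refl
      (G (Fin.suc i) Fin.zero) (inv g) b (top x) (rest i x))
    (cong (_+ G (Fin.suc i) Fin.zero * inv g * b) (sym (S-row x i)))
  S-definite : Definite S
  S-definite x i xi≢0 = subst (0ℚ <_) eq (def (cons t x) (Fin.suc i) xi≢0)
    where
    -- This first coordinate makes row 0 of G vanish at `cons t x`, so the form of G there equals
    -- the form of S at x.
    t = inv g * (0ℚ - top x)
    eq : sumF (λ i → cons t x i * sumF (λ j → G i j * cons t x j)) ≡ sumF
      (λ i → x i * sumF (λ j → S i j * x j))
    eq = trans (cong₂ _+_ (trans (cong (t *_) (row-0 x 0ℚ)) (*-zeroʳ t))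
        (sumF-cong λ i → cong (x i *_) (trans (row-suc x 0ℚ i)
          (solve 2 (λ s c → s :+ c :* con 0ℚ := s) refl (sumF (λ j → S i j * x j))
            (G (Fin.suc i) Fin.zero * inv g)))))
      (+-identityˡ _)
  extend : ∃ (λ (x : Fin n → ℚ) → ∀ i → sumF (λ j → S i j * x j) ≡ b (Fin.suc i) - G (Fin.suc i) Fin.zero *
    inv g * b Fin.zero) →
    ∃ λ (x : Fin (suc n) → ℚ) → ∀ i → sumF (λ j → G i j * x j) ≡ b i
  extend (x , eqs) = cons (inv g * (b Fin.zero - top x)) x , λ where
    Fin.zero    → row-0 x (b Fin.zero)
    (Fin.suc i) → trans (row-suc x (b Fin.zero) i)
      (trans (cong (_+ G (Fin.suc i) Fin.zero * inv g * b Fin.zero) (eqs i))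
      (solve 2 (λ b c → (b :- c) :+ c := b) refl (b (Fin.suc i))
        (G (Fin.suc i) Fin.zero * inv g * b Fin.zero)))

module Lattice {n} (Φ : RootSystem n) (θ : V n) (θ-highest : IsHighest Φ θ) where
  open Support Φ θ θ-highest public

  ip-e-form : ∀ x i → ip x (e i) ≡ sumF (λ j → form j i * lookup x j)
  ip-e-form x i = trans (ip-e x i) (sumF-cong λ j → *-comm (lookup x j) (form j i))

  -- The vector is ρ^∨, the sum of the fundamental coweights, obtained by solving the Gram system.
  ρ-exists : ∃[ ρ ] ∀ i → ip ρ (e i) ≡ 1ℚ
  ρ-exists = from (definite-solvable (λ i j → form j i) definite (λ _ → 1ℚ))
    where
    definite : Definite (λ i j → form j i)
    definite x i xi≢0 = subst (0ℚ <_)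
      (trans (ip-expand v v) (sumF-cong λ i → cong₂ _*_ (lookup∘tabulate x i)
        (trans (ip-e-form v i) (sumF-cong λ j → cong (form j i *_) (lookup∘tabulate x j)))))
      (ip-0< λ v≡0 → xi≢0 (trans (sym (lookup∘tabulate x i)) (trans (cong (λ u → lookup u i) v≡0)
        (lookup-zeroV i))))
      where
      v = tabulate x
    from : ∃ (λ (x : Fin n → ℚ) → ∀ i → sumF (λ j → form j i * x j) ≡ 1ℚ) → ∃[ ρ ] ∀ i → ip ρ (e i) ≡ 1ℚ
    from (x , eqs) = tabulate x , λ i → trans (ip-e-form (tabulate x) i)
      (trans (sumF-cong λ j → cong (form j i *_) (lookup∘tabulate x j)) (eqs i))

  h*inv : h * inv h ≡ 1ℚ
  h*inv = inv-inverseʳ λ eq → <-irrefl (sym eq) 0<h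

  -- The point ρ^∨/h of the fundamental alcove.
  centre : V n
  centre = inv h · proj₁ ρ-exists

  ip-centre : ∀ α → ip centre α ≡ inv h * height α
  ip-centre α = trans (ipˡ.map-· α (inv h) (proj₁ ρ-exists))
    (cong (inv h *_) (trans (ip-expand (proj₁ ρ-exists) α)
    (trans (sumF-cong λ j → trans (cong (lookup α j *_) (proj₂ ρ-exists j)) (*-identityʳ (lookup α j)))
      (sym (sumV≡sumF α)))))

  centre-in-alcove : InA Φ θ centre
  centre-in-alcove = (λ i → subst (0ℚ <_)
    (trans (sym (trans (ip-centre (e i)) (trans (cong (inv h *_) (sumV-e i)) (*-identityʳ (inv h)))))
    (ip-def centre (e i))) (0<inv 0<h))
    , subst (_< 1ℚ) (trans (sym (ip-centre θ)) (ip-def centre θ)) (<-by (0<inv 0<h)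
        (trans (solve 1 (λ i → i :- con 0ℚ := i) refl (inv h)) (trans
          (solve 2 (λ i t → i := (con 1ℚ :+ t) :* i :- i :* t) refl (inv h) (height θ))
            (cong (λ t → t - inv h * height θ) h*inv))))

  -- α + kδ as the affine function ⟨·,α⟩ + k, whose zero set is H_α^{-k}
  eval : V n → V (suc n) → ℚ
  eval x (k ∷ α) = ip x α + k

  eval-linear : ∀ x → Linear (eval x)
  eval-linear x = record
    { map-⊕ = λ where
        (k ∷ u) (l ∷ v) → trans (cong (_+ (k + l)) (ipʳ.map-⊕ x u v)) (+-interchange (ip x u) (ip x v) k l)
    ; map-· = λ where
        c (k ∷ u) → trans (cong (_+ c * k) (ipʳ.map-· x c u)) (sym (*-distribˡ-+ c (ip x u) k)) }

  -- This links geometry and combinatorics: the sign of a height is the side on which A∘ lies.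
  eval-centre : ∀ a → eval centre a * h ≡ affHeight a
  eval-centre (k ∷ α) = trans (cong (λ t → (t + k) * h) (ip-centre α)) (trans
    (solve 4 (λ i t k h → (i :* t :+ k) :* h := (h :* i) :* t :+ k :* h) refl (inv h) (height α) k h)
    (trans (cong (λ t → t * height α + k * h) h*inv) (cong (_+ k * h) (*-identityˡ (height α)))))

  eval-simple : ∀ {x} → InA Φ θ x → ∀ s → 0ℚ < eval x (simpleLevel s ∷ simpleRoot s)
  eval-simple {x} (pos , _) (just i) = subst (0ℚ <_) (trans (sym (ip-def x (e i)))
    (sym (+-identityʳ (ip x (e i))))) (pos i)
  eval-simple {x} (_ , below) nothing = <-by below (trans (cong (λ t → 1ℚ - t) (sym (ip-def x θ)))
    (trans (solve 1 (λ t → con 1ℚ :- t := (:- t :+ con 1ℚ) :- con 0ℚ) refl (ip x θ))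
      (cong (λ t → (t + 1ℚ) - 0ℚ) (sym (ipʳ.map-⊝ x θ)))))

  -- Subtracting an affine simple root at an acute angle lowers the height by 1 and leaves a
  -- positive root, so the value at x is a sum of positive values. At a multiple kδ the value is k
  -- itself.
  positive-on-alcove : ∀ {x} → InA Φ θ x → ∀ {a} → AffRoot a → 1ℚ ≤ affHeight a → 0ℚ < eval x a
  positive-on-alcove {x} x∈A {a} r = go (proj₁ (≤-ℕ (affHeight a))) r (proj₂ (≤-ℕ (affHeight a)))
    where
    go : ∀ N {a} → AffRoot a → affHeight a ≤ ℕ→ℚ N → 1ℚ ≤ affHeight a → 0ℚ < eval x a
    go zero    r h≤0 1≤h = ⊥-elim (<⇒≱ (<-≤-trans 0<1 1≤h) h≤0)
    go (suc N) (imag {k} hk k≢0) h≤N 1≤h = subst (0ℚ <_)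
      (sym (trans (cong (_+ k) (ipʳ.map-0 x)) (+-identityˡ k)))
      (≰⇒> λ k≤0 → <⇒≱ (<-≤-trans 0<1 1≤h) (subst (_≤ 0ℚ) (trans (*-comm h k)
        (sym (trans (cong (_+ k * h) (Linear.map-0 (sumV-linear {n}))) (+-identityˡ (k * h)))))
          (*-≤0 (<⇒≤ 0<h) k≤0)))
    go (suc N) {a} (real {α} {k} α∈ hk) h≤N 1≤h = from (acute-simple (roots-nonzero α∈))
      where
      from : ∃[ s ] 0ℚ < ip α (simpleRoot s) → 0ℚ < eval x a
      from (s , acute) = by-cases (acute-AffRoot (real α∈ hk) (real (simpleRoot∈ s) (simpleLevel-int s))
        acute)
        where
        b = simpleLevel s ∷ simpleRoot s
        height-a⊖b : affHeight (a ⊖ b) ≡ affHeight a - 1ℚ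
        height-a⊖b = trans (affHeight.map-⊖ a b) (cong (λ t → affHeight a - t) (affHeight-simple s))
        by-cases : a ≡ b ⊎ (AffRoot (a ⊖ b) × AffRoot (b ⊖ a)) → 0ℚ < eval x a
        by-cases (inj₁ eq) = subst (λ t → 0ℚ < eval x t) (sym eq) (eval-simple x∈A s)
        by-cases (inj₂ (r , _)) = subst (0ℚ <_) (trans (sym (Linear.map-⊕ (eval-linear x) (a ⊖ b) b))
          (cong (eval x) (sym (⊖-⊕-cancel a b))))
          (+-mono-< (go N r (subst (_≤ ℕ→ℚ N) (sym height-a⊖b)
            (≤-by h≤N (trans (cong (λ t → t - affHeight a) (ℕ→ℚ-suc N))
                (solve 2 (λ k a → (con 1ℚ :+ k) :- a := k :- (a :- con 1ℚ)) refl (ℕ→ℚ N) (affHeight a)))))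
              (gap-pos (affHeight-gap r) λ lt → <⇒≱ (subst (_< 0ℚ) height-a⊖b lt) (≤⇒0≤ 1≤h)))
            (eval-simple x∈A s))

  negative-on-alcove : ∀ {x} → InA Φ θ x → ∀ {a} → AffRoot a → affHeight a ≤ - 1ℚ → eval x a < 0ℚ
  negative-on-alcove {x} x∈A {a} r h≤-1 = <-by (positive-on-alcove x∈A (AffRoot-⊝ r)
      (subst (1ℚ ≤_) (sym (affHeight.map-⊝ a))
        (≤-by h≤-1 (solve 1 (λ t → (:- con 1ℚ) :- t := (:- t) :- con 1ℚ) refl (affHeight a)))))
    (trans (cong (_- 0ℚ) (Linear.map-⊝ (eval-linear x) a)) (solve 1 (λ t → :- t :- con 0ℚ := con 0ℚ :- t)
      refl (eval x a)))

  coroot : V n → V n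
  coroot β = (2ℚ * inv (ip β β)) · β

  ip-coroot : ∀ β x → ip (coroot β) x ≡ pairing x β
  ip-coroot β x = trans (ipˡ.map-· x (2ℚ * inv (ip β β)) β)
    (trans (cong (2ℚ * inv (ip β β) *_) (ip-comm β x))
    (solve 2 (λ i x → con 2ℚ :* i :* x := con 2ℚ :* x :* i) refl (inv (ip β β)) (ip x β)))

  subMul : Vec ℤ n → ℤ → Vec ℤ n → Vec ℤ n
  subMul c k d = tabulate λ j → lookup c j ℤ.- k ℤ.* lookup d j

  lookup-coweight : ∀ c j → lookup (coweight Φ c) j ≡ ℤ→ℚ (lookup c j) * 2ℚ * inv (form j j)
  lookup-coweight c j = lookup∘tabulate (λ j → ℤ→ℚ (lookup c j) * 2ℚ * inv (form j j)) j

  coweight-subMul : ∀ c k d → coweight Φ (subMul c k d) ≡ coweight Φ c ⊖ (ℤ→ℚ k · coweight Φ d)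
  coweight-subMul c k d = vec-ext λ j → trans (lookup-coweight (subMul c k d) j)
    (trans (cong (λ z → ℤ→ℚ z * 2ℚ * inv (form j j))
      (lookup∘tabulate (λ j → lookup c j ℤ.- k ℤ.* lookup d j) j))
    (trans (cong (λ z → z * 2ℚ * inv (form j j)) (trans (ℤ→ℚ-+ (lookup c j) (ℤ.- (k ℤ.* lookup d j)))
        (cong (ℤ→ℚ (lookup c j) +_) (trans (ℤ→ℚ-neg (k ℤ.* lookup d j)) (cong -_ (ℤ→ℚ-* k (lookup d j)))))))
    (trans (solve 4 (λ c k d i → (c :- k :* d) :* con 2ℚ :* i := c :* con 2ℚ :* i :- k :*
      (d :* con 2ℚ :* i)) refl
        (ℤ→ℚ (lookup c j)) (ℤ→ℚ k) (ℤ→ℚ (lookup d j)) (inv (form j j)))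
      (sym (trans (lookup-⊖ (coweight Φ c) (ℤ→ℚ k · coweight Φ d) j)
        (cong₂ _-_ (lookup-coweight c j) (trans (lookup-· (ℤ→ℚ k) (coweight Φ d) j)
          (cong (ℤ→ℚ k *_) (lookup-coweight d j)))))))))

  coweight-int : ∀ c {α} → α ∈ roots → IsInt (ip (coweight Φ c) α)
  coweight-int c {α} α∈ = subst IsInt (sym eq) (sum-int λ j → IsInt-* (lookup c j , refl)
    (pairing-int (e∈ j) α∈))
    where
    sum-int : ∀ {n} {f : Fin n → ℚ} → (∀ i → IsInt (f i)) → IsInt (sumF f)
    sum-int {zero}  _  = IsInt-0
    sum-int {suc n} hf = IsInt-+ (hf Fin.zero) (sum-int λ i → hf (Fin.suc i))
    eq : ip (coweight Φ c) α ≡ sumF (λ j → ℤ→ℚ (lookup c j) * pairing α (e j))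
    eq = trans (ip-comm (coweight Φ c) α) (trans (ip-expand α (coweight Φ c)) (sumF-cong λ j →
      trans (cong (_* ip α (e j)) (lookup-coweight c j)) (trans
        (solve 3 (λ c i x → c :* con 2ℚ :* i :* x := c :* (con 2ℚ :* x :* i)) refl (ℤ→ℚ (lookup c j))
          (inv (form j j)) (ip α (e j)))
        (cong (λ g → ℤ→ℚ (lookup c j) * (2ℚ * ip α (e j) * inv g)) (sym (ip-e-e j j))))))

  unit : Fin n → Vec ℤ n
  unit i = tabulate λ j → if does (i Fin.≟ j) then ℤ.+ 1 else ℤ.+ 0

  coweight-unit : ∀ i → coweight Φ (unit i) ≡ coroot (e i)
  coweight-unit i = vec-ext λ j → trans (lookup-coweight (unit i) j)
    (trans (cong (λ z → ℤ→ℚ z * 2ℚ * inv (form j j))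
      (lookup∘tabulate (λ j → if does (i Fin.≟ j) then ℤ.+ 1 else ℤ.+ 0) j))
      (trans (by-dec j) (sym (trans (lookup-· (2ℚ * inv (ip (e i) (e i))) (e i) j)
        (cong₂ _*_ (cong (λ g → 2ℚ * inv g) (ip-e-e i i)) (lookup-e i j))))))
    where
    by-dec : ∀ j → ℤ→ℚ (if does (i Fin.≟ j) then ℤ.+ 1 else ℤ.+ 0) * 2ℚ * inv (form j j) ≡
      (2ℚ * inv (form i i)) * δ i j
    by-dec j with i Fin.≟ j
    ... | yes refl = solve 1 (λ g → con 1ℚ :* con 2ℚ :* g := con 2ℚ :* g :* con 1ℚ) refl (inv (form i i))
    ... | no _     = solve 2 (λ g g′ → con 0ℚ :* con 2ℚ :* g := con 2ℚ :* g′ :* con 0ℚ)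
      refl (inv (form j j)) (inv (form i i))

  -- The reflection in β belongs to W, and β^∨ to Q^∨.
  Integral : V n → Set
  Integral β = ∃[ u ] ∃[ d ] (∀ x → wact Φ u x ≡ reflect β x) × coweight Φ d ≡ coroot β

  reflect-isometry : ∀ {α} → α ∈ roots → ∀ x y → ip (reflect α x) (reflect α y) ≡ ip x y
  reflect-isometry {α} α∈ x y = trans (reflect-adjoint α x (reflect α y))
    (cong (ip x) (reflect-involutive α∈ y))

  reflect-conjugate : ∀ {α} → α ∈ roots → ∀ β x → reflect α (reflect (reflect α β) (reflect α x)) ≡ reflect
    β x
  reflect-conjugate {α} α∈ β x = trans (cong (reflect α) eq) (reflect-involutive α∈ (reflect β x))
    where
    module S = LinearV (reflect-linear α)
    eq : reflect (reflect α β) (reflect α x) ≡ reflect α (reflect β x)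
    eq = trans (cong₂ (λ s t → reflect α x ⊖ ((2ℚ * s * inv t) · reflect α β)) (reflect-isometry α∈ x β)
      (reflect-isometry α∈ β β))
      (sym (trans (S.map-⊖ x (pairing x β · β)) (cong (reflect α x ⊖_) (S.map-· (pairing x β) β))))

  positive-root-integral : ∀ {β} → PosRoot Φ β → Integral β
  positive-root-integral = positive-root-induction Integral
    (λ i → i List.∷ List.[] , unit i , sref≡ i , coweight-unit i) step
    where
    step : ∀ {β} i → PosRoot Φ β → 0ℚ < ip β (e i) → Integral (reflect (e i) β) → Integral β
    -- With γ = s_i β, the reflection in β is s_i s_γ s_i, and β^∨ = s_i γ^∨ = γ^∨ - K α_i^∨ with K
    -- = ⟨γ^∨, α_i⟩ an integer.
    step {β} i _ _ (u , d , u≡ , d≡) = (i List.∷ u List.++ (i List.∷ List.[])) , subMul d (proj₁ K-int)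
      (unit i) , reflection , coroot≡
      where
      module S = LinearV (reflect-linear (e i))
      γ = reflect (e i) β
      K = ip (coweight Φ d) (e i)
      K-int : IsInt K
      K-int = coweight-int d (e∈ i)
      reflection : ∀ x → wact Φ (i List.∷ u List.++ (i List.∷ List.[])) x ≡ reflect β x
      reflection x = trans (sref≡ i _) (trans (cong (reflect (e i)) (trans (wact-++ u (i List.∷ List.[]) x)
        (trans (u≡ (sref Φ i x)) (cong (reflect γ) (sref≡ i x))))) (reflect-conjugate (e∈ i) β x))
      s-coroot : coroot β ≡ reflect (e i) (coroot γ)
      s-coroot = sym (trans (S.map-· (2ℚ * inv (ip γ γ)) γ) (cong₂ (λ g v → (2ℚ * inv g) · v)
        (reflect-isometry (e∈ i) β β) (reflect-involutive (e∈ i) β)))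
      scale : ∀ {n} p q (v : V n) → (p * q) · v ≡ p · (q · v)
      scale p q []      = refl
      scale p q (x ∷ v) = cong₂ _∷_ (*-assoc p q x) (scale p q v)
      coroot≡ : coweight Φ (subMul d (proj₁ K-int) (unit i)) ≡ coroot β
      coroot≡ = trans (coweight-subMul d (proj₁ K-int) (unit i)) (trans
        (cong₂ (λ k v → coweight Φ d ⊖ (k · v)) (sym (proj₂ K-int)) (coweight-unit i))
        (trans (cong (coweight Φ d ⊖_) (trans (sym (scale K (2ℚ * inv (ip (e i) (e i))) (e i)))
            (cong (_· e i) (solve 2 (λ k i → k :* (con 2ℚ :* i) := con 2ℚ :* k :* i) refl K
              (inv (ip (e i) (e i)))))))
          (trans (cong (reflect (e i)) d≡) (sym s-coroot))))

  simple-integral : ∀ s → Integral (simpleRoot s)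
  simple-integral (just i) = i List.∷ List.[] , unit i , sref≡ i , coweight-unit i
  simple-integral nothing  = from (positive-root-integral θ-pos)
    where
    from : Integral θ → Integral (⊝ θ)
    -- The roots θ and -θ share their reflection; only the coroot changes sign, and 0 - 1·d is -d.
    from (u , d , u≡ , d≡) = u , subMul (Vec.replicate n (ℤ.+ 0)) (ℤ.+ 1) d ,
      (λ x → trans (u≡ x) (reflection x)) , coroot≡
      where
      norm : ip (⊝ θ) (⊝ θ) ≡ ip θ θ
      norm = trans (ipˡ.map-⊝ (⊝ θ) θ) (trans (cong -_ (ipʳ.map-⊝ θ θ))
        (solve 1 (λ x → :- (:- x) := x) refl (ip θ θ)))
      reflection : ∀ x → reflect θ x ≡ reflect (⊝ θ) x
      reflection x = trans (lem x (pairing x θ) θ) (cong (λ t → x ⊖ (t · (⊝ θ))) (sym (trans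
          (cong₂ (λ s t → 2ℚ * s * inv t) (ipʳ.map-⊝ x θ) norm)
          (solve 2 (λ x i → con 2ℚ :* (:- x) :* i := :- (con 2ℚ :* x :* i)) refl (ip x θ) (inv (ip θ θ))))))
        where
        lem : ∀ {n} (x : V n) p v → x ⊖ (p · v) ≡ x ⊖ ((- p) · (⊝ v))
        lem []      p []      = refl
        lem (x ∷ u) p (y ∷ v) = cong₂ _∷_
          (solve 3 (λ x p y → x :- p :* y := x :- (:- p) :* ((:- con 1ℚ) :* y)) refl x p y) (lem u p v)
      coroot≡ : coweight Φ (subMul (Vec.replicate n (ℤ.+ 0)) (ℤ.+ 1) d) ≡ coroot (⊝ θ)
      coroot≡ = trans (vec-ext λ j → trans (lookup-coweight (subMul (Vec.replicate n (ℤ.+ 0)) (ℤ.+ 1) d) j)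
          (trans (cong (λ z → ℤ→ℚ z * 2ℚ * inv (form j j))
            (trans (lookup∘tabulate (λ j → lookup (Vec.replicate n (ℤ.+ 0)) j ℤ.- ℤ.+ 1 ℤ.* lookup d j) j)
              (trans (cong₂ (λ a b → a ℤ.- b) (lookup-replicate j (ℤ.+ 0)) (ℤ.*-identityˡ (lookup d j)))
                (ℤ.+-identityˡ (ℤ.- lookup d j)))))
          (trans (cong (λ z → z * 2ℚ * inv (form j j)) (ℤ→ℚ-neg (lookup d j)))
          (trans (solve 2 (λ d i → (:- d) :* con 2ℚ :* i := (:- con 1ℚ) :* (d :* con 2ℚ :* i))
            refl (ℤ→ℚ (lookup d j)) (inv (form j j)))
            (sym (trans (lookup-· (- 1ℚ) (coweight Φ d) j) (cong (- 1ℚ *_) (lookup-coweight d j)))))))) 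
        (trans (cong ⊝_ d≡) (trans (swap (2ℚ * inv (ip θ θ)) θ) (cong (λ g → (2ℚ * inv g) · (⊝ θ))
          (sym norm))))
        where
        swap : ∀ {n} p (v : V n) → ⊝ (p · v) ≡ p · (⊝ v)
        swap p []      = refl
        swap p (x ∷ v) = cong₂ _∷_ (solve 2 (λ p x → (:- con 1ℚ) :* (p :* x) := p :* ((:- con 1ℚ) :* x))
          refl p x) (swap p v)

-- The action of affine Weyl group elements on affine roots and alcoves

module Alcoves {n} (Φ : RootSystem n) (θ : V n) (θ-highest : IsHighest Φ θ) where
  open Lattice Φ θ θ-highest public

  module Element (w : List (Fin n)) (c : Vec ℤ n) where
    μ : V n
    μ = coweight Φ c

    -- pull is w̃⁻¹ and push is w̃ on affine roots, for w̃ = w t_μ.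
    pull : V (suc n) → V (suc n)
    pull (k ∷ α) = (k + ip μ (winv w α)) ∷ winv w α

    push : V (suc n) → V (suc n)
    push (k ∷ α) = (k - ip μ α) ∷ wact Φ w α

    pull-push : ∀ a → pull (push a) ≡ a
    pull-push (k ∷ α) = cong₂ _∷_
      (trans (cong (λ v → (k - ip μ α) + ip μ v) (winv-wact w α))
        (solve 2 (λ k x → (k :- x) :+ x := k) refl k (ip μ α)))
      (winv-wact w α)

    pull-height : V (suc n) → ℚ
    pull-height a = affHeight (pull a)

    pull-height-linear : Linear pull-height
    pull-height-linear = record
      { map-⊕ = λ { (k ∷ u) (l ∷ v) → trans (cong affHeight (cong₂ _∷_
            (trans (cong (λ t → (k + l) + t) (trans (cong (ip μ) (W.map-⊕ u v))
              (ipʳ.map-⊕ μ (winv w u) (winv w v))))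
              (+-interchange k l (ip μ (winv w u)) (ip μ (winv w v)))) (W.map-⊕ u v)))
          (affHeight.map-⊕ (pull (k ∷ u)) (pull (l ∷ v))) }
      ; map-· = λ { c (k ∷ u) → trans (cong affHeight (cong₂ _∷_
            (trans (cong (λ t → c * k + t) (trans (cong (ip μ) (W.map-· c u)) (ipʳ.map-· μ c (winv w u))))
              (sym (*-distribˡ-+ c k (ip μ (winv w u))))) (W.map-· c u)))
          (affHeight.map-· c (pull (k ∷ u))) }
      }
      where module W = LinearV (winv-linear w)

    winv-0 : winv w zeroV ≡ zeroV
    winv-0 = trans (cong (winv w) (sym (0· zeroV))) (trans (LinearV.map-· (winv-linear w) 0ℚ zeroV)
      (0· (winv w zeroV)))

    pull-imag : ∀ k → pull (k ∷ zeroV) ≡ k ∷ zeroV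
    pull-imag k = cong₂ _∷_ (trans (cong (λ v → k + ip μ v) winv-0) (trans (cong (k +_) (ipʳ.map-0 μ))
      (+-identityʳ k))) winv-0

    pull-root : ∀ {a} → AffRoot a → AffRoot (pull a)
    pull-root (real {α} α∈ hk) = real (winv-root w α∈) (IsInt-+ hk (coweight-int c (winv-root w α∈)))
    pull-root (imag {k} hk k≢0) = subst AffRoot (sym (pull-imag k)) (imag hk k≢0)

    pull-gap : Gap AffRoot pull-height
    pull-gap r = affHeight-gap (pull-root r)

    ip-act : ∀ x α → ip (act Φ (w , c) x) α ≡ ip x (winv w α) + ip μ (winv w α)
    ip-act x α = trans (wact-adjoint w (x ⊕ μ) α) (ipˡ.map-⊕ (winv w α) x μ)

    eval-act : ∀ x a → eval (act Φ (w , c) x) a ≡ eval x (pull a)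
    eval-act x (k ∷ α) = trans (cong (_+ k) (ip-act x α))
      (solve 3 (λ x m k → (x :+ m) :+ k := x :+ (k :+ m)) refl (ip x (winv w α)) (ip μ (winv w α)) k)

    -- The sign of ht(w̃⁻¹a) thus tells on which side of the hyperplane of a the alcove w̃A∘ lies.
    eval-act-centre : ∀ a → eval (act Φ (w , c) centre) a * h ≡ pull-height a
    eval-act-centre a = trans (cong (_* h) (eval-act centre a)) (eval-centre (pull a))

    act-centre-0< : ∀ {a} → 0ℚ < pull-height a → 0ℚ < eval (act Φ (w , c) centre) a
    act-centre-0< {a} p = *-cancel-0< (eval (act Φ (w , c) centre) a) 0<h
      (subst (0ℚ <_) (sym (eval-act-centre a)) p)

    act-centre-<0 : ∀ {a} → pull-height a < 0ℚ → eval (act Φ (w , c) centre) a < 0ℚ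
    act-centre-<0 {a} p = ≰⇒> λ q → <⇒≱ p (subst (0ℚ ≤_) (trans (*-comm h _) (eval-act-centre a))
      (*-0≤ (<⇒≤ 0<h) q))

    pull-height-<0 : ∀ {a} → eval (act Φ (w , c) centre) a < 0ℚ → pull-height a < 0ℚ
    pull-height-<0 {a} p = subst (_< 0ℚ) (trans (*-comm h _) (eval-act-centre a)) (*-<0 0<h p)

    PosAff⇒1≤ : ∀ {β j} → IsInt j → PosAff Φ (β , j) → 1ℚ ≤ affHeight (j ∷ β)
    PosAff⇒1≤ {β} {j} hj (inj₁ (pos , 0≤j)) = ≤-by (+-mono-≤ (height-0< pos) (*-0≤ 0≤j (<⇒≤ 0<h)))
      (solve 2 (λ a b → (a :+ b) :- (con 1ℚ :+ con 0ℚ) := (a :+ b) :- con 1ℚ) refl (height β) (j * h))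
    PosAff⇒1≤ {β} {j} hj (inj₂ (neg , 0<j)) = 1≤k⇒1≤affHeight {j} {β} (height-≥ (proj₁ neg))
      (IsInt-1≤ hj 0<j)

  -- Shi floors imply minimality

  module Minimality (m : ℕ) (1≤m : 1 ℕ.≤ m) where

    mℚ : ℚ
    mℚ = ℕ→ℚ m

    M : ℚ
    M = mℚ * h

    simpleLevelℤ : Maybe (Fin n) → ℤ
    simpleLevelℤ (just _) = ℤ.+ 0
    simpleLevelℤ nothing  = ℤ.+ 1

    simpleLevel≡ : ∀ s → simpleLevel s ≡ ℤ→ℚ (simpleLevelℤ s)
    simpleLevel≡ (just _) = refl
    simpleLevel≡ nothing  = refl

    shifted-level : ∀ s → ℤ→ℚ (ℤ.+ m ℤ.+ simpleLevelℤ s) ≡ mℚ + simpleLevel s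
    shifted-level s = trans (ℤ→ℚ-+ (ℤ.+ m) (simpleLevelℤ s)) (cong (mℚ +_) (sym (simpleLevel≡ s)))

    module InWp⇒Shi (w : List (Fin n)) (c : Vec ℤ n) (inWp : InWp Φ θ (M + 1ℚ) (w , c))
      (w′ : List (Fin n)) (c′ : Vec ℤ n) (same : SameRegion Φ θ m (w , c) (w′ , c′)) where

      module X = Element w c
      module Y = Element w′ c′

      -- Multiples of δ are fixed by w̃, so their two heights agree and they cannot be inversions.
      anisotropic : ∀ {a} → AffRoot a → 0ℚ < affHeight a → X.pull-height a < 0ℚ → 0ℚ < aip a a
      anisotropic (real α∈ _) _ _ = root-0< α∈
      anisotropic (imag {k} _ _) p q = ⊥-elim (<-asym p (subst (_< 0ℚ) (cong affHeight (X.pull-imag k)) q))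

      -- Take an affine simple root b acute with -w̃⁻¹a and let d = -w̃b; the form depends only on
      -- finite parts and is W-invariant, so d is acute with a.
      floor-exists : ∀ {a} → AffRoot a → 0ℚ < aip a a → ∃[ d ] AffRoot d × (X.pull-height d ≡ - 1ℚ) ×
        (0ℚ < aip a d) × (affHeight d < M)
      floor-exists (imag _ _) p = ⊥-elim (<-irrefl (sym (ipˡ.map-0 zeroV)) p)
      floor-exists (real {α} {k} α∈ _) _ = from (acute-simple (roots-nonzero (⊝-root (winv-root w α∈))))
        where
        from : ∃[ s ] 0ℚ < ip (⊝ winv w α) (simpleRoot s) → ∃[ d ] AffRoot d × (X.pull-height d ≡ - 1ℚ) ×
          (0ℚ < ip α (tail d)) × (affHeight d < M)
        from (s , acute) = ⊝ X.push b , AffRoot-⊝ (real (wact-root w (simpleRoot∈ s))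
          (IsInt-- (simpleLevel-int s) ipμ-int))
            , trans (Linear.map-⊝ X.pull-height-linear (X.push b))
              (cong -_ (trans (cong affHeight (X.pull-push b)) (affHeight-simple s)))
            , subst (0ℚ <_) eq acute , bound
          where
          β = simpleRoot s
          b = simpleLevel s ∷ β
          ipμ-int : IsInt (ip X.μ β)
          ipμ-int = coweight-int c (simpleRoot∈ s)
          eq : ip (⊝ winv w α) β ≡ ip α (⊝ wact Φ w β)
          eq = trans (ipˡ.map-⊝ β (winv w α))
            (trans (cong -_ (trans (ip-comm (winv w α) β) (trans (sym (wact-adjoint w β α))
            (ip-comm (wact Φ w β) α))))
            (sym (ipʳ.map-⊝ α (wact Φ w β))))
          level-eq : height β + ℤ→ℚ (ℤ.+ m ℤ.+ simpleLevelℤ s) * h ≡ M + 1ℚ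
          level-eq = trans (cong (λ t → height β + t * h) (shifted-level s)) (trans
            (solve 4 (λ b m j h → b :+ (m :+ j) :* h := m :* h :+ (b :+ j :* h)) refl (height β) mℚ
              (simpleLevel s) h)
            (cong (M +_) (affHeight-simple s)))
          -- The root b + mδ has height m h + 1, so the hypothesis on w̃ makes w̃b + mδ positive: m
          -- h + ht(w̃b) ≥ 1, that is, ht(-w̃b) < m h.
          raised : 1ℚ ≤ affHeight ((ℤ→ℚ (ℤ.+ m ℤ.+ simpleLevelℤ s) - ipG form X.μ β) ∷ wact Φ w β)
          raised = X.PosAff⇒1≤ (IsInt-- (ℤ.+ m ℤ.+ simpleLevelℤ s , refl)
            (subst IsInt (ip-def X.μ β) ipμ-int))
            (inWp β (ℤ.+ m ℤ.+ simpleLevelℤ s) (simpleRoot∈ s) level-eq)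
          bound : affHeight (⊝ X.push b) < M
          bound = <-by (<-≤-trans 0<1 raised) (trans
            (cong₂ (λ t u → height (wact Φ w β) + (t - u) * h - 0ℚ) (shifted-level s) (sym (ip-def X.μ β)))
            (trans (solve 5 (λ b m j u h → b :+ ((m :+ j) :- u) :* h :- con 0ℚ := m :* h :-
              (:- (b :+ (j :- u) :* h))) refl
                (height (wact Φ w β)) mℚ (simpleLevel s) (ip X.μ β) h)
              (cong (λ t → M - t) (sym (affHeight.map-⊝ (X.push b))))))

      separating : ∀ {a} → AffRoot a → 0ℚ < affHeight a → X.pull-height a < 0ℚ → 0ℚ < Y.pull-height a →
        M < affHeight a
      separating (imag {k} _ _) p q _ = ⊥-elim (<-asym p (subst (_< 0ℚ) (cong affHeight (X.pull-imag k)) q))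
      separating (real {α} α∈ (z , refl)) p q r = ≰⇒> λ P≤M → by-cases P≤M (pos⊎neg α∈)
        where
        k = ℤ→ℚ z
        q′ : ip (act Φ (w , c) centre) α + k < 0ℚ
        q′ = X.act-centre-<0 q
        r′ : 0ℚ < ip (act Φ (w′ , c′) centre) α + k
        r′ = Y.act-centre-0< r
        by-cases : affHeight (k ∷ α) ≤ M → PosRoot Φ α ⊎ NegRoot Φ α → ⊥
        by-cases P≤M (inj₁ pos) = <-asym r′
          (<-by (subst (_< ℤ→ℚ (ℤ.- z)) (sym (ip-def (act Φ (w′ , c′) centre) α))
              (proj₁ (same α pos (ℤ.- z) (ℤ.neg-mono-< z<m) (ℤ.≤-trans (ℤ.neg-mono-≤ 0≤z) (ℤ.+≤+ ℕ.z≤n))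
                centre centre centre-in-alcove centre-in-alcove)
                (subst (_< ℤ→ℚ (ℤ.- z)) (ip-def (act Φ (w , c) centre) α)
                  (<-by q′ (shift (ip (act Φ (w , c) centre) α))))))
              (sym (shift (ip (act Φ (w′ , c′) centre) α))))
          where
          shift : ∀ t → 0ℚ - (t + k) ≡ ℤ→ℚ (ℤ.- z) - t
          shift t = trans (solve 2 (λ t k → con 0ℚ :- (t :+ k) := :- k :- t) refl t k)
            (cong (_- t) (sym (ℤ→ℚ-neg z)))
          0≤z : ℤ.+ 0 ℤ.≤ z
          0≤z = ℤ.≮⇒≥ λ z<0 → <-asym p (≤-<-trans (k≤-1⇒affHeight≤-1 {k} {α} (height-≤ α∈)
            (IsInt-≤-1 (z , refl) (ℤ→ℚ-mono-< {z} {ℤ.+ 0} z<0))) -1<0)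
          z<m : z ℤ.< ℤ.+ m
          z<m = ℤ.≰⇒> λ m≤z → <⇒≱ 0<1 (≤-by
            (+-mono-≤ P≤M (+-mono-≤ (height-0< pos) (*-0≤ (≤⇒0≤ (ℤ→ℚ-mono-≤ m≤z)) (<⇒≤ 0<h))))
            (solve 4 (λ a k m h → (m :* h :+ (a :+ (k :- m) :* h)) :- ((a :+ k :* h) :+ (con 1ℚ :+ con 0ℚ))
              := con 0ℚ :- con 1ℚ) refl (height α) k mℚ h))
        by-cases P≤M (inj₂ neg) = <-asym q′ (<-by (subst (_< k) (sym (ip-def (act Φ (w , c) centre) (⊝ α)))
              (proj₂ (same (⊝ α) (⊝-root α∈ , ⊝-nonneg (proj₂ neg)) z
                (ℤ.<-trans (ℤ.neg-mono-< (ℤ.+<+ 1≤m)) 0<z) z≤m centre centre centre-in-alcove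
                centre-in-alcove)
                (subst (_< k) (ip-def (act Φ (w′ , c′) centre) (⊝ α))
                  (<-by r′ (shift (act Φ (w′ , c′) centre))))))
              (sym (shift (act Φ (w , c) centre))))
          where
          shift : ∀ x → (ip x α + k) - 0ℚ ≡ k - ip x (⊝ α)
          shift x = trans (solve 2 (λ t k → (t :+ k) :- con 0ℚ := k :- (:- t)) refl (ip x α) k)
            (cong (λ t → k - t) (sym (ipʳ.map-⊝ x α)))
          0<z : ℤ.+ 0 ℤ.< z
          0<z = ℤ.≰⇒> λ z≤0 → <⇒≱ p (≤-by (+-mono-≤ (≤-trans (height-<0 neg) (<⇒≤ -1<0))
            (*-≤0 (<⇒≤ 0<h) (ℤ→ℚ-mono-≤ {z} {ℤ.+ 0} z≤0)))
            (solve 3 (λ a k h → (con 0ℚ :+ con 0ℚ) :- (a :+ h :* k) := con 0ℚ :- (a :+ k :* h))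
              refl (height α) k h))
          z≤m : z ℤ.≤ ℤ.+ m
          z≤m = ℤ.≮⇒≥ λ m<z → <⇒≱ 0<1 (≤-by (+-mono-≤ P≤M (1≤k⇒1≤affHeight {k - mℚ} {α} (height-≥ α∈)
              (IsInt-1≤ (IsInt-- (z , refl) (ℤ.+ m , refl)) (<⇒0< (ℤ→ℚ-mono-< m<z)))))
            (solve 4 (λ a k m h → (m :* h :+ (a :+ (k :- m) :* h)) :- ((a :+ k :* h) :+ con 1ℚ) := con 0ℚ :-
              con 1ℚ) refl (height α) k mℚ h))

      open Inversions AffRoot aip aip-linearˡ aip-linearʳ acute-AffRoot AffRoot-⊝
        affHeight X.pull-height Y.pull-height affHeight-linear X.pull-height-linear Y.pull-height-linear
        affHeight-gap X.pull-gap Y.pull-gap anisotropic M floor-exists separating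

      separates : ∀ {α} z → α ∈ roots → 0ℚ < affHeight (ℤ→ℚ z ∷ α) →
        ip (act Φ (w , c) centre) α + ℤ→ℚ z < 0ℚ → ip (act Φ (w′ , c′) centre) α + ℤ→ℚ z < 0ℚ
      separates z α∈ p q = Y.act-centre-<0 (inversion-shared (real α∈ (z , refl)) p (X.pull-height-<0 q))

      -- For k > 0 the inversion -α + kδ records that ⟨x,α⟩ > k; for k < 0 the inversion α - (k+1)δ
      -- records that ⟨x,α⟩ < k + 1. Sharing it pushes k′ at least as far from 0 as k, on the same
      -- side.
      minimal : ∀ α → PosRoot Φ α → ∀ k k′ → KVal Φ θ (w , c) α k → KVal Φ θ (w′ , c′) α k′ →
        ℤ.∣ k ∣ ℕ.≤ ℤ.∣ k′ ∣
      minimal α pos k k′ kval kval′ = by-cases k refl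
        where
        x = act Φ (w , c) centre
        y = act Φ (w′ , c′) centre
        k<x : ℤ→ℚ k < ip x α
        k<x = subst (ℤ→ℚ k <_) (sym (ip-def x α)) (proj₁ (kval centre centre-in-alcove))
        x<k+1 : ip x α < ℤ→ℚ (k ℤ.+ ℤ.+ 1)
        x<k+1 = subst (_< ℤ→ℚ (k ℤ.+ ℤ.+ 1)) (sym (ip-def x α)) (proj₂ (kval centre centre-in-alcove))
        k′<y : ℤ→ℚ k′ < ip y α
        k′<y = subst (ℤ→ℚ k′ <_) (sym (ip-def y α)) (proj₁ (kval′ centre centre-in-alcove))
        y<k′+1 : ip y α < ℤ→ℚ (k′ ℤ.+ ℤ.+ 1)
        y<k′+1 = subst (_< ℤ→ℚ (k′ ℤ.+ ℤ.+ 1)) (sym (ip-def y α)) (proj₂ (kval′ centre centre-in-alcove))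
        <suc⇒≤ : ∀ {i j} → i ℤ.< j ℤ.+ ℤ.+ 1 → i ℤ.≤ j
        <suc⇒≤ {i} {j} lt = ℤ.≮⇒≥ λ j<i → ℤ.<⇒≱ lt (subst (ℤ._≤ i) (ℤ.+-comm (ℤ.+ 1) j)
          (ℤ.i<j⇒suc[i]≤j j<i))
        by-cases : ∀ k″ → k ≡ k″ → ℤ.∣ k″ ∣ ℕ.≤ ℤ.∣ k′ ∣
        by-cases (ℤ.+ zero) _ = ℕ.z≤n
        by-cases (ℤ.+ suc N) refl = above k′ (<suc⇒≤ (ℤ→ℚ-cancel-< (<-trans k<y y<k′+1)))
          where
          flip : ∀ v → ip v (⊝ α) + ℤ→ℚ k ≡ ℤ→ℚ k - ip v α
          flip v = trans (cong (_+ ℤ→ℚ k) (ipʳ.map-⊝ v α)) (+-comm (- ip v α) (ℤ→ℚ k))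
          k<y : ℤ→ℚ k < ip y α
          k<y = <-by (subst (_< 0ℚ) (flip y) (separates k (⊝-root (proj₁ pos))
              (<-≤-trans 0<1 (1≤k⇒1≤affHeight {ℤ→ℚ k} {⊝ α} (height-≥ (⊝-root (proj₁ pos)))
                (ℤ→ℚ-mono-≤ {ℤ.+ 1} {ℤ.+ suc N} (ℤ.+≤+ (ℕ.s≤s ℕ.z≤n)))))
              (subst (_< 0ℚ) (sym (flip x)) (<-by k<x (solve 2 (λ x k → x :- k := con 0ℚ :- (k :- x))
                refl (ip x α) (ℤ→ℚ k))))))
            (solve 2 (λ x k → con 0ℚ :- (k :- x) := x :- k) refl (ip y α) (ℤ→ℚ k))
          above : ∀ k′ → ℤ.+ suc N ℤ.≤ k′ → suc N ℕ.≤ ℤ.∣ k′ ∣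
          above (ℤ.+ _) (ℤ.+≤+ le) = le
        by-cases -[1+ N ] refl = below k′ (<suc⇒≤ (ℤ→ℚ-cancel-< (<-trans k′<y y<k+1)))
          where
          -- For k < 0 the separating hyperplane nearest to the alcove is its upper bound H_α^{k+1},
          -- whence the shift by one; it gives l ≥ 0, so α + lδ is positive.
          l = ℤ.- (k ℤ.+ ℤ.+ 1)
          l≡ : ℤ→ℚ l ≡ - ℤ→ℚ (k ℤ.+ ℤ.+ 1)
          l≡ = ℤ→ℚ-neg (k ℤ.+ ℤ.+ 1)
          0≤l : ℤ.+ 0 ℤ.≤ l
          0≤l = ℤ.neg-mono-≤ { k ℤ.+ ℤ.+ 1 } {ℤ.+ 0} (subst (ℤ._≤ ℤ.+ 0) (ℤ.+-comm (ℤ.+ 1) k)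
            (ℤ.i<j⇒suc[i]≤j (ℤ.-<+ {N} {0})))
          y<k+1 : ip y α < ℤ→ℚ (k ℤ.+ ℤ.+ 1)
          y<k+1 = <-by (subst (λ t → ip y α + t < 0ℚ) l≡ (separates l (proj₁ pos)
              (<-≤-trans 0<1 (≤-by (+-mono-≤ (height-0< pos) (*-0≤ (ℤ→ℚ-mono-≤ {ℤ.+ 0} {l} 0≤l) (<⇒≤ 0<h)))
                (solve 2 (λ a b → (a :+ b) :- (con 1ℚ :+ con 0ℚ) := (a :+ b) :- con 1ℚ) refl (height α)
                  (ℤ→ℚ l * h))))
              (subst (λ t → ip x α + t < 0ℚ) (sym l≡) (<-by x<k+1 (shift (ip x α))))))
            (sym (shift (ip y α)))
            where
            shift : ∀ t → ℤ→ℚ (k ℤ.+ ℤ.+ 1) - t ≡ 0ℚ - (t + - ℤ→ℚ (k ℤ.+ ℤ.+ 1))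
            shift t = solve 2 (λ k t → k :- t := con 0ℚ :- (t :+ :- k)) refl (ℤ→ℚ (k ℤ.+ ℤ.+ 1)) t
          below : ∀ k′ → k′ ℤ.≤ -[1+ N ] → suc N ℕ.≤ ℤ.∣ k′ ∣
          below -[1+ _ ] (ℤ.-≤- le) = ℕ.s≤s le

    InWp⇒Shi : ∀ w̃ → InWp Φ θ (M + 1ℚ) w̃ → IsShiAlcove Φ θ m w̃
    InWp⇒Shi (w , c) inWp (w′ , c′) same = InWp⇒Shi.minimal w c inWp w′ c′ same

-- Minimal alcoves have Shi floors

module WallReflection {n} (Φ : RootSystem n) (θ : V n) (θ-highest : IsHighest Φ θ) (m : ℕ) (1≤m : 1 ℕ.≤ m)
  (w : List (Fin n)) (c : Vec ℤ n) (s : Maybe (Fin n)) where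
  open Alcoves Φ θ θ-highest
  open Minimality m 1≤m

  module X = Element w c

  β : V n
  β = simpleRoot s

  β∈ : β ∈ roots
  β∈ = simpleRoot∈ s

  j : ℚ
  j = simpleLevel s

  b : V (suc n)
  b = j ∷ β

  -- As w̃b = wβ - Kδ, the wall is H_{wβ}^K, and w̃A∘ lies on its side where ⟨·,wβ⟩ > K.
  K : ℚ
  K = ip X.μ β - j

  ipμβ-int : IsInt (ip X.μ β)
  ipμβ-int = coweight-int c β∈

  Kℤ : ℤ
  Kℤ = proj₁ ipμβ-int ℤ.- simpleLevelℤ s

  Kℤ≡ : ℤ→ℚ Kℤ ≡ K
  Kℤ≡ = trans (ℤ→ℚ-+ (proj₁ ipμβ-int) (ℤ.- simpleLevelℤ s)) (cong₂ _+_ (sym (proj₂ ipμβ-int))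
    (trans (ℤ→ℚ-neg (simpleLevelℤ s)) (cong -_ (sym (simpleLevel≡ s)))))

  u : List (Fin n)
  u = proj₁ (simple-integral s)

  d : Vec ℤ n
  d = proj₁ (proj₂ (simple-integral s))

  -- The neighbour of w̃A∘ across its wall w̃H_b, where b is the affine simple root j ∷ β.
  w′ : List (Fin n)
  w′ = w List.++ u

  c′ : Vec ℤ n
  c′ = subMul c Kℤ d

  -- The neighbour is w̃ s_b, and w t_μ s_b = (w s_β) t_{μ - K β^∨}, where s_b x = s_β x - j β^∨.
  coweight-c′ : coweight Φ c′ ≡ X.μ ⊖ (K · coroot β)
  coweight-c′ = trans (coweight-subMul c Kℤ d) (cong₂ (λ k v → X.μ ⊖ (k · v)) Kℤ≡
    (proj₂ (proj₂ (proj₂ (simple-integral s)))))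

  eval-neighbour : ∀ x a → eval (act Φ (w′ , c′) x) a ≡ eval x (affRefl b (X.pull a))
  eval-neighbour x (k ∷ α) = trans (cong (_+ k) ip-act′) (trans (cong (λ t → (ip x γ′ + t) + k) ip-c′)
      (solve 5 (λ x m p j k → (x :+ (m :- p :* j)) :+ k := x :+ ((k :+ m) :- p :* j)) refl (ip x γ′)
        (ip X.μ γ) p j k))
    where
    γ = winv w α
    γ′ = reflect β γ
    p = pairing γ β
    ip-act′ : ip (act Φ (w′ , c′) x) α ≡ ip x γ′ + ip (coweight Φ c′) γ′
    ip-act′ = trans (cong (λ v → ip v α) (trans (wact-++ w u (x ⊕ coweight Φ c′))
        (cong (wact Φ w) (proj₁ (proj₂ (proj₂ (simple-integral s))) (x ⊕ coweight Φ c′)))))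
      (trans (wact-adjoint w (reflect β (x ⊕ coweight Φ c′)) α)
        (trans (reflect-adjoint β (x ⊕ coweight Φ c′) γ)
        (ipˡ.map-⊕ γ′ x (coweight Φ c′))))
    ip-c′ : ip (coweight Φ c′) γ′ ≡ ip X.μ γ - p * j
    ip-c′ = trans (cong (λ v → ip v γ′) coweight-c′) (trans (ipˡ.map-⊖ γ′ X.μ (K · coroot β)) (trans
      (cong₂ _-_ (trans (ipʳ.map-⊖ X.μ γ (p · β)) (cong (λ t → ip X.μ γ - t) (ipʳ.map-· X.μ p β)))
        (trans (ipˡ.map-· γ′ K (coroot β)) (cong (K *_) (trans (ip-coroot β γ′)
          (trans (Linear.map-⊖ (pairing-linear β) γ (p · β)) (cong (λ t → p - t)
            (trans (Linear.map-· (pairing-linear β) p β) (cong (p *_) (pairing-self β∈)))))))))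
      (solve 4 (λ g p q j → (g :- p :* q) :- (q :- j) :* (p :- p :* con 2ℚ) := g :- p :* j) refl (ip X.μ γ)
        p (ip X.μ β) j)))

  ip-act-wall : ∀ x → ip (act Φ (w , c) x) (wact Φ w β) ≡ K + eval x b
  ip-act-wall x = trans (solve 3 (λ y q j → y := (q :- j) :+ (y :+ (j :- q))) refl (ip (act Φ (w , c) x)
    (wact Φ w β)) (ip X.μ β) j)
    (cong (K +_) (trans (X.eval-act x (X.push b)) (cong (eval x) (X.pull-push b))))

  ip-neighbour-wall : ∀ x → ip (act Φ (w′ , c′) x) (wact Φ w β) ≡ K - eval x b
  ip-neighbour-wall x = trans (solve 3 (λ y q j → y := (q :- j) :+ (y :+ (j :- q)))
    refl (ip (act Φ (w′ , c′) x) (wact Φ w β)) (ip X.μ β) j)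
    (cong (K +_) (trans (eval-neighbour x (X.push b))
      (trans (cong (λ t → eval x (affRefl b t)) (X.pull-push b))
      (trans (Linear.map-⊖ (eval-linear x) b (pairing β β · b)) (trans (cong (λ t → eval x b - t)
        (trans (Linear.map-· (eval-linear x) (pairing β β) b) (cong (_* eval x b) (pairing-self β∈))))
        (solve 1 (λ t → t :- con 2ℚ :* t := :- t) refl (eval x b)))))))

  -- The root δ - b has height h - 1 ≥ 1, so it is positive on A∘. Each of the two alcoves thus
  -- fills no more than the unit strip next to the wall.
  eval-b<1 : ∀ {x} → InA Φ θ x → eval x b < 1ℚ
  eval-b<1 {x} x∈A = <-by (positive-on-alcove x∈A (real (⊝-root β∈) (IsInt-- IsInt-1 (simpleLevel-int s)))
    (≤-by 2≤h
      (trans (cong (λ t → h - t) (cong (_+ 1ℚ) (sym (affHeight-simple s)))) (trans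
        (solve 3 (λ a j h → h :- ((a :+ j :* h) :+ con 1ℚ) := (:- a :+ (con 1ℚ :- j) :* h) :- con 1ℚ)
          refl (height β) j h)
        (cong (λ t → (t + (1ℚ - j) * h) - 1ℚ) (sym (Linear.map-⊝ sumV-linear β)))))))
    (trans (cong (λ t → (t + (1ℚ - j)) - 0ℚ) (ipʳ.map-⊝ x β))
      (solve 2 (λ t j → (:- t :+ (con 1ℚ :- j)) :- con 0ℚ := con 1ℚ :- (t :+ j)) refl (ip x β) j))

  NonShiFloor : Set
  NonShiFloor = (PosRoot Φ (wact Φ w β) × ℤ.+ m ℤ.< Kℤ) ⊎ (NegRoot Φ (wact Φ w β) × ℤ.+ m ℤ.≤ Kℤ)

  -- The only affine roots changing sign across the wall are b and ⊝ b, and the wall is no Shi hyperplane.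
  same-region : NonShiFloor → SameRegion Φ θ m (w , c) (w′ , c′)
  same-region floor α α-pos z -m<z z≤m x y x∈A y∈A =
      subst₂ (λ s t → (s < ℤ→ℚ z → t < ℤ→ℚ z) × (t < ℤ→ℚ z → s < ℤ→ℚ z))
        (ip-def (act Φ (w , c) x) α) (ip-def (act Φ (w′ , c′) y) α) (by-cases (X.pull-gap a-root))
    where
    k = ℤ→ℚ (ℤ.- z)
    k≡ : k ≡ - ℤ→ℚ z
    k≡ = ℤ→ℚ-neg z
    a = k ∷ α
    a-root : AffRoot a
    a-root = real (proj₁ α-pos) (ℤ.- z , refl)
    γ∈ : winv w α ∈ roots
    γ∈ = winv-root w (proj₁ α-pos)
    l-int : IsInt (k + ip X.μ (winv w α))
    l-int = IsInt-+ (ℤ.- z , refl) (coweight-int c γ∈)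
    on-wall : ∀ {v} → X.pull a ≡ v → winv w α ≡ tail v × ℤ→ℚ z ≡ ip X.μ (tail v) - head v
    on-wall refl = refl , trans (solve 2 (λ z q → z := q :- ((:- z) :+ q)) refl (ℤ→ℚ z) (ip X.μ (winv w α)))
      (cong (λ t → ip X.μ (winv w α) - (t + ip X.μ (winv w α))) (sym k≡))
    no-pos-neg : ∀ {δ} → PosRoot Φ δ → NegRoot Φ δ → ⊥
    no-pos-neg p q = <⇒≱ (<-trans -1<0 0<1) (≤-trans (height-0< p) (height-<0 q))
    wact-γ : ∀ {v} → winv w α ≡ v → wact Φ w v ≡ α
    wact-γ eq = trans (cong (wact Φ w) (sym eq)) (wact-winv w α)
    ≢b : X.pull a ≢ b
    ≢b eq = contra floor
      where
      wβ≡α : wact Φ w β ≡ α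
      wβ≡α = wact-γ (proj₁ (on-wall eq))
      z≡K : z ≡ Kℤ
      z≡K = ℤ→ℚ-injective (trans (proj₂ (on-wall eq)) (sym Kℤ≡))
      contra : NonShiFloor → ⊥
      contra (inj₁ (_ , m<K))  = ℤ.<⇒≱ m<K (subst (ℤ._≤ ℤ.+ m) z≡K z≤m)
      contra (inj₂ (neg , _))  = no-pos-neg α-pos (subst (NegRoot Φ) wβ≡α neg)
    ≢⊝b : X.pull a ≢ ⊝ b
    ≢⊝b eq = contra floor
      where
      ⊝wβ≡α : ⊝ wact Φ w β ≡ α
      ⊝wβ≡α = trans (sym (LinearV.map-⊝ (wact-linear w) β)) (wact-γ (proj₁ (on-wall eq)))
      z≡-K : z ≡ ℤ.- Kℤ
      z≡-K = ℤ→ℚ-injective (trans (proj₂ (on-wall eq)) (trans (cong (_- (- 1ℚ * j)) (ipʳ.map-⊝ X.μ β))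
        (trans (solve 2 (λ q j → (:- q) :- (:- con 1ℚ) :* j := :- (q :- j)) refl (ip X.μ β) j)
          (trans (cong -_ (sym Kℤ≡)) (sym (ℤ→ℚ-neg Kℤ))))))
      contra : NonShiFloor → ⊥
      contra (inj₁ ((wβ∈ , pos) , _)) = no-pos-neg α-pos
        (subst (NegRoot Φ) ⊝wβ≡α (⊝-root wβ∈ , ⊝-nonpos pos))
      contra (inj₂ (_ , m≤K))         = ℤ.<⇒≱ -m<z (subst (ℤ._≤ ℤ.- (ℤ.+ m)) (sym z≡-K) (ℤ.neg-mono-≤ m≤K))
    to-eval : ∀ v → eval v a < 0ℚ → ip v α < ℤ→ℚ z
    to-eval v lt = <-by lt (trans (cong (λ t → 0ℚ - (ip v α + t)) k≡)
      (solve 2 (λ x z → con 0ℚ :- (x :+ (:- z)) := z :- x) refl (ip v α) (ℤ→ℚ z)))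
    from-eval : ∀ v → 0ℚ < eval v a → ¬ ip v α < ℤ→ℚ z
    from-eval v lt lt′ = <-asym lt
      (<-by lt′ (sym (trans (cong (λ t → 0ℚ - (ip v α + t)) k≡)
      (solve 2 (λ x z → con 0ℚ :- (x :+ (:- z)) := z :- x) refl (ip v α) (ℤ→ℚ z)))))
    reflected : AffRoot (affRefl b (X.pull a))
    reflected = affRefl-root β∈ (simpleLevel-int s) γ∈ l-int
    by-cases : 1ℚ ≤ X.pull-height a ⊎ X.pull-height a ≤ - 1ℚ →
      (ip (act Φ (w , c) x) α < ℤ→ℚ z → ip (act Φ (w′ , c′) y) α < ℤ→ℚ z) ×
        (ip (act Φ (w′ , c′) y) α < ℤ→ℚ z → ip (act Φ (w , c) x) α < ℤ→ℚ z)
    by-cases (inj₁ 1≤) =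
        (λ lt → ⊥-elim (from-eval (act Φ (w , c) x) (subst (0ℚ <_) (sym (X.eval-act x a))
          (positive-on-alcove x∈A (X.pull-root a-root) 1≤)) lt))
      , (λ lt → ⊥-elim (from-eval (act Φ (w′ , c′) y) (subst (0ℚ <_) (sym (eval-neighbour y a))
        (positive-on-alcove y∈A reflected
            (affRefl-positive β∈ (simpleLevel-int s) (affHeight-simple s) γ∈ l-int 1≤ ≢b))) lt))
    by-cases (inj₂ ≤-1) =
        (λ _ → to-eval (act Φ (w′ , c′) y) (subst (_< 0ℚ) (sym (eval-neighbour y a))
          (negative-on-alcove y∈A reflected reflected≤-1)))
      , (λ _ → to-eval (act Φ (w , c) x) (subst (_< 0ℚ) (sym (X.eval-act x a))
        (negative-on-alcove x∈A (X.pull-root a-root) ≤-1)))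
      where
      1≤⊝ : 1ℚ ≤ affHeight (⊝ X.pull a)
      1≤⊝ = subst (1ℚ ≤_) (sym (affHeight.map-⊝ (X.pull a)))
        (≤-by ≤-1 (solve 1 (λ t → (:- con 1ℚ) :- t := (:- t) :- con 1ℚ) refl (X.pull-height a)))
      ⊝≢b : ⊝ X.pull a ≢ b
      ⊝≢b eq = ≢⊝b (trans (sym (⊝-involutive (X.pull a))) (cong ⊝_ eq))
      ⊝-reflected : affHeight (affRefl b (⊝ X.pull a)) ≡ - affHeight (affRefl b (X.pull a))
      ⊝-reflected = trans (affHeight-affRefl {b} (affHeight-simple s) (⊝ X.pull a)) (trans
        (cong₂ _-_ (affHeight.map-⊝ (X.pull a)) (Linear.map-⊝ (pairing-linear β) (winv w α)))
        (trans (solve 2 (λ H p → (:- H) :- (:- p) := :- (H :- p)) refl (X.pull-height a)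
          (pairing (winv w α) β))
          (cong -_ (sym (affHeight-affRefl {b} (affHeight-simple s) (X.pull a))))))
      reflected≤-1 : affHeight (affRefl b (X.pull a)) ≤ - 1ℚ
      reflected≤-1 = ≤-by (subst (1ℚ ≤_) ⊝-reflected (affRefl-positive β∈ (simpleLevel-int s)
        (affHeight-simple s)
          (⊝-root γ∈) (IsInt-* (IsInt-neg IsInt-1) l-int) 1≤⊝ ⊝≢b))
        (solve 1 (λ t → (:- t) :- con 1ℚ := (:- con 1ℚ) :- t) refl (affHeight (affRefl b (X.pull a))))

  between⇒KVal : ∀ {w̃ : AffW Φ} {α} k (f : V n → ℚ) → (∀ x → ip (act Φ w̃ x) α ≡ ℤ→ℚ k + f x) →
    (∀ {x} → InA Φ θ x → 0ℚ < f x × f x < 1ℚ) → KVal Φ θ w̃ α k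
  between⇒KVal {w̃} {α} k f eq bounds x x∈A = subst₂ _<_ (+-identityʳ (ℤ→ℚ k)) eq′
    (+-monoʳ-< (ℤ→ℚ k) (proj₁ (bounds x∈A)))
      , subst₂ _<_ eq′ (sym (ℤ→ℚ-+ k (ℤ.+ 1))) (+-monoʳ-< (ℤ→ℚ k) (proj₂ (bounds x∈A)))
    where
    eq′ : ℤ→ℚ k + f x ≡ ipG form (act Φ w̃ x) α
    eq′ = trans (sym (eq x)) (ip-def (act Φ w̃ x) α)

  eval-b-bounds : ∀ {x} → InA Φ θ x → 0ℚ < eval x b × eval x b < 1ℚ
  eval-b-bounds x∈A = eval-simple x∈A s , eval-b<1 x∈A

  1-eval-b-bounds : ∀ {x} → InA Φ θ x → 0ℚ < 1ℚ - eval x b × 1ℚ - eval x b < 1ℚ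
  1-eval-b-bounds {x} x∈A = <⇒0< (eval-b<1 x∈A)
    , <-by (eval-simple x∈A s) (solve 1 (λ t → t :- con 0ℚ := con 1ℚ :- (con 1ℚ :- t)) refl (eval x b))

  ∣i∣≰∣i-1∣ : ∀ {i} → ℤ.+ 0 ℤ.< i → ¬ ℤ.∣ i ∣ ℕ.≤ ℤ.∣ i ℤ.- ℤ.+ 1 ∣
  ∣i∣≰∣i-1∣ {ℤ.+ suc N} _ le = ℕ.<-irrefl refl le
  ∣i∣≰∣i-1∣ {ℤ.+ zero} (ℤ.+<+ ())

  ∣i+1∣≰∣i∣ : ∀ {i} → ℤ.+ 0 ℤ.≤ i → ¬ ℤ.∣ ℤ.- (i ℤ.+ ℤ.+ 1) ∣ ℕ.≤ ℤ.∣ ℤ.- i ∣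
  ∣i+1∣≰∣i∣ {i@(ℤ.+ N)} _ le = ℕ.<-irrefl refl (subst₂ ℕ._≤_ (trans (ℤ.∣-i∣≡∣i∣ (i ℤ.+ ℤ.+ 1))
    (ℕ.+-comm N 1)) (ℤ.∣-i∣≡∣i∣ i) le)

  -- Crossing the floor changes k along the positive one of wβ and -wβ from K to K - 1, or from -K -
  -- 1 to -K. Both lower the absolute value inside one region.
  no-non-Shi-floor : IsShiAlcove Φ θ m (w , c) → ¬ NonShiFloor
  no-non-Shi-floor shi floor@(inj₁ (pos , m<K)) = ∣i∣≰∣i-1∣ {Kℤ} (ℤ.≤-<-trans (ℤ.+≤+ ℕ.z≤n) m<K)
    (shi (w′ , c′) (same-region floor) (wact Φ w β) pos Kℤ (Kℤ ℤ.- ℤ.+ 1)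
      (between⇒KVal {w , c} Kℤ (λ x → eval x b) (λ x → trans (ip-act-wall x) (cong (_+ eval x b) (sym Kℤ≡)))
        eval-b-bounds)
      (between⇒KVal {w′ , c′} (Kℤ ℤ.- ℤ.+ 1) (λ x → 1ℚ - eval x b) (λ x → trans (ip-neighbour-wall x)
        (trans (solve 2 (λ k t → k :- t := (k :+ (:- con 1ℚ)) :+ (con 1ℚ :- t)) refl K (eval x b))
          (cong (_+ (1ℚ - eval x b)) (sym (trans (ℤ→ℚ-+ Kℤ (ℤ.- (ℤ.+ 1))) (cong (_+ - 1ℚ) Kℤ≡))))))
            1-eval-b-bounds))
  no-non-Shi-floor shi floor@(inj₂ ((wβ∈ , neg) , m≤K)) = ∣i+1∣≰∣i∣ {Kℤ} (ℤ.≤-trans (ℤ.+≤+ ℕ.z≤n) m≤K)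
    (shi (w′ , c′) (same-region floor) (⊝ wact Φ w β) (⊝-root wβ∈ , ⊝-nonneg neg) (ℤ.- (Kℤ ℤ.+ ℤ.+ 1))
      (ℤ.- Kℤ)
      (between⇒KVal {w , c} (ℤ.- (Kℤ ℤ.+ ℤ.+ 1)) (λ x → 1ℚ - eval x b)
        (λ x → trans (ipʳ.map-⊝ (act Φ (w , c) x) (wact Φ w β)) (trans (cong -_ (ip-act-wall x))
        (trans (solve 2 (λ k t → :- (k :+ t) := :- (k :+ con 1ℚ) :+ (con 1ℚ :- t)) refl K (eval x b))
          (cong (_+ (1ℚ - eval x b)) (sym (trans (ℤ→ℚ-neg (Kℤ ℤ.+ ℤ.+ 1))
            (cong -_ (trans (ℤ→ℚ-+ Kℤ (ℤ.+ 1)) (cong (_+ 1ℚ) Kℤ≡))))))))) 1-eval-b-bounds)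
      (between⇒KVal {w′ , c′} (ℤ.- Kℤ) (λ x → eval x b)
        (λ x → trans (ipʳ.map-⊝ (act Φ (w′ , c′) x) (wact Φ w β)) (trans (cong -_ (ip-neighbour-wall x))
        (trans (solve 2 (λ k t → :- (k :- t) := :- k :+ t) refl K (eval x b))
          (cong (_+ eval x b) (sym (trans (ℤ→ℚ-neg Kℤ) (cong -_ Kℤ≡))))))) eval-b-bounds))

  -- The pair is w̃(b + mδ). Its failing to be positive means m < K if wβ > 0 and m ≤ K if wβ < 0,
  -- which is exactly a non-Shi floor.
  push-shifted-positive : IsShiAlcove Φ θ m (w , c) → PosAff Φ (wact Φ w β , mℚ - K)
  push-shifted-positive shi = by-cases (pos⊎neg (wact-root w β∈))
    where
    by-cases : PosRoot Φ (wact Φ w β) ⊎ NegRoot Φ (wact Φ w β) → PosAff Φ (wact Φ w β , mℚ - K)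
    by-cases (inj₁ pos) = inj₁ (pos , ≮⇒≥ λ lt → no-non-Shi-floor shi
      (inj₁ (pos , ℤ→ℚ-cancel-< (subst (mℚ <_) (sym Kℤ≡)
      (<-by lt (solve 2 (λ m k → con 0ℚ :- (m :- k) := k :- m) refl mℚ K))))))
    by-cases (inj₂ neg) = inj₂ (neg , ≰⇒> λ le → no-non-Shi-floor shi
      (inj₂ (neg , ℤ→ℚ-cancel-≤ (subst (mℚ ≤_) (sym Kℤ≡)
      (≤-by le (solve 2 (λ m k → con 0ℚ :- (m :- k) := k :- m) refl mℚ K))))))

-- Affine roots of height m h + 1

module MinimalAlcoves {n} (Φ : RootSystem n) (θ : V n) (θ-highest : IsHighest Φ θ) (m : ℕ) (1≤m : 1 ℕ.≤ m)
  where
  open Alcoves Φ θ θ-highest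
  open Minimality m 1≤m public

  -- The level decides: negative levels give negative height, level 0 leaves a root of height 1,
  -- level 1 forces ht α = -ht θ and hence α = -θ, and from level 2 on the height exceeds h.
  affHeight-1⇒simple : ∀ {α l} → α ∈ roots → IsInt l → affHeight (l ∷ α) ≡ 1ℚ →
    ∃[ s ] (α ≡ simpleRoot s × l ≡ simpleLevel s)
  affHeight-1⇒simple {α} {l} α∈ hl eq = by-cases (IsInt-tri hl)
    where
    by-cases : l ≤ - 1ℚ ⊎ l ≡ 0ℚ ⊎ 1ℚ ≤ l → ∃[ s ] (α ≡ simpleRoot s × l ≡ simpleLevel s)
    by-cases (inj₁ l≤-1) = ⊥-elim (<⇒≱ (<-trans -1<0 0<1)
      (subst (_≤ - 1ℚ) eq (k≤-1⇒affHeight≤-1 {l} {α} (height-≤ α∈) l≤-1)))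
    by-cases (inj₂ (inj₁ refl)) = from (height-1⇒simple α∈ (trans (sym (affHeight-0∷ α)) eq))
      where
      from : ∃[ i ] α ≡ e i → ∃[ s ] (α ≡ simpleRoot s × 0ℚ ≡ simpleLevel s)
      from (i , α≡) = just i , α≡ , refl
    by-cases (inj₂ (inj₂ 1≤l)) = sub (IsInt-≡1⊎2≤ hl (<-≤-trans 0<1 1≤l))
      where
      sub : l ≡ 1ℚ ⊎ 2ℚ ≤ l → ∃[ s ] (α ≡ simpleRoot s × l ≡ simpleLevel s)
      sub (inj₁ refl) = nothing , trans (sym (⊝-involutive α))
        (cong ⊝_ (highest-unique (⊝-root α∈) height-⊝α)) , refl
        where
        height-⊝α : height (⊝ α) ≡ height θ
        height-⊝α = trans (Linear.map-⊝ sumV-linear α) (trans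
          (solve 2 (λ a t → :- a := con 1ℚ :+ t :- (a :+ con 1ℚ :* (con 1ℚ :+ t))) refl (height α)
            (height θ))
          (trans (cong (λ t → 1ℚ + height θ - t) eq) (solve 1 (λ t → con 1ℚ :+ t :- con 1ℚ := t)
            refl (height θ))))
      sub (inj₂ 2≤l) = ⊥-elim (<⇒≱ (positive⁻¹ 2ℚ)
        (≤-by (+-mono-≤ (1≤k⇒1≤affHeight {l - 1ℚ} {α} (height-≥ α∈) (≤-by 2≤l
            (solve 1 (λ l → l :- con 2ℚ := (l :- con 1ℚ) :- con 1ℚ) refl l))) 2≤h)
          (trans (solve 3 (λ a l h → ((a :+ (l :- con 1ℚ) :* h) :+ h) :- (con 1ℚ :+ con 2ℚ) := (a :+ l :* h)
            :- (con 1ℚ :+ con 2ℚ)) refl (height α) l h)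
            (trans (cong (_- (1ℚ + 2ℚ)) eq) refl))))

  -- Subtracting mδ from a root of height m h + 1 leaves height 1, so the condition need only be
  -- checked at b + mδ for affine simple b, one wall at a time.
  Shi⇒InWp : ∀ w̃ → IsShiAlcove Φ θ m w̃ → InWp Φ θ (M + 1ℚ) w̃
  Shi⇒InWp (w , c) shi α k α∈ eq = from (affHeight-1⇒simple α∈ (IsInt-- (k , refl) (ℤ.+ m , refl))
      (trans (solve 4 (λ a k m h → a :+ (k :- m) :* h := (a :+ k :* h) :- m :* h) refl (height α)
        (ℤ→ℚ k) mℚ h)
        (trans (cong (_- M) eq) (solve 1 (λ M → (M :+ con 1ℚ) :- M := con 1ℚ) refl M))))
    where
    from : ∃[ s ] (α ≡ simpleRoot s × ℤ→ℚ k - mℚ ≡ simpleLevel s) → PosAff Φ (affAct Φ (w , c) α (ℤ→ℚ k))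
    from (s , refl , level) = subst (λ t → PosAff Φ (wact Φ w (simpleRoot s) , t)) (trans
        (trans (solve 3 (λ m q j → m :- (q :- j) := (m :+ j) :- q) refl mℚ
          (ip (coweight Φ c) (simpleRoot s)) (simpleLevel s))
          (trans (cong (λ t → (mℚ + t) - ip (coweight Φ c) (simpleRoot s)) (sym level))
            (cong (_- ip (coweight Φ c) (simpleRoot s)) (solve 2 (λ m k → m :+ (k :- m) := k) refl mℚ
              (ℤ→ℚ k)))))
        (cong (λ t → ℤ→ℚ k - t) (ip-def (coweight Φ c) (simpleRoot s))))
      (WallReflection.push-shifted-positive Φ θ θ-highest m 1≤m w c s shi)

theorem12p6 : (n : ℕ) (Φ : RootSystem (suc n)) (θ : V (suc n)) → IsHighest Φ θ →
    (m : ℕ) → 1 ℕ.≤ m → (w̃ : AffW Φ) →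
    IsShiAlcove Φ θ m w̃ ⇔ InWp Φ θ (ℕ→ℚ m * cox Φ θ + 1ℚ) w̃
theorem12p6 n Φ θ θ-highest m 1≤m w̃ = mk⇔ (Shi⇒InWp w̃) (InWp⇒Shi w̃)
  where open MinimalAlcoves Φ θ θ-highest m 1≤m
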